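{- Let $R$ be a field of characteristic zero, $n\ge1$ and $0\ne q\in R$. Then $\{I(\lambda):\lambda\text{ a signed partition of }n\}$ is a complete set of pairwise non-isomorphic irreducible $\Sigma_q(n)$-modules.
   Context: A signed composition of $n$ is a sequence $\mu=(\mu_1,\dots,\mu_k)$ of nonzero integers with $\sum|\mu_i|=n$; it is a signed partition if $\mu_1\ge\mu_2\ge\dots\ge\mu_k$. For signed compositions $\mu$ (length $k$) and $\nu$ (length $l$) let $\mathcal N_{\mu\nu}$ be the set of $k\times l$ integer matrices $M=(m_{ij})$ with $\sum_j|m_{ij}|=|\mu_i|$, $\sum_i|m_{ij}|=|\nu_j|$, $m_{ij}\le0$ whenever $\mu_i<0$ or $\nu_j<0$, and $m_{ij}\ge0$ whenever $\mu_i>0$ and $\nu_j>0$. Put $\operatorname{wt}(M)=-\sum_{i:\mu_i<0,\ j:\nu_j<0}m_{ij}$ and let $\operatorname{comp}(M)$ be the signed composition listing the nonzero entries of $M$ row by row, left to right. $d_{\mu\nu\sigma}(x)=\sum_{M\in\mathcal N_{\mu\nu},\ \operatorname{comp}(M)=\sigma}x^{\operatorname{wt}(M)}$. $\Sigma_q(n)$ is the $R$-algebra with generators $\{E_\mu\}$ and relations $E_\mu E_\nu=\sum_\sigma d_{\mu\nu\sigma}(q)E_\sigma$. For a signed composition $\lambda$, $I(\lambda)$ is the one-dimensional $\Sigma_q(n)$-module on which each $E_\alpha$ acts as multiplication by $d_{\lambda\alpha\lambda}(q)$. -}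

module Defs where

open import Level using (Level; _⊔_) renaming (suc to lsuc)
open import Data.Bool using (Bool; true; false; _∧_; _∨_; T; if_then_else_)
open import Data.Bool.Properties using (T?)
open import Data.Nat as ℕ using (ℕ; zero; suc)
open import Data.Integer as ℤ using (ℤ; +_; -[1+_]; ∣_∣)
import Data.Integer.Properties as ℤP
open import Data.List using (List; []; _∷_; _++_; map; concat; concatMap; upTo; length; zipWith; foldr; filterᵇ)
open import Data.Bool.ListAction using (and)
import Data.List.Properties as ListP
open import Data.List.Relation.Unary.Linked using (Linked)
open import Data.Product using (Σ; _×_; _,_; ∃)
open import Relation.Nullary using (¬_; Dec; yes; no)
open import Relation.Nullary.Decidable using (⌊_⌋)
open import Relation.Binary.PropositionalEquality using (_≡_)
open import Algebra.Bundles using (CommutativeRing; Ring)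
open import Algebra.Module.Bundles using (LeftModule)
import Algebra.Module.Construct.TensorUnit as TensorUnit

record Field (c ℓ : Level) : Set (lsuc (c ⊔ ℓ)) where
  field
    commutativeRing : CommutativeRing c ℓ
  open CommutativeRing commutativeRing public
  field
    0≉1     : ¬ (0# ≈ 1#)
    inverse : ∀ x → ¬ (x ≈ 0#) → Σ Carrier λ y → x * y ≈ 1#

module _ {c ℓ : Level} (R : Field c ℓ) where
  open Field R

  ℕ→R : ℕ → Carrier
  ℕ→R zero    = 0#
  ℕ→R (suc k) = 1# + ℕ→R k

  CharacteristicZero : Set ℓ
  CharacteristicZero = ∀ k → ¬ (ℕ→R (suc k) ≈ 0#)

  infixr 8 _^_
  _^_ : Carrier → ℕ → Carrier
  x ^ zero  = 1#
  x ^ suc k = x * (x ^ k)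

isNonzero : ℤ → Bool
isNonzero (+ zero) = false
isNonzero _        = true

isNeg : ℤ → Bool
isNeg -[1+ _ ] = true
isNeg (+ _)    = false

absSum : List ℤ → ℕ
absSum μ = foldr ℕ._+_ 0 (map ∣_∣ μ)

isSignedComp : ℕ → List ℤ → Bool
isSignedComp n μ = and (map isNonzero μ) ∧ ⌊ absSum μ ℕ.≟ n ⌋

record SignedComp (n : ℕ) : Set where
  constructor sc
  field
    parts : List ℤ
    valid : T (isSignedComp n parts)
open SignedComp public

IsSignedPartition : {n : ℕ} → SignedComp n → Set
IsSignedPartition μ = Linked ℤ._≥_ (parts μ)

box : ℕ → List ℤ
box N = map +_ (upTo (suc N)) ++ map -[1+_] (upTo N)

words : {A : Set} → List A → ℕ → List (List A)
words xs zero    = [] ∷ []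
words xs (suc l) = concatMap (λ x → map (x ∷_) (words xs l)) xs

withProof : {A : Set} (P : A → Bool) → List A → List (Σ A (λ a → T (P a)))
withProof P []       = []
withProof P (x ∷ xs) with T? (P x)
... | yes p = (x , p) ∷ withProof P xs
... | no _  = withProof P xs

-- all signed compositions of n (each exactly once); their lengths are ≤ n
-- and their entries have absolute value ≤ n
allSignedComps : (n : ℕ) → List (SignedComp n)
allSignedComps n =
  map (λ p → sc (Data.Product.proj₁ p) (Data.Product.proj₂ p))
      (withProof (isSignedComp n) (concatMap (words (box n)) (upTo (suc n))))

-- The matrices 𝒩_{μν}.  A k×l integer matrix is a list of k rows, each
-- a list of l integers.

entry : ℕ → List ℤ → ℤ
entry j       []       = + 0
entry zero    (x ∷ xs) = x
entry (suc j) (x ∷ xs) = entry j xs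

column : List (List ℤ) → ℕ → List ℤ
column M j = map (entry j) M

infix 4 _≤ᵇ_
_≤ᵇ_ : ℤ → ℤ → Bool
a ≤ᵇ b = ⌊ a ℤ.≤? b ⌋

-- m_ij ≤ 0 if μ_i < 0 or ν_j < 0, and m_ij ≥ 0 if μ_i > 0 and ν_j > 0
-- (entries of signed compositions are nonzero)
signOK : ℤ → ℤ → ℤ → Bool
signOK a b m = if isNeg a ∨ isNeg b then (m ≤ᵇ ℤ.0ℤ) else (ℤ.0ℤ ≤ᵇ m)

inN : List ℤ → List ℤ → List (List ℤ) → Bool
inN μ ν M =
  ⌊ length M ℕ.≟ length μ ⌋
  ∧ and (map (λ row → ⌊ length row ℕ.≟ length ν ⌋) M)
  ∧ and (zipWith (λ a row → ⌊ absSum row ℕ.≟ ∣ a ∣ ⌋) μ M)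
  ∧ and (zipWith (λ b j → ⌊ absSum (column M j) ℕ.≟ ∣ b ∣ ⌋) ν (upTo (length ν)))
  ∧ and (zipWith (λ a row → and (zipWith (λ b m → signOK a b m) ν row)) μ M)

-- the list of all elements of 𝒩_{μν} (each exactly once): every entry of
-- such an M satisfies |m_ij| ≤ |μ_i| ≤ Σ|μ_i|
𝒩 : List ℤ → List ℤ → List (List (List ℤ))
𝒩 μ ν = filterᵇ (inN μ ν) (words (words (box (absSum μ)) (length ν)) (length μ))

-- wt(M) = - Σ_{μ_i<0, ν_j<0} m_ij   (an integer, ≥ 0 on 𝒩_{μν})
wt : List ℤ → List ℤ → List (List ℤ) → ℤ
wt μ ν M = ℤ.- foldr ℤ._+_ (+ 0)
  (concat (zipWith (λ a row → zipWith (λ b m → if isNeg a ∧ isNeg b then m else + 0) ν row) μ M))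

comp : List (List ℤ) → List ℤ
comp M = filterᵇ isNonzero (concat M)

module _ {c ℓ : Level} (R : Field c ℓ) where
  open Field R

  sumR : List Carrier → Carrier
  sumR = foldr _+_ 0#

  d : Carrier → List ℤ → List ℤ → List ℤ → Carrier
  d q μ ν σ = sumR (map (λ M → _^_ R q ∣ wt μ ν M ∣)
                       (filterᵇ (λ M → ⌊ ListP.≡-dec ℤP._≟_ (comp M) σ ⌋) (𝒩 μ ν)))

-- Σ_q(n)-modules.  A Σ_q(n)-module is an R-module V with an R-linear
-- action of each generator E_μ satisfying the defining relations, and on
-- which the unit E_(n) of Σ_q(n) acts as the identity.

module _ {c ℓ : Level} (R : Field c ℓ) where
  open Field R

  record SigmaRep (n : ℕ) (m ℓm : Level) : Set (c ⊔ ℓ ⊔ lsuc (m ⊔ ℓm)) where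
    field
      carrierModule : LeftModule ring m ℓm
    open LeftModule carrierModule public
    field
      act : SignedComp n → Carrierᴹ → Carrierᴹ

  module _ {n : ℕ} {m ℓm : Level} (V : SigmaRep n m ℓm) where
    open SigmaRep V

    sumᴹ : List Carrierᴹ → Carrierᴹ
    sumᴹ = foldr _+ᴹ_ 0ᴹ

    record IsSigmaModule (q : Carrier) : Set (c ⊔ m ⊔ ℓm) where
      field
        act-cong : ∀ μ {x y} → x ≈ᴹ y → act μ x ≈ᴹ act μ y
        act-+    : ∀ μ x y → act μ (x +ᴹ y) ≈ᴹ act μ x +ᴹ act μ y
        act-*ₗ   : ∀ μ r x → act μ (r *ₗ x) ≈ᴹ r *ₗ act μ x
        act-rel  : ∀ μ ν x →
          act μ (act ν x) ≈ᴹ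
            sumᴹ (map (λ σ → d R q (parts μ) (parts ν) (parts σ) *ₗ act σ x) (allSignedComps n))
        act-unit : ∀ μ → parts μ ≡ (+ n ∷ []) → ∀ x → act μ x ≈ᴹ x

    record IsSubmodule (S : Carrierᴹ → Set (c ⊔ ℓ ⊔ m ⊔ ℓm)) : Set (c ⊔ ℓ ⊔ m ⊔ ℓm) where
      field
        resp : ∀ {x y} → x ≈ᴹ y → S x → S y
        0-closed : S 0ᴹ
        +-closed : ∀ {x y} → S x → S y → S (x +ᴹ y)
        *ₗ-closed : ∀ r {x} → S x → S (r *ₗ x)
        act-closed : ∀ μ {x} → S x → S (act μ x)

    record Irreducible : Set (lsuc (c ⊔ ℓ ⊔ m ⊔ ℓm)) where
      field
        nonzero : ∃ λ x → ¬ (x ≈ᴹ 0ᴹ)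
        simple  : ∀ S → IsSubmodule S → (∃ λ x → S x × ¬ (x ≈ᴹ 0ᴹ)) → ∀ y → S y

  record Iso {n : ℕ} {m₁ ℓ₁ m₂ ℓ₂ : Level} (V : SigmaRep n m₁ ℓ₁) (W : SigmaRep n m₂ ℓ₂)
           : Set (c ⊔ m₁ ⊔ ℓ₁ ⊔ m₂ ⊔ ℓ₂) where
    module V = SigmaRep V
    module W = SigmaRep W
    field
      f         : V.Carrierᴹ → W.Carrierᴹ
      f-cong    : ∀ {x y} → x V.≈ᴹ y → f x W.≈ᴹ f y
      f-+       : ∀ x y → f (x V.+ᴹ y) W.≈ᴹ f x W.+ᴹ f y
      f-*ₗ      : ∀ r x → f (r V.*ₗ x) W.≈ᴹ r W.*ₗ f x
      f-act     : ∀ μ x → f (V.act μ x) W.≈ᴹ W.act μ (f x)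
      injective : ∀ {x y} → f x W.≈ᴹ f y → x V.≈ᴹ y
      surjective : ∀ y → ∃ λ x → f x W.≈ᴹ y

  I : {n : ℕ} → Carrier → SignedComp n → SigmaRep n c ℓ
  I q lam = record
    { carrierModule = TensorUnit.leftModule {R = ring}
    ; act = λ α x → d R q (parts lam) (parts α) (parts lam) * x
    }

{-# OPTIONS --safe #-}

-- Assign to each part of λ a slot of σ, a negative slot accepting only negative
-- parts, and let N(λ,σ) count the assignments which fill every slot exactly.
-- Matrices M with comp(M) = λ have one entry per row, so they are such assignments,
-- and all have weight negSum(σ), the total size of the negative parts of σ; hence
-- d_{λσλ} = q^negSum(σ) N(λ,σ).  A pair of assignments to the rows and to the columns
-- is an assignment to cells, so Σ_{M ∈ 𝒩_{μν}} N(λ, comp M) = N(λ,μ) N(λ,ν); together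
-- with wt(M) + negSum(comp M) = negSum(μ) + negSum(ν) this makes σ ↦ d_{λσλ} a
-- character of Σ_q(n), for every signed composition λ.
--
-- Let rank(σ) be the length of σ plus the number of its negative parts.  If
-- M ∈ 𝒩_{λα}, then comp(M) = λ or rank(comp M) > rank(λ).  So if E_λ has maximal rank
-- among the generators acting nontrivially on an irreducible V, then
-- E_λ E_α = d_{λαλ} E_λ on V; the kernel of E_λ is a submodule, hence zero, and each
-- E_α acts as the scalar d_{λαλ}.  Thus V is one-dimensional, and λ may be sorted
-- since N(λ,α) is symmetric in the parts of λ.  The rank argument applied to the
-- columns shows that N(λ,σ) and N(σ,λ) are both nonzero only if σ permutes λ.

module Submission where

open import Defs
open import Algebra.Bundles using (CommutativeMonoid)
open import Algebra.Module.Bundles using (LeftModule)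
import Algebra.Properties.Group as GroupProperties
open import Axiom.ExcludedMiddle using (ExcludedMiddle)
open import Data.Bool using (Bool; true; false; T; _∧_; _∨_; not; if_then_else_)
open import Data.Bool.ListAction using (and)
open import Data.Bool.Properties using (T?; T-irrelevant)
open import Data.Empty using (⊥-elim)
open import Data.Integer as ℤ using (ℤ; +_; -[1+_]; ∣_∣)
import Data.Integer.Properties as ℤP
open import Data.List using (List; []; _∷_; _++_; map; concat; concatMap; upTo; length; zipWith; foldr; filterᵇ; cartesianProductWith; applyUpTo; replicate)
open import Data.List.Membership.Propositional using (_∈_)
open import Data.List.Membership.Propositional.Properties
import Data.List.Properties as ListP
open import Data.List.Relation.Binary.Permutation.Propositional as ↭ using (_↭_; ↭-refl; ↭-sym; ↭-trans; ↭-prep; ↭⇒↭ₛ′)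
import Data.List.Relation.Binary.Permutation.Propositional.Properties as ↭P
open import Data.List.Relation.Binary.Pointwise as PW using (Pointwise; []; _∷_)
open import Data.List.Relation.Unary.All as All using (All; []; _∷_)
import Data.List.Relation.Unary.All.Properties as AllP
open import Data.List.Relation.Unary.AllPairs using ([]; _∷_)
import Data.List.Relation.Unary.AllPairs as AllPairs
import Data.List.Relation.Unary.AllPairs.Properties as AllPairsP
open import Data.List.Relation.Unary.Any using (here; there)
open import Data.List.Relation.Unary.Linked using (Linked)
open import Data.List.Relation.Unary.Sorted.TotalOrder.Properties using (↗↭↗⇒≋)
open import Data.List.Relation.Unary.Unique.Propositional using (Unique)
import Data.List.Relation.Unary.Unique.Propositional.Properties as Uniq
open import Data.Nat as ℕ using (ℕ; zero; suc; _≤_; _<_; z≤n; s≤s)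
open import Data.Nat.ListAction.Properties using (sum-↭)
import Data.Nat.Properties as ℕP
open import Data.Nat.Solver using (module +-*-Solver)
open import Data.Product using (Σ; _×_; _,_; ∃; proj₁; proj₂)
open import Data.Sum using (_⊎_; inj₁; inj₂)
open import Function using (_∘_)
open import Level using (Level; _⊔_; 0ℓ; Lift; lift; lower)
open import Relation.Binary.Bundles using (DecTotalOrder)
import Relation.Binary.Construct.Flip.EqAndOrd as Flip
open import Relation.Binary.PropositionalEquality using (_≡_; _≢_; refl; sym; trans; cong; cong₂; subst; subst₂; module ≡-Reasoning)
import Relation.Binary.Reasoning.Setoid as SetoidReasoning
open import Relation.Nullary using (¬_; yes; no; contradiction)
open import Relation.Nullary.Decidable using (⌊_⌋; toWitness; fromWitness)

-- Counts are compared without bijections. Each enumeration is summed against an arbitrary test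
-- function, and the induction over slots, cells or parts changes that function; this is why the
-- counting lemmas carry a parameter `H`, `G` or `K`. The obstacle in the product formula is that
-- `comp` drops zero entries, so the slots of `comp M` vary with M. The count is therefore first
-- moved to a rectangle with one slot for every cell, zero cells included. Its slots depend only on
-- the signs of μ and ν, and the sums over matrices and over assignments can be exchanged. The rank
-- counts negative parts twice because a positive row may have a single entry in a negative column.
-- That entry is negative, and the length alone would not tell comp(M) from λ. Characteristic zero
-- and q ≠ 0 keep d_{λλλ} nonzero: N(λ,λ) is at least 1, since every part may go into its own slot.
-- Excluded middle finds the generator of maximal rank and turns "not unequal to zero" into
-- equality.

private variable
  ℓ₁ ℓ₂ ℓ₃ ℓ₄ : Level
  X : Set ℓ₁
  Y : Set ℓ₂

-- Finite sums and enumerations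

module Sum (M : CommutativeMonoid ℓ₃ ℓ₄) where
  open CommutativeMonoid M renaming (refl to ≈-refl; sym to ≈-sym; trans to ≈-trans)
  open import Relation.Binary.Reasoning.Setoid setoid
  open import Algebra.Properties.CommutativeSemigroup commutativeSemigroup using (interchange)

  ∑ : List X → (X → Carrier) → Carrier
  ∑ xs f = foldr _∙_ ε (map f xs)

  ∑-cong-∈ : {f g : X → Carrier} (xs : List X) → (∀ x → x ∈ xs → f x ≈ g x) → ∑ xs f ≈ ∑ xs g
  ∑-cong-∈ [] h = ≈-refl
  ∑-cong-∈ (x ∷ xs) h = ∙-cong (h x (here refl)) (∑-cong-∈ xs (λ y y∈ → h y (there y∈)))

  ∑-cong : {f g : X → Carrier} (xs : List X) → (∀ x → f x ≈ g x) → ∑ xs f ≈ ∑ xs g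
  ∑-cong xs h = ∑-cong-∈ xs (λ x _ → h x)

  ∑-zero : {f : X → Carrier} (xs : List X) → (∀ x → x ∈ xs → f x ≈ ε) → ∑ xs f ≈ ε
  ∑-zero [] h = ≈-refl
  ∑-zero (x ∷ xs) h = ≈-trans (∙-cong (h x (here refl)) (∑-zero xs (λ y y∈ → h y (there y∈)))) (identityˡ ε)

  ∑-++ : (f : X → Carrier) (xs ys : List X) → ∑ (xs ++ ys) f ≈ ∑ xs f ∙ ∑ ys f
  ∑-++ f [] ys = ≈-sym (identityˡ _)
  ∑-++ f (x ∷ xs) ys = begin
    f x ∙ ∑ (xs ++ ys) f      ≈⟨ ∙-congˡ (∑-++ f xs ys) ⟩
    f x ∙ (∑ xs f ∙ ∑ ys f)   ≈⟨ assoc _ _ _ ⟨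
    f x ∙ ∑ xs f ∙ ∑ ys f     ∎

  ∑-map : (f : Y → Carrier) (g : X → Y) (xs : List X) → ∑ (map g xs) f ≡ ∑ xs (f ∘ g)
  ∑-map f g xs = cong (foldr _∙_ ε) (sym (ListP.map-∘ xs))

  ∑-concatMap : (f : Y → Carrier) (g : X → List Y) (xs : List X) → ∑ (concatMap g xs) f ≈ ∑ xs (λ x → ∑ (g x) f)
  ∑-concatMap f g [] = ≈-refl
  ∑-concatMap f g (x ∷ xs) = ≈-trans (∑-++ f (g x) (concatMap g xs)) (∙-congˡ (∑-concatMap f g xs))

  ∑-∙ : (f g : X → Carrier) (xs : List X) → ∑ xs (λ x → f x ∙ g x) ≈ ∑ xs f ∙ ∑ xs g
  ∑-∙ f g [] = ≈-sym (identityˡ ε)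
  ∑-∙ f g (x ∷ xs) = ≈-trans (∙-congˡ (∑-∙ f g xs)) (interchange _ _ _ _)

  ∑-swap : (f : X → Y → Carrier) (xs : List X) (ys : List Y) →
    ∑ xs (λ x → ∑ ys (f x)) ≈ ∑ ys (λ y → ∑ xs (λ x → f x y))
  ∑-swap f [] ys = ≈-sym (∑-zero ys (λ _ _ → ≈-refl))
  ∑-swap f (x ∷ xs) ys = ≈-trans (∙-congˡ (∑-swap f xs ys))
    (≈-sym (∑-∙ (f x) (λ y → ∑ xs (λ x′ → f x′ y)) ys))

  ∑-single : {f : X → Carrier} {xs : List X} {x₀ : X} → Unique xs → x₀ ∈ xs →
    (∀ x → x ≢ x₀ → f x ≈ ε) → ∑ xs f ≈ f x₀
  ∑-single {xs = x ∷ xs} (x∉ ∷ u) (here refl) h =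
    ≈-trans (∙-congˡ (∑-zero xs (λ y y∈ → h y (λ y≡x → All.lookup x∉ y∈ (sym y≡x))))) (identityʳ _)
  ∑-single {xs = x ∷ xs} (x∉ ∷ u) (there x₀∈) h =
    ≈-trans (∙-cong (h x (All.lookup x∉ x₀∈)) (∑-single u x₀∈ h)) (identityˡ _)

module ℕΣ = Sum ℕP.+-0-commutativeMonoid
open ℕΣ public using (∑; ∑-cong-∈; ∑-cong; ∑-zero; ∑-++; ∑-map; ∑-concatMap; ∑-swap; ∑-single)

*-∑ : (k : ℕ) (f : X → ℕ) (xs : List X) → ∑ xs (λ x → k ℕ.* f x) ≡ k ℕ.* ∑ xs f
*-∑ k f [] = sym (ℕP.*-zeroʳ k)
*-∑ k f (x ∷ xs) = trans (cong (k ℕ.* f x ℕ.+_) (*-∑ k f xs)) (sym (ℕP.*-distribˡ-+ k (f x) (∑ xs f)))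

∑-* : (k : ℕ) (f : X → ℕ) (xs : List X) → ∑ xs (λ x → f x ℕ.* k) ≡ ∑ xs f ℕ.* k
∑-* k f [] = refl
∑-* k f (x ∷ xs) = trans (cong (f x ℕ.* k ℕ.+_) (∑-* k f xs)) (sym (ℕP.*-distribʳ-+ k (f x) (∑ xs f)))

⟦_⟧ : Bool → ℕ
⟦ true ⟧  = 1
⟦ false ⟧ = 0

⟦∧⟧ : ∀ x y → ⟦ x ∧ y ⟧ ≡ ⟦ x ⟧ ℕ.* ⟦ y ⟧
⟦∧⟧ true y  = sym (ℕP.+-identityʳ ⟦ y ⟧)
⟦∧⟧ false y = refl

¬T⇒≡false : ∀ {x} → ¬ T x → x ≡ false
¬T⇒≡false {false} h = refl
¬T⇒≡false {true} h = ⊥-elim (h _)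

T⇒≡true : ∀ {x} → T x → x ≡ true
T⇒≡true {true} h = refl

T-∧⁻ : ∀ {x y} → T (x ∧ y) → T x × T y
T-∧⁻ {true} h = _ , h

T-∧⁺ : ∀ {x y} → T x → T y → T (x ∧ y)
T-∧⁺ {true} _ h = h

T-ext : ∀ {x y} → (T x → T y) → (T y → T x) → x ≡ y
T-ext {true} f g = sym (T⇒≡true (f _))
T-ext {false} {true} f g = ⊥-elim (g _)
T-ext {false} {false} f g = refl

⟦⟧-zero : ∀ {x} → ¬ T x → ⟦ x ⟧ ≡ 0
⟦⟧-zero h = cong ⟦_⟧ (¬T⇒≡false h)

∑-filterᵇ : (P : X → Bool) (f : X → ℕ) (xs : List X) → ∑ (filterᵇ P xs) f ≡ ∑ xs (λ x → ⟦ P x ⟧ ℕ.* f x)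
∑-filterᵇ P f [] = refl
∑-filterᵇ P f (x ∷ xs) with P x
... | true  = cong₂ ℕ._+_ (sym (ℕP.+-identityʳ (f x))) (∑-filterᵇ P f xs)
... | false = ∑-filterᵇ P f xs

length≡∑ : (xs : List X) → length xs ≡ ∑ xs (λ _ → 1)
length≡∑ [] = refl
length≡∑ (x ∷ xs) = cong suc (length≡∑ xs)

-- Entries, rows and matrices are enumerated by brute force over `box`; a predicate with a single
-- solution collapses such an enumeration to one term.
∑-indicator : (P : X → Bool) (f : X → ℕ) {xs : List X} {x₀ : X} → Unique xs → x₀ ∈ xs →
  T (P x₀) → (∀ x → T (P x) → x ≡ x₀) → ∑ xs (λ x → ⟦ P x ⟧ ℕ.* f x) ≡ f x₀
∑-indicator P f {x₀ = x₀} u x₀∈ Px₀ h =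
  trans (∑-single u x₀∈ (λ x x≢x₀ → cong (ℕ._* f x) (⟦⟧-zero (λ Px → x≢x₀ (h x Px)))))
        (trans (cong (λ t → ⟦ t ⟧ ℕ.* f x₀) (T⇒≡true Px₀)) (ℕP.*-identityˡ _))

words-suc : (xs : List X) (k : ℕ) → words xs (suc k) ≡ cartesianProductWith _∷_ xs (words xs k)
words-suc xs k = go xs
  where
  go : ∀ ys → concatMap (λ x → map (x ∷_) (words xs k)) ys ≡ cartesianProductWith _∷_ ys (words xs k)
  go [] = refl
  go (y ∷ ys) = cong (map (y ∷_) (words xs k) ++_) (go ys)

words-Unique : {xs : List X} → Unique xs → ∀ k → Unique (words xs k)
words-Unique u zero = [] ∷ []
words-Unique {xs = xs} u (suc k) = subst Unique (sym (words-suc xs k))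
  (Uniq.cartesianProductWith⁺ _∷_ (λ eq → ListP.∷-injectiveˡ eq , ListP.∷-injectiveʳ eq) u (words-Unique u k))

∈-words⁺ : {xs w : List X} → All (_∈ xs) w → w ∈ words xs (length w)
∈-words⁺ [] = here refl
∈-words⁺ {xs = xs} {w = x ∷ w} (x∈ ∷ w∈) =
  subst (x ∷ w ∈_) (sym (words-suc xs (length w))) (∈-cartesianProductWith⁺ _∷_ x∈ (∈-words⁺ w∈))

∈-words⁻ : {xs w : List X} (k : ℕ) → w ∈ words xs k → length w ≡ k × All (_∈ xs) w
∈-words⁻ zero (here refl) = refl , []
∈-words⁻ {xs = xs} {w} (suc k) w∈
  with x , v , x∈ , v∈ , refl ← ∈-cartesianProductWith⁻ _∷_ xs (words xs k) (subst (w ∈_) (words-suc xs k) w∈)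
  = let eq , all = ∈-words⁻ k v∈ in cong suc eq , x∈ ∷ all

∑-words-suc : (xs : List X) (k : ℕ) (f : List X → ℕ) →
  ∑ (words xs (suc k)) f ≡ ∑ xs (λ x → ∑ (words xs k) (λ w → f (x ∷ w)))
∑-words-suc xs k f = trans (∑-concatMap f (λ x → map (x ∷_) (words xs k)) xs)
  (∑-cong xs (λ x → ∑-map f (x ∷_) (words xs k)))

box-Unique : ∀ N → Unique (box N)
box-Unique N = Uniq.++⁺ (Uniq.map⁺ (λ { refl → refl }) (Uniq.upTo⁺ (suc N)))
  (Uniq.map⁺ (λ { refl → refl }) (Uniq.upTo⁺ N))
  (λ (x∈₁ , x∈₂) → disj (∈-map⁻ +_ x∈₁) (∈-map⁻ -[1+_] x∈₂))
  where
  disj : ∀ {x : ℤ} → (∃ λ y → y ∈ upTo (suc N) × x ≡ + y) → ¬ (∃ λ y → y ∈ upTo N × x ≡ -[1+ y ])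
  disj (_ , _ , refl) (_ , _ , ())

∈-box : ∀ {N} x → ∣ x ∣ ≤ N → x ∈ box N
∈-box (+ k) h = ∈-++⁺ˡ (∈-map⁺ +_ (∈-upTo⁺ (ℕ.s≤s h)))
∈-box {N} -[1+ k ] h = ∈-++⁺ʳ (map +_ (upTo (suc N))) (∈-map⁺ -[1+_] (∈-upTo⁺ h))

-- Matrices, ranks and placements of parts

zip-and⁻ : (f : X → Y → Bool) (xs : List X) (ys : List Y) → length xs ≡ length ys →
  T (and (zipWith f xs ys)) → Pointwise (λ x y → T (f x y)) xs ys
zip-and⁻ f [] [] eq h = []
zip-and⁻ f (x ∷ xs) (y ∷ ys) eq h =
  let h₁ , h₂ = T-∧⁻ h in h₁ ∷ zip-and⁻ f xs ys (ℕP.suc-injective eq) h₂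

zip-and⁺ : (f : X → Y → Bool) {xs : List X} {ys : List Y} →
  Pointwise (λ x y → T (f x y)) xs ys → T (and (zipWith f xs ys))
zip-and⁺ f [] = _
zip-and⁺ f (p ∷ ps) = T-∧⁺ p (zip-and⁺ f ps)

map-and⁻ : (f : X → Bool) (xs : List X) → T (and (map f xs)) → All (T ∘ f) xs
map-and⁻ f [] h = []
map-and⁻ f (x ∷ xs) h = let h₁ , h₂ = T-∧⁻ h in h₁ ∷ map-and⁻ f xs h₂

map-and⁺ : (f : X → Bool) {xs : List X} → All (T ∘ f) xs → T (and (map f xs))
map-and⁺ f [] = _
map-and⁺ f (p ∷ ps) = T-∧⁺ p (map-and⁺ f ps)

abss : List ℤ → List ℕ
abss = map ∣_∣

-- A recursion on rows in place of the indexed `column`, so that inductions can peel off one row;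
-- `l` keeps the width when no row is left.
colSums : ℕ → List (List ℕ) → List ℕ
colSums l []      = replicate l 0
colSums l (r ∷ M) = zipWith ℕ._+_ r (colSums l M)

entries-upTo : (r : List ℤ) → map (λ j → ∣ entry j r ∣) (upTo (length r)) ≡ abss r
entries-upTo r = trans (ListP.map-upTo _ (length r)) (go r)
  where
  go : ∀ r → applyUpTo (λ j → ∣ entry j r ∣) (length r) ≡ abss r
  go []      = refl
  go (x ∷ r) = cong (∣ x ∣ ∷_) (go r)

map-zipWith-+ : (f g : X → ℕ) (xs : List X) →
  map (λ x → f x ℕ.+ g x) xs ≡ zipWith ℕ._+_ (map f xs) (map g xs)
map-zipWith-+ f g [] = refl
map-zipWith-+ f g (x ∷ xs) = cong (_ ∷_) (map-zipWith-+ f g xs)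

column-colSums : ∀ l (M : List (List ℤ)) → All (λ r → length r ≡ l) M →
  map (λ j → absSum (column M j)) (upTo l) ≡ colSums l (map abss M)
column-colSums l [] [] = trans (zeros (upTo l)) (cong (λ k → replicate k 0) (ListP.length-upTo l))
  where
  zeros : ∀ (js : List ℕ) → map (λ _ → 0) js ≡ replicate (length js) 0
  zeros []       = refl
  zeros (_ ∷ js) = cong (0 ∷_) (zeros js)
column-colSums .(length r) (r ∷ M) (refl ∷ h) =
  trans (map-zipWith-+ (λ j → ∣ entry j r ∣) (λ j → absSum (column M j)) (upTo (length r)))
        (cong₂ (zipWith ℕ._+_) (entries-upTo r) (column-colSums (length r) M h))

Row : List ℤ → ℤ → List ℤ → Set
Row ν a r = length r ≡ length ν × absSum r ≡ ∣ a ∣ × Pointwise (λ b m → T (signOK a b m)) ν r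

-- The tests of `inN` regrouped: all conditions on a single row travel with that row, and the column
-- sums form one list equation.
record IsMat (μ ν : List ℤ) (M : List (List ℤ)) : Set where
  constructor mat
  field
    rows : Pointwise (Row ν) μ M
    cols : colSums (length ν) (map abss M) ≡ abss ν
open IsMat public

rows-length : ∀ {μ ν M} → Pointwise (Row ν) μ M → All (λ r → length r ≡ length ν) M
rows-length [] = []
rows-length ((p , _) ∷ ps) = p ∷ rows-length ps

private
  pointwise-map≡ : (f : X → ℕ) (g : Y → ℕ) {xs : List X} {ys : List Y} →
    Pointwise (λ x y → T ⌊ g y ℕ.≟ f x ⌋) xs ys → map g ys ≡ map f xs
  pointwise-map≡ f g [] = refl
  pointwise-map≡ f g (p ∷ ps) = cong₂ _∷_ (toWitness p) (pointwise-map≡ f g ps)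

  map≡-pointwise : (f : X → ℕ) (g : Y → ℕ) (xs : List X) (ys : List Y) →
    map g ys ≡ map f xs → Pointwise (λ x y → T ⌊ g y ℕ.≟ f x ⌋) xs ys
  map≡-pointwise f g [] [] eq = []
  map≡-pointwise f g (x ∷ xs) (y ∷ ys) eq =
    fromWitness (ListP.∷-injectiveˡ eq) ∷ map≡-pointwise f g xs ys (ListP.∷-injectiveʳ eq)

  split-rows : ∀ {μ ν M} → All (λ r → T ⌊ length r ℕ.≟ length ν ⌋) M →
    Pointwise (λ a r → T ⌊ absSum r ℕ.≟ ∣ a ∣ ⌋) μ M →
    Pointwise (λ a r → T (and (zipWith (signOK a) ν r))) μ M → Pointwise (Row ν) μ M
  split-rows [] [] [] = []
  split-rows {ν = ν} (l ∷ ls) (s ∷ ss) (o ∷ os) =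
    (toWitness l , toWitness s , zip-and⁻ _ ν _ (sym (toWitness l)) o) ∷ split-rows ls ss os

inN⁻ : ∀ μ ν M → T (inN μ ν M) → IsMat μ ν M
inN⁻ μ ν M h
  with h₁ , h ← T-∧⁻ {⌊ length M ℕ.≟ length μ ⌋} h
  with h₂ , h ← T-∧⁻ {and (map (λ row → ⌊ length row ℕ.≟ length ν ⌋) M)} h
  with h₃ , h ← T-∧⁻ {and (zipWith (λ a row → ⌊ absSum row ℕ.≟ ∣ a ∣ ⌋) μ M)} h
  with h₄ , h₅ ← T-∧⁻ {and (zipWith (λ b j → ⌊ absSum (column M j) ℕ.≟ ∣ b ∣ ⌋) ν (upTo (length ν)))} h
  = mat rs (trans (sym (column-colSums (length ν) M (rows-length rs)))
      (pointwise-map≡ ∣_∣ (λ j → absSum (column M j))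
        (zip-and⁻ _ ν (upTo (length ν)) (sym (ListP.length-upTo (length ν))) h₄)))
  where
  len : length μ ≡ length M
  len = sym (toWitness h₁)
  rs : Pointwise (Row ν) μ M
  rs = split-rows (map-and⁻ _ M h₂) (zip-and⁻ _ μ M len h₃) (zip-and⁻ _ μ M len h₅)

inN⁺ : ∀ {μ ν M} → IsMat μ ν M → T (inN μ ν M)
inN⁺ {μ} {ν} {M} (mat rs cs) =
  T-∧⁺ {⌊ length M ℕ.≟ length μ ⌋} (fromWitness (sym (PW.Pointwise-length rs)))
  (T-∧⁺ (map-and⁺ (λ r → ⌊ length r ℕ.≟ length ν ⌋) (All.map fromWitness (rows-length rs)))
  (T-∧⁺ (zip-and⁺ (λ a r → ⌊ absSum r ℕ.≟ ∣ a ∣ ⌋) (PW.map (λ (_ , s , _) → fromWitness s) rs))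
  (T-∧⁺ (zip-and⁺ (λ b j → ⌊ absSum (column M j) ℕ.≟ ∣ b ∣ ⌋)
          (map≡-pointwise ∣_∣ (λ j → absSum (column M j)) ν (upTo (length ν))
            (trans (column-colSums (length ν) M (rows-length rs)) cs)))
    (zip-and⁺ (λ a r → and (zipWith (signOK a) ν r)) (PW.map (λ (_ , _ , o) → zip-and⁺ (signOK _) o) rs)))))

-- Compositions of matrices and their rank

NonzeroParts : List ℤ → Set
NonzeroParts = All (T ∘ isNonzero)

comp₁ : List ℤ → List ℤ
comp₁ = filterᵇ isNonzero

comp₁-++ : ∀ r s → comp₁ (r ++ s) ≡ comp₁ r ++ comp₁ s
comp₁-++ [] s = refl
comp₁-++ (x ∷ r) s with isNonzero x
... | true  = cong (x ∷_) (comp₁-++ r s)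
... | false = comp₁-++ r s

comp-∷ : ∀ r M → comp (r ∷ M) ≡ comp₁ r ++ comp M
comp-∷ r M = comp₁-++ r (concat M)

comp₁-nonzero : ∀ r → NonzeroParts (comp₁ r)
comp₁-nonzero [] = []
comp₁-nonzero (+ zero ∷ r) = comp₁-nonzero r
comp₁-nonzero (+ suc x ∷ r) = _ ∷ comp₁-nonzero r
comp₁-nonzero (-[1+ x ] ∷ r) = _ ∷ comp₁-nonzero r

absSum-comp₁ : ∀ r → absSum (comp₁ r) ≡ absSum r
absSum-comp₁ [] = refl
absSum-comp₁ (+ zero ∷ r) = absSum-comp₁ r
absSum-comp₁ (+ suc x ∷ r) = cong (suc x ℕ.+_) (absSum-comp₁ r)
absSum-comp₁ (-[1+ x ] ∷ r) = cong (suc x ℕ.+_) (absSum-comp₁ r)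

absSum-++ : ∀ r s → absSum (r ++ s) ≡ absSum r ℕ.+ absSum s
absSum-++ [] s = refl
absSum-++ (x ∷ r) s = trans (cong (∣ x ∣ ℕ.+_) (absSum-++ r s)) (sym (ℕP.+-assoc ∣ x ∣ (absSum r) (absSum s)))

-- The extra unit for a negative part detects a positive row whose single entry lies in a negative
-- column: the part changes sign there while the length stays the same.
rank : List ℤ → ℕ
rank σ = ∑ σ (λ x → suc ⟦ isNeg x ⟧)

rank-++ : ∀ r s → rank (r ++ s) ≡ rank r ℕ.+ rank s
rank-++ = ∑-++ (λ x → suc ⟦ isNeg x ⟧)

-- What rows and columns of a matrix in `𝒩` have in common, so that one rank argument serves both. A
-- positive label leaves the signs open, since the crossing line may be negative.
Line : ℤ → List ℤ → Set
Line a r = absSum r ≡ ∣ a ∣ × (T (isNeg a) → All (ℤ._≤ ℤ.0ℤ) r)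

private
  neg-part : ∀ x → T (isNonzero x) → x ℤ.≤ ℤ.0ℤ → T (isNeg x)
  neg-part (+ zero) () h
  neg-part (+ suc n) _ (ℤ.+≤+ ())
  neg-part -[1+ n ] _ h = _

  comp₁-All : ∀ {P : ℤ → Set} {r} → All P r → All P (comp₁ r)
  comp₁-All [] = []
  comp₁-All {r = x ∷ r} (p ∷ ps) with isNonzero x
  ... | true  = p ∷ comp₁-All ps
  ... | false = comp₁-All ps

  -- A positive part, of rank 1, is kept, negated or broken up, and the last two raise the rank. A
  -- negative part has only negative entries, each of rank 2, so breaking it up raises the rank as
  -- well.
  line-rank′ : ∀ a c → T (isNonzero a) → NonzeroParts c → Line a c → rank (a ∷ []) < rank c ⊎ c ≡ a ∷ []
  line-rank′ (+ zero) c () nz h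
  line-rank′ (+ suc n) [] _ nz (() , _)
  line-rank′ -[1+ n ] [] _ nz (() , _)
  line-rank′ (+ suc n) (+ m ∷ []) _ nz (s , _) =
    inj₂ (cong (λ k → + k ∷ []) (trans (sym (ℕP.+-identityʳ m)) s))
  line-rank′ (+ suc n) (-[1+ m ] ∷ []) _ nz _ = inj₁ (s≤s (s≤s z≤n))
  line-rank′ (+ suc n) (x ∷ y ∷ c) _ nz _ = inj₁ (s≤s (ℕP.m≤n⇒m≤o+n ⟦ isNeg x ⟧ (s≤s z≤n)))
  line-rank′ -[1+ n ] (x ∷ c) _ (x≠0 ∷ nz) (s , neg) with neg _
  line-rank′ -[1+ n ] (x ∷ c) _ (x≠0 ∷ nz) (s , neg) | x≤0 ∷ c≤0 with x | neg-part x x≠0 x≤0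
  line-rank′ -[1+ n ] (x ∷ []) _ (x≠0 ∷ nz) (s , neg) | x≤0 ∷ c≤0 | -[1+ m ] | _ =
    inj₂ (cong (λ k → -[1+ k ] ∷ []) (trans (sym (ℕP.+-identityʳ m)) (ℕP.suc-injective s)))
  line-rank′ -[1+ n ] (x ∷ y ∷ c) _ (x≠0 ∷ nz) (s , neg) | x≤0 ∷ c≤0 | -[1+ m ] | _ =
    inj₁ (s≤s (s≤s (s≤s z≤n)))

line-rank : ∀ a r → T (isNonzero a) → Line a r → rank (a ∷ []) < rank (comp₁ r) ⊎ comp₁ r ≡ a ∷ []
line-rank a r a≠0 (s , neg) =
  line-rank′ a (comp₁ r) a≠0 (comp₁-nonzero r) (trans (absSum-comp₁ r) s , comp₁-All ∘ neg)

OneEntry : ℤ → List ℤ → Set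
OneEntry a r = comp₁ r ≡ a ∷ []

oneEntry-comp : ∀ {lam M} → Pointwise OneEntry lam M → comp M ≡ lam
oneEntry-comp [] = refl
oneEntry-comp {M = r ∷ M} (p ∷ ps) = trans (comp-∷ r M) (cong₂ _++_ p (oneEntry-comp ps))

rank-∷-< : ∀ a r lam M → rank (a ∷ []) ℕ.+ rank lam < rank (comp₁ r) ℕ.+ rank (comp M) →
  rank (a ∷ lam) < rank (comp (r ∷ M))
rank-∷-< a r lam M =
  subst₂ _<_ (sym (rank-++ (a ∷ []) lam)) (sym (trans (cong rank (comp-∷ r M)) (rank-++ (comp₁ r) (comp M))))

-- Ranks add over the lines and no line loses any, so a gain in one line is a gain in total.
lines-rank : ∀ {lam M} → NonzeroParts lam → Pointwise Line lam M →
  rank lam < rank (comp M) ⊎ Pointwise OneEntry lam M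
lines-rank [] [] = inj₂ []
lines-rank {a ∷ lam} {r ∷ M} (a≠0 ∷ nz) (l ∷ ls) with line-rank a r a≠0 l | lines-rank nz ls
... | inj₁ p | inj₁ q = inj₁ (rank-∷-< a r lam M (ℕP.+-mono-< p q))
... | inj₁ p | inj₂ q = inj₁ (rank-∷-< a r lam M (ℕP.+-mono-<-≤ p (ℕP.≤-reflexive (cong rank (sym (oneEntry-comp q))))))
... | inj₂ p | inj₁ q = inj₁ (rank-∷-< a r lam M (ℕP.+-mono-≤-< (ℕP.≤-reflexive (cong rank (sym p))) q))
... | inj₂ p | inj₂ q = inj₂ (p ∷ q)

rows-lines : ∀ {μ ν M} → Pointwise (Row ν) μ M → Pointwise Line μ M
rows-lines = PW.map (λ (_ , s , o) → s , λ a<0 → nonpos a<0 o)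
  where
  nonpos : ∀ {a ν r} → T (isNeg a) → Pointwise (λ b m → T (signOK a b m)) ν r → All (ℤ._≤ ℤ.0ℤ) r
  nonpos a<0 [] = []
  nonpos { -[1+ n ]} a<0 (p ∷ ps) = toWitness p ∷ nonpos { -[1+ n ]} a<0 ps

-- The list `comp M` forgets the row boundaries. As no rank is gained in total, none is gained in
-- any row, and each row contributes exactly its own part.
mat-comp≡ : ∀ {lam σ M} → NonzeroParts lam → IsMat lam σ M → comp M ≡ lam → Pointwise OneEntry lam M
mat-comp≡ nz (mat rs _) eq with lines-rank nz (rows-lines rs)
... | inj₁ lt = contradiction (cong rank (sym eq)) (ℕP.<⇒≢ lt)
... | inj₂ p  = p

-- Placements of parts into slots and their number

_==_ : List ℕ → List ℕ → Bool
p == t = ⌊ ListP.≡-dec ℕ._≟_ p t ⌋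

_≡ℤ_ : List ℤ → List ℤ → Bool
r ≡ℤ s = ⌊ ListP.≡-dec ℤP._≟_ r s ⌋

accepts : Bool → ℤ → Bool
accepts s a = not s ∨ isNeg a

-- Slots are marked true when negative; step a puts the part a into one accepting slot, in all ways.
step : ℤ → List Bool → List ℕ → List (List ℕ)
step a (s ∷ ss) (x ∷ p) =
  (if accepts s a then (x ℕ.+ ∣ a ∣ ∷ p) ∷ [] else []) ++ map (x ∷_) (step a ss p)
step a _ _ = []

-- Abstract in the state `P`, because the same iteration runs on load vectors and, for placements
-- into cells, on matrices of loads.
runs : {P : Set} → (ℤ → P → List P) → List ℤ → P → List P
runs st [] p        = p ∷ []
runs st (a ∷ lam) p = concatMap (runs st lam) (st a p)

zeros : ℕ → List ℕ
zeros k = replicate k 0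

loads : List Bool → List ℤ → List ℕ → List (List ℕ)
loads ss = runs (λ a → step a ss)

signs : List ℤ → List Bool
signs = map isNeg

N : List ℤ → List ℤ → ℕ
N lam σ = ∑ (loads (signs σ) lam (zeros (length σ))) (λ p → ⟦ p == abss σ ⟧)

∑-if : ∀ {X : Set} (b : Bool) (x : X) (H : X → ℕ) → ∑ (if b then x ∷ [] else []) H ≡ ⟦ b ⟧ ℕ.* H x
∑-if true x H = refl
∑-if false x H = refl

∑-step : ∀ a s ss x p (H : List ℕ → ℕ) → ∑ (step a (s ∷ ss) (x ∷ p)) H ≡
  ⟦ accepts s a ⟧ ℕ.* H (x ℕ.+ ∣ a ∣ ∷ p) ℕ.+ ∑ (step a ss p) (H ∘ (x ∷_))
∑-step a s ss x p H = trans (∑-++ H (if accepts s a then _ else []) _)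
  (cong₂ ℕ._+_ (∑-if (accepts s a) _ H) (∑-map H (x ∷_) (step a ss p)))

∑-runs : {P : Set} (st : ℤ → P → List P) (a : ℤ) (lam : List ℤ) (p : P) (G : P → ℕ) →
  ∑ (runs st (a ∷ lam) p) G ≡ ∑ (st a p) (λ p′ → ∑ (runs st lam p′) G)
∑-runs st a lam p G = ∑-concatMap G (runs st lam) (st a p)

∑-loads : ∀ ss a lam p (G : List ℕ → ℕ) →
  ∑ (loads ss (a ∷ lam) p) G ≡ ∑ (step a ss p) (λ p′ → ∑ (loads ss lam p′) G)
∑-loads ss a lam p G = ∑-runs (λ a → step a ss) a lam p G

-- The conditions on one row of a matrix with `comp M ≡ lam`. The column sums are the only global
-- condition left, and the load vectors record them.
entryAt : ℤ → List ℤ → List ℤ → Bool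
entryAt a ν r = (comp₁ r ≡ℤ (a ∷ [])) ∧ and (zipWith (signOK a) ν r)

-- Matrices with one entry per row

zerosℤ : ℕ → List ℤ
zerosℤ k = replicate k (+ 0)

comp₁-zeros : ∀ k → comp₁ (zerosℤ k) ≡ []
comp₁-zeros zero    = refl
comp₁-zeros (suc k) = comp₁-zeros k

comp₁≡[] : ∀ r → comp₁ r ≡ [] → r ≡ zerosℤ (length r)
comp₁≡[] [] eq = refl
comp₁≡[] (+ zero ∷ r) eq = cong (+ 0 ∷_) (comp₁≡[] r eq)

comp₁-nz : ∀ {m} r → T (isNonzero m) → comp₁ (m ∷ r) ≡ m ∷ comp₁ r
comp₁-nz {m} r h with isNonzero m
... | true = refl

signOK-zero : ∀ a b → T (signOK a b (+ 0))
signOK-zero a b with isNeg a ∨ isNeg b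
... | true  = _
... | false = _

signsOK-zeros : ∀ a ν → T (and (zipWith (signOK a) ν (zerosℤ (length ν))))
signsOK-zeros a [] = _
signsOK-zeros a (b ∷ ν) = T-∧⁺ (signOK-zero a b) (signsOK-zeros a ν)

-- The origin of `accepts`: it is the sign rule of `𝒩`, read for an entry that equals the label of
-- its row.
signOK-self : ∀ a b → T (isNonzero a) → signOK a b a ≡ accepts (isNeg b) a
signOK-self (+ zero) b ()
signOK-self (+ suc n) (+ m) h = refl
signOK-self (+ suc n) -[1+ m ] h = refl
signOK-self -[1+ n ] (+ m) h = refl
signOK-self -[1+ n ] -[1+ m ] h = refl

private
  nonzero-≟ : ∀ m → T (isNonzero m) → ⌊ m ℤ.≟ + 0 ⌋ ≡ false
  nonzero-≟ m h = ¬T⇒≡false (λ t → subst (T ∘ isNonzero) (toWitness t) h)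

private
  entryAt-∷-nz : ∀ a b ν m r → T (isNonzero a) → T (isNonzero m) → length r ≡ length ν →
    entryAt a (b ∷ ν) (m ∷ r) ≡ ⌊ m ℤ.≟ a ⌋ ∧ accepts (isNeg b) a ∧ (r ≡ℤ zerosℤ (length ν))
  entryAt-∷-nz a b ν m r a≠0 m≠0 len = T-ext to from
    where
    to : T (entryAt a (b ∷ ν) (m ∷ r)) → T (⌊ m ℤ.≟ a ⌋ ∧ accepts (isNeg b) a ∧ (r ≡ℤ zerosℤ (length ν)))
    to h with h₁ , h₂ ← T-∧⁻ {comp₁ (m ∷ r) ≡ℤ (a ∷ [])} h
      with eq ← trans (sym (comp₁-nz r m≠0)) (toWitness h₁)
      with refl ← ListP.∷-injectiveˡ eq
      = T-∧⁺ {⌊ m ℤ.≟ a ⌋} (fromWitness refl)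
        (T-∧⁺ {accepts (isNeg b) a} (subst T (signOK-self a b a≠0) (proj₁ (T-∧⁻ h₂)))
          (fromWitness (trans (comp₁≡[] r (ListP.∷-injectiveʳ eq)) (cong zerosℤ len))))
    from : T (⌊ m ℤ.≟ a ⌋ ∧ accepts (isNeg b) a ∧ (r ≡ℤ zerosℤ (length ν))) → T (entryAt a (b ∷ ν) (m ∷ r))
    from h with h₁ , h ← T-∧⁻ {⌊ m ℤ.≟ a ⌋} h
      with h₂ , h₃ ← T-∧⁻ {accepts (isNeg b) a} h
      with refl ← toWitness h₁ | refl ← toWitness h₃
      = T-∧⁺ {comp₁ (m ∷ r) ≡ℤ (a ∷ [])} (fromWitness (trans (comp₁-nz r m≠0) (cong (a ∷_) (comp₁-zeros (length ν)))))
        (T-∧⁺ {signOK a b a} (subst T (sym (signOK-self a b a≠0)) h₂) (signsOK-zeros a ν))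

  entryAt-∷-nz′ : ∀ a b ν m r → T (isNonzero a) → T (isNonzero m) → length r ≡ length ν →
    ⟦ entryAt a (b ∷ ν) (m ∷ r) ⟧ ≡
      ⟦ ⌊ m ℤ.≟ a ⌋ ⟧ ℕ.* (⟦ accepts (isNeg b) a ⟧ ℕ.* ⟦ r ≡ℤ zerosℤ (length ν) ⟧) ℕ.+
      ⟦ ⌊ m ℤ.≟ + 0 ⌋ ⟧ ℕ.* ⟦ entryAt a ν r ⟧
  entryAt-∷-nz′ a b ν m r a≠0 m≠0 len =
    trans (cong ⟦_⟧ (entryAt-∷-nz a b ν m r a≠0 m≠0 len)) (trans (⟦∧⟧ ⌊ m ℤ.≟ a ⌋ _)
      (trans (cong (⟦ ⌊ m ℤ.≟ a ⌋ ⟧ ℕ.*_) (⟦∧⟧ (accepts (isNeg b) a) _))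
        (sym (trans (cong (λ z → x ℕ.+ ⟦ z ⟧ ℕ.* ⟦ entryAt a ν r ⟧) (nonzero-≟ m m≠0)) (ℕP.+-identityʳ x)))))
    where x = ⟦ ⌊ m ℤ.≟ a ⌋ ⟧ ℕ.* (⟦ accepts (isNeg b) a ⟧ ℕ.* ⟦ r ≡ℤ zerosℤ (length ν) ⟧)

-- The two summands match those of `∑-step`: the first cell holds `a`, must accept it, and is
-- followed by zeros; or it is empty and `a` comes later. They exclude each other because `a` is
-- nonzero.
entryAt-∷ : ∀ a b ν m r → T (isNonzero a) → length r ≡ length ν →
  ⟦ entryAt a (b ∷ ν) (m ∷ r) ⟧ ≡
    ⟦ ⌊ m ℤ.≟ a ⌋ ⟧ ℕ.* (⟦ accepts (isNeg b) a ⟧ ℕ.* ⟦ r ≡ℤ zerosℤ (length ν) ⟧) ℕ.+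
    ⟦ ⌊ m ℤ.≟ + 0 ⌋ ⟧ ℕ.* ⟦ entryAt a ν r ⟧
entryAt-∷ (+ suc n) b ν (+ zero) r a≠0 len =
  trans (cong (λ z → ⟦ (comp₁ r ≡ℤ _) ∧ z ∧ and (zipWith (signOK (+ suc n)) ν r) ⟧) (T⇒≡true (signOK-zero (+ suc n) b))) (sym (ℕP.+-identityʳ _))
entryAt-∷ -[1+ n ] b ν (+ zero) r a≠0 len = sym (ℕP.+-identityʳ _)
entryAt-∷ a b ν (+ suc m) r a≠0 len = entryAt-∷-nz′ a b ν (+ suc m) r a≠0 _ len
entryAt-∷ a b ν -[1+ m ] r a≠0 len = entryAt-∷-nz′ a b ν -[1+ m ] r a≠0 _ len

zipWith-+-zeros : ∀ p k → length p ≡ k → zipWith ℕ._+_ p (zeros k) ≡ p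
zipWith-+-zeros [] zero eq = refl
zipWith-+-zeros (x ∷ p) (suc k) eq = cong₂ _∷_ (ℕP.+-identityʳ x) (zipWith-+-zeros p k (ℕP.suc-injective eq))

abss-zeros : ∀ k → abss (zerosℤ k) ≡ zeros k
abss-zeros k = ListP.map-replicate ∣_∣ k (+ 0)

module _ (B : ℕ) where

  ∑-zero-row : ∀ k (F : List ℤ → ℕ) → ∑ (words (box B) k) (λ r → ⟦ r ≡ℤ zerosℤ k ⟧ ℕ.* F r) ≡ F (zerosℤ k)
  ∑-zero-row k F = ∑-indicator (_≡ℤ zerosℤ k) F (words-Unique (box-Unique B) k)
    (subst (zerosℤ k ∈_) (cong (words (box B)) (ListP.length-replicate k)) (∈-words⁺ (AllP.replicate⁺ k (∈-box {B} (+ 0) z≤n))))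
    (fromWitness refl) (λ r h → toWitness h)

  -- A row with `a` as its only nonzero entry is a choice of slot. `H` sees only the updated column
  -- loads, so the induction moves to the later cells by absorbing the first load into `H`.
  ∑-entryAt : ∀ a ν p (H : List ℕ → ℕ) → T (isNonzero a) → ∣ a ∣ ≤ B → length p ≡ length ν →
    ∑ (words (box B) (length ν)) (λ r → ⟦ entryAt a ν r ⟧ ℕ.* H (zipWith ℕ._+_ p (abss r))) ≡ ∑ (step a (signs ν) p) H
  ∑-entryAt a [] [] H a≠0 a≤B len = refl
  ∑-entryAt a (b ∷ ν) (x ∷ p) H a≠0 a≤B len = begin
    ∑ (words (box B) (suc l)) (λ r → ⟦ entryAt a (b ∷ ν) r ⟧ ℕ.* H (zipWith ℕ._+_ (x ∷ p) (abss r)))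
      ≡⟨ ∑-words-suc (box B) l _ ⟩
    ∑ (box B) (λ m → ∑ W (λ r → ⟦ entryAt a (b ∷ ν) (m ∷ r) ⟧ ℕ.* h m r))
      ≡⟨ ∑-cong (box B) split ⟩
    ∑ (box B) (λ m → ⟦ ⌊ m ℤ.≟ a ⌋ ⟧ ℕ.* here′ m ℕ.+ ⟦ ⌊ m ℤ.≟ + 0 ⌋ ⟧ ℕ.* there′ m)
      ≡⟨ ℕΣ.∑-∙ (λ m → ⟦ ⌊ m ℤ.≟ a ⌋ ⟧ ℕ.* here′ m) (λ m → ⟦ ⌊ m ℤ.≟ + 0 ⌋ ⟧ ℕ.* there′ m) (box B) ⟩
    ∑ (box B) (λ m → ⟦ ⌊ m ℤ.≟ a ⌋ ⟧ ℕ.* here′ m) ℕ.+ ∑ (box B) (λ m → ⟦ ⌊ m ℤ.≟ + 0 ⌋ ⟧ ℕ.* there′ m)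
      ≡⟨ cong₂ ℕ._+_ (pick here′ a a≤B) (pick there′ (+ 0) z≤n) ⟩
    here′ a ℕ.+ there′ (+ 0)
      ≡⟨ cong₂ ℕ._+_ (cong (⟦ accepts (isNeg b) a ⟧ ℕ.*_) (trans (∑-zero-row l (h a)) (cong H (cong (x ℕ.+ ∣ a ∣ ∷_) pz))))
           (trans (cong (λ y → ∑ W (λ r → ⟦ entryAt a ν r ⟧ ℕ.* H (y ∷ zipWith ℕ._+_ p (abss r)))) (ℕP.+-identityʳ x))
             (∑-entryAt a ν p (H ∘ (x ∷_)) a≠0 a≤B (ℕP.suc-injective len))) ⟩
    ⟦ accepts (isNeg b) a ⟧ ℕ.* H (x ℕ.+ ∣ a ∣ ∷ p) ℕ.+ ∑ (step a (signs ν) p) (H ∘ (x ∷_))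
      ≡⟨ ∑-step a (isNeg b) (signs ν) x p H ⟨
    ∑ (step a (signs (b ∷ ν)) (x ∷ p)) H ∎
    where
    open ≡-Reasoning
    l = length ν
    W = words (box B) l
    h : ℤ → List ℤ → ℕ
    h m r = H (x ℕ.+ ∣ m ∣ ∷ zipWith ℕ._+_ p (abss r))
    here′ there′ : ℤ → ℕ
    here′ m  = ⟦ accepts (isNeg b) a ⟧ ℕ.* ∑ W (λ r → ⟦ r ≡ℤ zerosℤ l ⟧ ℕ.* h m r)
    there′ m = ∑ W (λ r → ⟦ entryAt a ν r ⟧ ℕ.* h m r)
    pz : zipWith ℕ._+_ p (abss (zerosℤ l)) ≡ p
    pz = trans (cong (zipWith ℕ._+_ p) (abss-zeros l)) (zipWith-+-zeros p l (ℕP.suc-injective len))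
    pick : (F : ℤ → ℕ) (c : ℤ) → ∣ c ∣ ≤ B → ∑ (box B) (λ m → ⟦ ⌊ m ℤ.≟ c ⌋ ⟧ ℕ.* F m) ≡ F c
    pick F c c≤B = ∑-indicator (λ m → ⌊ m ℤ.≟ c ⌋) F (box-Unique B) (∈-box c c≤B) (fromWitness refl) (λ m → toWitness)
    rearrange : ∀ i j k l t → (i ℕ.* (j ℕ.* k) ℕ.+ l) ℕ.* t ≡ i ℕ.* (j ℕ.* (k ℕ.* t)) ℕ.+ l ℕ.* t
    rearrange i j k l t = trans (ℕP.*-distribʳ-+ t (i ℕ.* (j ℕ.* k)) l)
      (cong (ℕ._+ l ℕ.* t) (trans (ℕP.*-assoc i (j ℕ.* k) t) (cong (i ℕ.*_) (ℕP.*-assoc j k t))))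
    split : ∀ m → ∑ W (λ r → ⟦ entryAt a (b ∷ ν) (m ∷ r) ⟧ ℕ.* h m r) ≡
      ⟦ ⌊ m ℤ.≟ a ⌋ ⟧ ℕ.* here′ m ℕ.+ ⟦ ⌊ m ℤ.≟ + 0 ⌋ ⟧ ℕ.* there′ m
    split m = begin
      ∑ W (λ r → ⟦ entryAt a (b ∷ ν) (m ∷ r) ⟧ ℕ.* h m r)
        ≡⟨ ∑-cong-∈ W (λ r r∈ → trans (cong (ℕ._* h m r) (entryAt-∷ a b ν m r a≠0 (proj₁ (∈-words⁻ l r∈))))
             (rearrange ⟦ ⌊ m ℤ.≟ a ⌋ ⟧ ⟦ accepts (isNeg b) a ⟧ ⟦ r ≡ℤ zerosℤ l ⟧ _ (h m r))) ⟩
      ∑ W (λ r → ⟦ ⌊ m ℤ.≟ a ⌋ ⟧ ℕ.* (⟦ accepts (isNeg b) a ⟧ ℕ.* (⟦ r ≡ℤ zerosℤ l ⟧ ℕ.* h m r)) ℕ.+ ⟦ ⌊ m ℤ.≟ + 0 ⌋ ⟧ ℕ.* ⟦ entryAt a ν r ⟧ ℕ.* h m r)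
        ≡⟨ ℕΣ.∑-∙ _ _ W ⟩
      ∑ W (λ r → ⟦ ⌊ m ℤ.≟ a ⌋ ⟧ ℕ.* (⟦ accepts (isNeg b) a ⟧ ℕ.* (⟦ r ≡ℤ zerosℤ l ⟧ ℕ.* h m r))) ℕ.+ ∑ W (λ r → ⟦ ⌊ m ℤ.≟ + 0 ⌋ ⟧ ℕ.* ⟦ entryAt a ν r ⟧ ℕ.* h m r)
        ≡⟨ cong₂ ℕ._+_ (trans (*-∑ ⟦ ⌊ m ℤ.≟ a ⌋ ⟧ _ W) (cong (⟦ ⌊ m ℤ.≟ a ⌋ ⟧ ℕ.*_) (*-∑ ⟦ accepts (isNeg b) a ⟧ _ W)))
             (trans (∑-cong W (λ r → ℕP.*-assoc ⟦ ⌊ m ℤ.≟ + 0 ⌋ ⟧ ⟦ entryAt a ν r ⟧ (h m r))) (*-∑ ⟦ ⌊ m ℤ.≟ + 0 ⌋ ⟧ _ W)) ⟩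
      ⟦ ⌊ m ℤ.≟ a ⌋ ⟧ ℕ.* here′ m ℕ.+ ⟦ ⌊ m ℤ.≟ + 0 ⌋ ⟧ ℕ.* there′ m ∎

step-length : ∀ a ss {p} → All (λ p′ → length p′ ≡ length p) (step a ss p)
step-length a [] = []
step-length a (s ∷ ss) {[]} = []
step-length a (s ∷ ss) {x ∷ p} = AllP.++⁺ (hd (accepts s a)) (AllP.map⁺ (All.map (cong suc) (step-length a ss)))
  where
  hd : ∀ b → All (λ p′ → length p′ ≡ suc (length p)) (if b then (x ℕ.+ ∣ a ∣ ∷ p) ∷ [] else [])
  hd true  = refl ∷ []
  hd false = []

runs-inv : {P : Set} {I : P → Set} (st : ℤ → P → List P) → (∀ a {p} → I p → All I (st a p)) →
  ∀ lam {p} → I p → All I (runs st lam p)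
runs-inv st h [] i = i ∷ []
runs-inv st h (a ∷ lam) i = AllP.concat⁺ (AllP.map⁺ (All.map (runs-inv st h lam) (h a i)))

loads-length : ∀ ss lam p → All (λ p′ → length p′ ≡ length p) (loads ss lam p)
loads-length ss lam p = runs-inv (λ a → step a ss) (λ a eq → All.map (λ eq′ → trans eq′ eq) (step-length a ss)) lam refl

entriesAt : List ℤ → List ℤ → List (List ℤ) → Bool
entriesAt lam σ M = and (zipWith (λ a r → entryAt a σ r) lam M)

-- Running column sums, top row first, in the order in which `loads` places the parts; `colSums`
-- builds them from the bottom row.
accumulate : List ℕ → List (List ℤ) → List ℕ
accumulate p []      = p
accumulate p (r ∷ M) = accumulate (zipWith ℕ._+_ p (abss r)) M

∑-entriesAt : ∀ B lam σ p (G : List ℕ → ℕ) → NonzeroParts lam → All (λ a → ∣ a ∣ ≤ B) lam → length p ≡ length σ →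
  ∑ (words (words (box B) (length σ)) (length lam)) (λ M → ⟦ entriesAt lam σ M ⟧ ℕ.* G (accumulate p M)) ≡
  ∑ (loads (signs σ) lam p) G
∑-entriesAt B [] σ p G nz bd len = cong (ℕ._+ 0) (ℕP.+-identityʳ (G p))
∑-entriesAt B (a ∷ lam) σ p G (a≠0 ∷ nz) (a≤B ∷ bd) len = begin
  ∑ (words W (suc k)) (λ M → ⟦ entriesAt (a ∷ lam) σ M ⟧ ℕ.* G (accumulate p M))
    ≡⟨ ∑-words-suc W k _ ⟩
  ∑ W (λ r → ∑ (words W k) (λ M → ⟦ entryAt a σ r ∧ entriesAt lam σ M ⟧ ℕ.* G (accumulate (p ⊕ r) M)))
    ≡⟨ ∑-cong W (λ r → ∑-cong (words W k) (λ M →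
         trans (cong (ℕ._* G (accumulate (p ⊕ r) M)) (⟦∧⟧ (entryAt a σ r) _)) (ℕP.*-assoc ⟦ entryAt a σ r ⟧ _ _))) ⟩
  ∑ W (λ r → ∑ (words W k) (λ M → ⟦ entryAt a σ r ⟧ ℕ.* (⟦ entriesAt lam σ M ⟧ ℕ.* G (accumulate (p ⊕ r) M))))
    ≡⟨ ∑-cong W (λ r → *-∑ ⟦ entryAt a σ r ⟧ _ (words W k)) ⟩
  ∑ W (λ r → ⟦ entryAt a σ r ⟧ ℕ.* ∑ (words W k) (λ M → ⟦ entriesAt lam σ M ⟧ ℕ.* G (accumulate (p ⊕ r) M)))
    ≡⟨ ∑-cong-∈ W (λ r r∈ → cong (⟦ entryAt a σ r ⟧ ℕ.*_) (∑-entriesAt B lam σ (p ⊕ r) G nz bd (len⊕ r r∈))) ⟩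
  ∑ W (λ r → ⟦ entryAt a σ r ⟧ ℕ.* ∑ (loads (signs σ) lam (p ⊕ r)) G)
    ≡⟨ ∑-entryAt B a σ p (λ p′ → ∑ (loads (signs σ) lam p′) G) a≠0 a≤B len ⟩
  ∑ (step a (signs σ) p) (λ p′ → ∑ (loads (signs σ) lam p′) G)
    ≡⟨ ∑-loads (signs σ) a lam p G ⟨
  ∑ (loads (signs σ) (a ∷ lam) p) G ∎
  where
  open ≡-Reasoning
  W = words (box B) (length σ)
  k = length lam
  _⊕_ : List ℕ → List ℤ → List ℕ
  p ⊕ r = zipWith ℕ._+_ p (abss r)
  len⊕ : ∀ r → r ∈ W → length (p ⊕ r) ≡ length σ
  len⊕ r r∈ = trans (ListP.length-zipWith ℕ._+_ p (abss r))
    (trans (cong₂ ℕ._⊓_ len (trans (ListP.length-map ∣_∣ r) (proj₁ (∈-words⁻ (length σ) r∈)))) (ℕP.⊓-idem _))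

-- The coefficients d_{λσλ} and weights

parts≤absSum : ∀ lam → All (λ a → ∣ a ∣ ≤ absSum lam) lam
parts≤absSum [] = []
parts≤absSum (a ∷ lam) = ℕP.m≤m+n ∣ a ∣ _ ∷ All.map (λ h → ℕP.≤-trans h (ℕP.m≤n+m _ ∣ a ∣)) (parts≤absSum lam)

∈-𝒩⁻ : ∀ {μ ν M} → M ∈ 𝒩 μ ν → IsMat μ ν M
∈-𝒩⁻ {μ} {ν} {M} h = inN⁻ μ ν M (proj₂ (∈-filter⁻ (T? ∘ inN μ ν) {xs = words (words (box (absSum μ)) (length ν)) (length μ)} h))

zipWith-+-assoc : ∀ p q r → zipWith ℕ._+_ (zipWith ℕ._+_ p q) r ≡ zipWith ℕ._+_ p (zipWith ℕ._+_ q r)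
zipWith-+-assoc [] q r = refl
zipWith-+-assoc (x ∷ p) [] r = refl
zipWith-+-assoc (x ∷ p) (y ∷ q) [] = refl
zipWith-+-assoc (x ∷ p) (y ∷ q) (z ∷ r) = cong₂ _∷_ (ℕP.+-assoc x y z) (zipWith-+-assoc p q r)

accumulate-colSums : ∀ l p M → length p ≡ l → All (λ r → length r ≡ l) M →
  accumulate p M ≡ zipWith ℕ._+_ p (colSums l (map abss M))
accumulate-colSums l p [] lp [] = sym (zipWith-+-zeros p l lp)
accumulate-colSums l p (r ∷ M) lp (lr ∷ ls) =
  trans (accumulate-colSums l (zipWith ℕ._+_ p (abss r)) M len ls) (zipWith-+-assoc p (abss r) _)
  where
  len : length (zipWith ℕ._+_ p (abss r)) ≡ l
  len = trans (ListP.length-zipWith ℕ._+_ p (abss r))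
    (trans (cong₂ ℕ._⊓_ lp (trans (ListP.length-map ∣_∣ r) lr)) (ℕP.⊓-idem l))

colSums-length : ∀ l M → All (λ r → length r ≡ l) M → length (colSums l M) ≡ l
colSums-length l [] [] = ListP.length-replicate l
colSums-length l (r ∷ M) (lr ∷ ls) = trans (ListP.length-zipWith ℕ._+_ r _)
  (trans (cong₂ ℕ._⊓_ lr (colSums-length l M ls)) (ℕP.⊓-idem l))

zeros-+ : ∀ p → zipWith ℕ._+_ (zeros (length p)) p ≡ p
zeros-+ []      = refl
zeros-+ (x ∷ p) = cong (x ∷_) (zeros-+ p)

accumulate-zeros : ∀ l M → All (λ r → length r ≡ l) M → accumulate (zeros l) M ≡ colSums l (map abss M)
accumulate-zeros l M ls = trans (accumulate-colSums l (zeros l) M (ListP.length-replicate l) ls)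
  (trans (cong (λ k → zipWith ℕ._+_ (zeros k) c) (sym lc)) (zeros-+ c))
  where
  c = colSums l (map abss M)
  lc : length c ≡ l
  lc = colSums-length l (map abss M) (AllP.map⁺ (All.map (λ {r} lr → trans (ListP.length-map ∣_∣ r) lr) ls))

entriesAt⁻ : ∀ {lam σ M} → length lam ≡ length M → T (entriesAt lam σ M) → All (λ r → length r ≡ length σ) M →
  Pointwise (Row σ) lam M × Pointwise OneEntry lam M
entriesAt⁻ {[]} {σ} {[]} len h [] = [] , []
entriesAt⁻ {a ∷ lam} {σ} {r ∷ M} len h (lr ∷ ls) =
  let h₁ , h₂ = T-∧⁻ {entryAt a σ r} h
      e , s = T-∧⁻ {comp₁ r ≡ℤ (a ∷ [])} h₁
      one = toWitness e
      rs , os = entriesAt⁻ (ℕP.suc-injective len) h₂ ls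
  in (lr , trans (sym (absSum-comp₁ r)) (trans (cong absSum one) (ℕP.+-identityʳ ∣ a ∣)) , zip-and⁻ (signOK a) σ r (sym lr) s) ∷ rs
     , one ∷ os

entriesAt⁺ : ∀ {lam σ M} → Pointwise (Row σ) lam M → Pointwise OneEntry lam M → T (entriesAt lam σ M)
entriesAt⁺ [] [] = _
entriesAt⁺ {a ∷ lam} {σ} {r ∷ M} ((_ , _ , s) ∷ rs) (o ∷ os) =
  T-∧⁺ {entryAt a σ r} (T-∧⁺ {comp₁ r ≡ℤ (a ∷ [])} (fromWitness o) (zip-and⁺ (signOK a) s)) (entriesAt⁺ rs os)

diagonal : List ℤ → List ℤ → List (List (List ℤ))
diagonal lam σ = filterᵇ (λ M → comp M ≡ℤ lam) (𝒩 lam σ)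

-- Once the rank argument has fixed one entry per row, row sums and signs are local to the rows; the
-- test `p == abss σ` in `N` stands for the column sums.
length-diagonal : ∀ lam σ → NonzeroParts lam → length (diagonal lam σ) ≡ N lam σ
length-diagonal lam σ nz = begin
  length (diagonal lam σ)
    ≡⟨ length≡∑ (diagonal lam σ) ⟩
  ∑ (diagonal lam σ) (λ _ → 1)
    ≡⟨ ∑-filterᵇ (λ M → comp M ≡ℤ lam) (λ _ → 1) (𝒩 lam σ) ⟩
  ∑ (𝒩 lam σ) (λ M → ⟦ comp M ≡ℤ lam ⟧ ℕ.* 1)
    ≡⟨ ∑-filterᵇ (inN lam σ) _ W ⟩
  ∑ W (λ M → ⟦ inN lam σ M ⟧ ℕ.* (⟦ comp M ≡ℤ lam ⟧ ℕ.* 1))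
    ≡⟨ ∑-cong-∈ W indicators ⟩
  ∑ W (λ M → ⟦ entriesAt lam σ M ⟧ ℕ.* ⟦ accumulate (zeros l) M == abss σ ⟧)
    ≡⟨ ∑-entriesAt (absSum lam) lam σ (zeros l) (λ p → ⟦ p == abss σ ⟧) nz (parts≤absSum lam) (ListP.length-replicate l) ⟩
  N lam σ ∎
  where
  open ≡-Reasoning
  l = length σ
  W = words (words (box (absSum lam)) l) (length lam)
  indicators : ∀ M → M ∈ W → ⟦ inN lam σ M ⟧ ℕ.* (⟦ comp M ≡ℤ lam ⟧ ℕ.* 1) ≡ ⟦ entriesAt lam σ M ⟧ ℕ.* ⟦ accumulate (zeros l) M == abss σ ⟧
  indicators M M∈ = begin
    ⟦ inN lam σ M ⟧ ℕ.* (⟦ comp M ≡ℤ lam ⟧ ℕ.* 1)  ≡⟨ cong (⟦ inN lam σ M ⟧ ℕ.*_) (ℕP.*-identityʳ _) ⟩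
    ⟦ inN lam σ M ⟧ ℕ.* ⟦ comp M ≡ℤ lam ⟧          ≡⟨ ⟦∧⟧ (inN lam σ M) _ ⟨
    ⟦ inN lam σ M ∧ (comp M ≡ℤ lam) ⟧              ≡⟨ cong ⟦_⟧ (T-ext to from) ⟩
    ⟦ entriesAt lam σ M ∧ (accumulate (zeros l) M == abss σ) ⟧ ≡⟨ ⟦∧⟧ (entriesAt lam σ M) _ ⟩
    ⟦ entriesAt lam σ M ⟧ ℕ.* ⟦ accumulate (zeros l) M == abss σ ⟧ ∎
    where
    lens : All (λ r → length r ≡ l) M
    lens = All.map (λ r∈ → proj₁ (∈-words⁻ l r∈)) (proj₂ (∈-words⁻ (length lam) M∈))
    to : T (inN lam σ M ∧ (comp M ≡ℤ lam)) → T (entriesAt lam σ M ∧ (accumulate (zeros l) M == abss σ))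
    to h = let h₁ , h₂ = T-∧⁻ {inN lam σ M} h
               m = inN⁻ lam σ M h₁
           in T-∧⁺ {entriesAt lam σ M} (entriesAt⁺ (rows m) (mat-comp≡ nz m (toWitness h₂)))
                (fromWitness (trans (accumulate-zeros l M lens) (cols m)))
    from : T (entriesAt lam σ M ∧ (accumulate (zeros l) M == abss σ)) → T (inN lam σ M ∧ (comp M ≡ℤ lam))
    from h = let h₁ , h₂ = T-∧⁻ {entriesAt lam σ M} h
                 rs , os = entriesAt⁻ (sym (proj₁ (∈-words⁻ (length lam) M∈))) h₁ lens
             in T-∧⁺ {inN lam σ M} (inN⁺ (mat rs (trans (sym (accumulate-zeros l M lens)) (toWitness h₂))))
                  (fromWitness (oneEntry-comp os))

-- The weight identity

negSum : List ℤ → ℕ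
negSum σ = ∑ σ (λ a → ⟦ isNeg a ⟧ ℕ.* ∣ a ∣)

negSum-++ : ∀ r s → negSum (r ++ s) ≡ negSum r ℕ.+ negSum s
negSum-++ = ∑-++ (λ a → ⟦ isNeg a ⟧ ℕ.* ∣ a ∣)

negSum-comp₁ : ∀ r → negSum (comp₁ r) ≡ negSum r
negSum-comp₁ [] = refl
negSum-comp₁ (+ zero ∷ r) = negSum-comp₁ r
negSum-comp₁ (+ suc n ∷ r) = negSum-comp₁ r
negSum-comp₁ (-[1+ n ] ∷ r) = cong (suc n ℕ.+ 0 ℕ.+_) (negSum-comp₁ r)

rowWt : ℤ → List ℤ → List ℤ → List ℤ
rowWt a ν r = zipWith (λ b m → if isNeg a ∧ isNeg b then m else + 0) ν r

wtEntries : List ℤ → List ℤ → List (List ℤ) → List ℤ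
wtEntries μ ν M = concat (zipWith (λ a r → rowWt a ν r) μ M)

colNeg : List ℤ → List ℕ → ℕ
colNeg [] _ = 0
colNeg _ [] = 0
colNeg (b ∷ ν) (x ∷ p) = ⟦ isNeg b ⟧ ℕ.* x ℕ.+ colNeg ν p

-- No cancellation occurs in the sum defining `wt`, so it can be computed with absolute values in ℕ.
∣sum∣-nonpos : ∀ xs → All (ℤ._≤ ℤ.0ℤ) xs → foldr ℤ._+_ (+ 0) xs ≡ ℤ.- (+ absSum xs)
∣sum∣-nonpos [] [] = refl
∣sum∣-nonpos (x ∷ xs) (p ∷ ps) =
  trans (cong₂ ℤ._+_ (nonpos x p) (∣sum∣-nonpos xs ps)) (sym (ℤP.neg-distrib-+ (+ ∣ x ∣) (+ absSum xs)))
  where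
  nonpos : ∀ x → x ℤ.≤ ℤ.0ℤ → x ≡ ℤ.- (+ ∣ x ∣)
  nonpos (+ zero) _ = refl
  nonpos (+ suc n) (ℤ.+≤+ ())
  nonpos -[1+ n ] _ = refl

colNeg-+ : ∀ ν p q → length p ≡ length q → colNeg ν (zipWith ℕ._+_ p q) ≡ colNeg ν p ℕ.+ colNeg ν q
colNeg-+ [] p q eq = refl
colNeg-+ (b ∷ ν) [] [] eq = refl
colNeg-+ (b ∷ ν) (x ∷ p) (y ∷ q) eq =
  trans (cong₂ ℕ._+_ (ℕP.*-distribˡ-+ ⟦ isNeg b ⟧ x y) (colNeg-+ ν p q (ℕP.suc-injective eq)))
    (interchange (⟦ isNeg b ⟧ ℕ.* x) (⟦ isNeg b ⟧ ℕ.* y) (colNeg ν p) (colNeg ν q))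
  where open import Algebra.Properties.CommutativeSemigroup ℕP.+-commutativeSemigroup using (interchange)

colNeg-zeros : ∀ ν k → colNeg ν (zeros k) ≡ 0
colNeg-zeros [] k = refl
colNeg-zeros (b ∷ ν) zero = refl
colNeg-zeros (b ∷ ν) (suc k) = cong₂ ℕ._+_ (ℕP.*-zeroʳ ⟦ isNeg b ⟧) (colNeg-zeros ν k)

colNeg-abss : ∀ ν → colNeg ν (abss ν) ≡ negSum ν
colNeg-abss [] = refl
colNeg-abss (b ∷ ν) = cong (⟦ isNeg b ⟧ ℕ.* ∣ b ∣ ℕ.+_) (colNeg-abss ν)

-- Inclusion–exclusion over the rows and columns of negative sign, entry by entry.
entry-wt : ∀ a b m → T (signOK a b m) →
  ∣ if isNeg a ∧ isNeg b then m else + 0 ∣ ℕ.+ ⟦ isNeg m ⟧ ℕ.* ∣ m ∣ ≡ ⟦ isNeg a ⟧ ℕ.* ∣ m ∣ ℕ.+ ⟦ isNeg b ⟧ ℕ.* ∣ m ∣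
entry-wt (+ _) (+ _) (+ _) _ = refl
entry-wt (+ _) -[1+ _ ] (+ zero) _ = refl
entry-wt (+ _) -[1+ _ ] -[1+ _ ] _ = refl
entry-wt -[1+ _ ] (+ _) (+ zero) _ = refl
entry-wt -[1+ _ ] (+ _) -[1+ n ] _ = sym (ℕP.+-identityʳ _)
entry-wt -[1+ _ ] -[1+ _ ] (+ zero) _ = refl
entry-wt -[1+ _ ] -[1+ _ ] -[1+ n ] _ = cong (ℕ._+ (suc n ℕ.+ 0)) (sym (ℕP.+-identityʳ (suc n)))

row-wt : ∀ a ν r → Pointwise (λ b m → T (signOK a b m)) ν r →
  absSum (rowWt a ν r) ℕ.+ negSum r ≡ ⟦ isNeg a ⟧ ℕ.* absSum r ℕ.+ colNeg ν (abss r)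
row-wt a [] [] [] = sym (trans (ℕP.+-identityʳ _) (ℕP.*-zeroʳ ⟦ isNeg a ⟧))
row-wt a (b ∷ ν) (m ∷ r) (p ∷ ps) = begin
  (w ℕ.+ ws) ℕ.+ (k ℕ.+ ks)   ≡⟨ interchange w ws k ks ⟩
  (w ℕ.+ k) ℕ.+ (ws ℕ.+ ks)   ≡⟨ cong₂ ℕ._+_ (entry-wt a b m p) (row-wt a ν r ps) ⟩
  (A ℕ.* ∣ m ∣ ℕ.+ c) ℕ.+ (A ℕ.* absSum r ℕ.+ cs) ≡⟨ interchange (A ℕ.* ∣ m ∣) c _ cs ⟩
  (A ℕ.* ∣ m ∣ ℕ.+ A ℕ.* absSum r) ℕ.+ (c ℕ.+ cs) ≡⟨ cong (ℕ._+ (c ℕ.+ cs)) (ℕP.*-distribˡ-+ A ∣ m ∣ (absSum r)) ⟨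
  A ℕ.* absSum (m ∷ r) ℕ.+ (c ℕ.+ cs) ∎
  where
  open ≡-Reasoning
  open import Algebra.Properties.CommutativeSemigroup ℕP.+-commutativeSemigroup using (interchange)
  A = ⟦ isNeg a ⟧
  w = ∣ if isNeg a ∧ isNeg b then m else + 0 ∣
  ws = absSum (rowWt a ν r)
  k = ⟦ isNeg m ⟧ ℕ.* ∣ m ∣
  ks = negSum r
  c = ⟦ isNeg b ⟧ ℕ.* ∣ m ∣
  cs = colNeg ν (abss r)

rows-wt : ∀ μ ν M → Pointwise (Row ν) μ M →
  absSum (wtEntries μ ν M) ℕ.+ negSum (concat M) ≡ negSum μ ℕ.+ colNeg ν (colSums (length ν) (map abss M))
rows-wt [] ν [] [] = sym (colNeg-zeros ν (length ν))
rows-wt (a ∷ μ) ν (r ∷ M) ((lr , sr , s) ∷ rs) = begin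
  absSum (rowWt a ν r ++ wtEntries μ ν M) ℕ.+ negSum (r ++ concat M)
    ≡⟨ cong₂ ℕ._+_ (absSum-++ (rowWt a ν r) _) (negSum-++ r (concat M)) ⟩
  (w ℕ.+ ws) ℕ.+ (negSum r ℕ.+ negSum (concat M))
    ≡⟨ interchange w ws _ _ ⟩
  (w ℕ.+ negSum r) ℕ.+ (ws ℕ.+ negSum (concat M))
    ≡⟨ cong₂ ℕ._+_ (trans (row-wt a ν r s) (cong (λ t → ⟦ isNeg a ⟧ ℕ.* t ℕ.+ colNeg ν (abss r)) sr)) (rows-wt μ ν M rs) ⟩
  (⟦ isNeg a ⟧ ℕ.* ∣ a ∣ ℕ.+ colNeg ν (abss r)) ℕ.+ (negSum μ ℕ.+ colNeg ν cs)
    ≡⟨ interchange (⟦ isNeg a ⟧ ℕ.* ∣ a ∣) _ _ _ ⟩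
  negSum (a ∷ μ) ℕ.+ (colNeg ν (abss r) ℕ.+ colNeg ν cs)
    ≡⟨ cong (negSum (a ∷ μ) ℕ.+_) (colNeg-+ ν (abss r) cs len) ⟨
  negSum (a ∷ μ) ℕ.+ colNeg ν (zipWith ℕ._+_ (abss r) cs) ∎
  where
  open ≡-Reasoning
  open import Algebra.Properties.CommutativeSemigroup ℕP.+-commutativeSemigroup using (interchange)
  w = absSum (rowWt a ν r)
  ws = absSum (wtEntries μ ν M)
  cs = colSums (length ν) (map abss M)
  len : length (abss r) ≡ length cs
  len = trans (trans (ListP.length-map ∣_∣ r) lr)
    (sym (colSums-length (length ν) (map abss M) (AllP.map⁺ (All.map (λ {r} l → trans (ListP.length-map ∣_∣ r) l) (rows-length rs)))))

wtEntries-nonpos : ∀ {μ ν M} → Pointwise (Row ν) μ M → All (ℤ._≤ ℤ.0ℤ) (wtEntries μ ν M)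
wtEntries-nonpos [] = []
wtEntries-nonpos {a ∷ _} {ν} {r ∷ _} ((_ , _ , s) ∷ rs) = AllP.++⁺ (row {a} {ν} {r} s) (wtEntries-nonpos rs)
  where
  row : ∀ {a ν r} → Pointwise (λ b m → T (signOK a b m)) ν r → All (ℤ._≤ ℤ.0ℤ) (rowWt a ν r)
  row [] = []
  row {+ n} (p ∷ ps) = ℤP.≤-refl ∷ row {+ n} ps
  row { -[1+ n ]} {+ _ ∷ ν} (p ∷ ps) = ℤP.≤-refl ∷ row { -[1+ n ]} ps
  row { -[1+ n ]} { -[1+ _ ] ∷ ν} (p ∷ ps) = toWitness p ∷ row { -[1+ n ]} ps

-- Inclusion-exclusion on absolute values: negative rows total `negSum μ`, negative columns total
-- `negSum ν`, their intersection is the weight, and their union carries exactly the negative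
-- entries of `M`.
wt-negSum : ∀ {μ ν M} → IsMat μ ν M → ∣ wt μ ν M ∣ ℕ.+ negSum (comp M) ≡ negSum μ ℕ.+ negSum ν
wt-negSum {μ} {ν} {M} (mat rs cs) = begin
  ∣ wt μ ν M ∣ ℕ.+ negSum (comp M)
    ≡⟨ cong₂ ℕ._+_ ∣wt∣ (negSum-comp₁ (concat M)) ⟩
  absSum (wtEntries μ ν M) ℕ.+ negSum (concat M)
    ≡⟨ rows-wt μ ν M rs ⟩
  negSum μ ℕ.+ colNeg ν (colSums (length ν) (map abss M))
    ≡⟨ cong (λ p → negSum μ ℕ.+ colNeg ν p) cs ⟩
  negSum μ ℕ.+ colNeg ν (abss ν)
    ≡⟨ cong (negSum μ ℕ.+_) (colNeg-abss ν) ⟩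
  negSum μ ℕ.+ negSum ν ∎
  where
  open ≡-Reasoning
  ∣wt∣ : ∣ wt μ ν M ∣ ≡ absSum (wtEntries μ ν M)
  ∣wt∣ = trans (cong (λ z → ∣ ℤ.- z ∣) (∣sum∣-nonpos (wtEntries μ ν M) (wtEntries-nonpos rs)))
    (cong ∣_∣ (ℤP.neg-involutive (+ absSum (wtEntries μ ν M))))

-- Here `comp M` is `lam`, so `negSum lam` cancels from the weight identity.
wt-diagonal : ∀ {lam σ M} → M ∈ diagonal lam σ → ∣ wt lam σ M ∣ ≡ negSum σ
wt-diagonal {lam} {σ} {M} M∈ =
  let M∈𝒩 , c = ∈-filter⁻ (λ M → T? (comp M ≡ℤ lam)) {xs = 𝒩 lam σ} M∈
  in ℕP.+-cancelʳ-≡ (negSum lam) ∣ wt lam σ M ∣ (negSum σ)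
       (trans (cong (λ c → ∣ wt lam σ M ∣ ℕ.+ negSum c) (sym (toWitness c)))
         (trans (wt-negSum (∈-𝒩⁻ {lam} {σ} M∈𝒩)) (ℕP.+-comm (negSum lam) (negSum σ))))

-- Placements into the cells of a matrix

∑-cong-All : {A : Set} {Q : A → Set} {f g : A → ℕ} {xs : List A} → All Q xs → (∀ x → Q x → f x ≡ g x) → ∑ xs f ≡ ∑ xs g
∑-cong-All {xs = xs} al h = ∑-cong-∈ xs (λ x x∈ → h x (All.lookup al x∈))

-- A zero entry in a negative row or column has `isNeg` false although its slot is negative; hence
-- only nonzero cells are constrained.
Consistent : List ℤ → List Bool → Set
Consistent = Pointwise (λ m s → T (isNonzero m) → isNeg m ≡ s)

-- comp drops the zero cells of a matrix; this is harmless, since no part can be placed in them.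
restrict : List ℤ → List ℕ → List ℕ
restrict (m ∷ t) (x ∷ p) = if isNonzero m then x ∷ restrict t p else restrict t p
restrict _ _ = []

vanishes : List ℤ → List ℕ → Bool
vanishes (m ∷ t) (x ∷ p) = (isNonzero m ∨ (x ℕ.≡ᵇ 0)) ∧ vanishes t p
vanishes _ _ = true

private
  pull : ∀ {A : Set} i (xs : List A) (v f : A → ℕ) → ∑ xs (λ x → i ℕ.* v x ℕ.* f x) ≡ i ℕ.* ∑ xs (λ x → v x ℕ.* f x)
  pull i xs v f = trans (∑-cong xs (λ x → ℕP.*-assoc i (v x) (f x))) (*-∑ i _ xs)

  x+∣a∣≢0 : ∀ x a → T (isNonzero a) → (x ℕ.+ ∣ a ∣ ℕ.≡ᵇ 0) ≡ false
  x+∣a∣≢0 zero (+ suc n) h = refl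
  x+∣a∣≢0 zero -[1+ n ] h = refl
  x+∣a∣≢0 (suc x) a h = refl

  factor : ∀ (c v h s : ℕ) → c ℕ.* (v ℕ.* h) ℕ.+ v ℕ.* s ≡ v ℕ.* (c ℕ.* h ℕ.+ s)
  factor c v h s = trans (cong (ℕ._+ v ℕ.* s) (x∙yz≈y∙xz c v h)) (sym (ℕP.*-distribˡ-+ v (c ℕ.* h) s))
    where open import Algebra.Properties.CommutativeSemigroup ℕP.*-commutativeSemigroup using (x∙yz≈y∙xz)

-- A part put into a zero cell makes the load there nonzero, and `vanishes` kills the term. In every
-- other cell the placement commutes with `restrict`.
step-restrict : ∀ {t ss} a p (H : List ℕ → ℕ) → T (isNonzero a) → Consistent t ss → length p ≡ length t →
  ∑ (step a ss p) (λ p′ → ⟦ vanishes t p′ ⟧ ℕ.* H (restrict t p′)) ≡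
  ⟦ vanishes t p ⟧ ℕ.* ∑ (step a (signs (comp₁ t)) (restrict t p)) H
step-restrict {[]} a [] H a≠0 [] len = refl
step-restrict {+ zero ∷ t} {s ∷ ss} a (x ∷ p) H a≠0 (_ ∷ cs) len = begin
  ∑ (step a (s ∷ ss) (x ∷ p)) (λ p′ → ⟦ vanishes (+ 0 ∷ t) p′ ⟧ ℕ.* H (restrict (+ 0 ∷ t) p′))
    ≡⟨ ∑-step a s ss x p _ ⟩
  ⟦ accepts s a ⟧ ℕ.* (⟦ (x ℕ.+ ∣ a ∣ ℕ.≡ᵇ 0) ∧ vanishes t p ⟧ ℕ.* h) ℕ.+ ∑ (step a ss p) (λ p′ → ⟦ (x ℕ.≡ᵇ 0) ∧ vanishes t p′ ⟧ ℕ.* H (restrict t p′))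
    ≡⟨ cong₂ ℕ._+_ (trans (cong (λ z → ⟦ accepts s a ⟧ ℕ.* (⟦ z ∧ vanishes t p ⟧ ℕ.* h)) (x+∣a∣≢0 x a a≠0)) (ℕP.*-zeroʳ ⟦ accepts s a ⟧))
         (∑-cong (step a ss p) (λ p′ → cong (ℕ._* H (restrict t p′)) (⟦∧⟧ (x ℕ.≡ᵇ 0) (vanishes t p′)))) ⟩
  ∑ (step a ss p) (λ p′ → ⟦ x ℕ.≡ᵇ 0 ⟧ ℕ.* ⟦ vanishes t p′ ⟧ ℕ.* H (restrict t p′))
    ≡⟨ pull ⟦ x ℕ.≡ᵇ 0 ⟧ (step a ss p) _ _ ⟩
  ⟦ x ℕ.≡ᵇ 0 ⟧ ℕ.* ∑ (step a ss p) (λ p′ → ⟦ vanishes t p′ ⟧ ℕ.* H (restrict t p′))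
    ≡⟨ cong (⟦ x ℕ.≡ᵇ 0 ⟧ ℕ.*_) (step-restrict a p H a≠0 cs (ℕP.suc-injective len)) ⟩
  ⟦ x ℕ.≡ᵇ 0 ⟧ ℕ.* (⟦ vanishes t p ⟧ ℕ.* S)
    ≡⟨ ℕP.*-assoc ⟦ x ℕ.≡ᵇ 0 ⟧ ⟦ vanishes t p ⟧ S ⟨
  ⟦ x ℕ.≡ᵇ 0 ⟧ ℕ.* ⟦ vanishes t p ⟧ ℕ.* S
    ≡⟨ cong (ℕ._* S) (⟦∧⟧ (x ℕ.≡ᵇ 0) (vanishes t p)) ⟨
  ⟦ (x ℕ.≡ᵇ 0) ∧ vanishes t p ⟧ ℕ.* S ∎
  where
  open ≡-Reasoning
  h = H (restrict t p)
  S = ∑ (step a (signs (comp₁ t)) (restrict t p)) H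
step-restrict {+ suc n ∷ t} {s ∷ ss} a (x ∷ p) H a≠0 (c ∷ cs) len with refl ← c _ =
  trans (∑-step a false ss x p _)
  (trans (cong (1 ℕ.* (⟦ vanishes t p ⟧ ℕ.* H (x ℕ.+ ∣ a ∣ ∷ restrict t p)) ℕ.+_) (step-restrict a p (H ∘ (x ∷_)) a≠0 cs (ℕP.suc-injective len)))
  (trans (factor 1 ⟦ vanishes t p ⟧ _ _)
    (cong (⟦ vanishes t p ⟧ ℕ.*_) (sym (∑-step a false (signs (comp₁ t)) x (restrict t p) H)))))
step-restrict { -[1+ n ] ∷ t} {s ∷ ss} a (x ∷ p) H a≠0 (c ∷ cs) len with refl ← c _ =
  trans (∑-step a true ss x p _)
  (trans (cong (⟦ isNeg a ⟧ ℕ.* (⟦ vanishes t p ⟧ ℕ.* H (x ℕ.+ ∣ a ∣ ∷ restrict t p)) ℕ.+_) (step-restrict a p (H ∘ (x ∷_)) a≠0 cs (ℕP.suc-injective len)))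
  (trans (factor ⟦ isNeg a ⟧ ⟦ vanishes t p ⟧ _ _)
    (cong (⟦ vanishes t p ⟧ ℕ.*_) (sym (∑-step a true (signs (comp₁ t)) x (restrict t p) H)))))

loads-restrict : ∀ {t ss} lam p (G : List ℕ → ℕ) → NonzeroParts lam → Consistent t ss → length p ≡ length t →
  ∑ (loads ss lam p) (λ p′ → ⟦ vanishes t p′ ⟧ ℕ.* G (restrict t p′)) ≡
  ⟦ vanishes t p ⟧ ℕ.* ∑ (loads (signs (comp₁ t)) lam (restrict t p)) G
loads-restrict {t} [] p G nz cs len =
  trans (ℕP.+-identityʳ _) (cong (⟦ vanishes t p ⟧ ℕ.*_) (sym (ℕP.+-identityʳ _)))
loads-restrict {t} {ss} (a ∷ lam) p G (a≠0 ∷ nz) cs len = begin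
  ∑ (loads ss (a ∷ lam) p) (λ p′ → ⟦ vanishes t p′ ⟧ ℕ.* G (restrict t p′))
    ≡⟨ ∑-loads ss a lam p _ ⟩
  ∑ (step a ss p) (λ p₁ → ∑ (loads ss lam p₁) (λ p′ → ⟦ vanishes t p′ ⟧ ℕ.* G (restrict t p′)))
    ≡⟨ ∑-cong-All (step-length a ss) (λ p₁ eq → loads-restrict lam p₁ G nz cs (trans eq len)) ⟩
  ∑ (step a ss p) (λ p₁ → ⟦ vanishes t p₁ ⟧ ℕ.* ∑ (loads (signs (comp₁ t)) lam (restrict t p₁)) G)
    ≡⟨ step-restrict a p (λ q → ∑ (loads (signs (comp₁ t)) lam q) G) a≠0 cs len ⟩
  ⟦ vanishes t p ⟧ ℕ.* ∑ (step a (signs (comp₁ t)) (restrict t p)) (λ q → ∑ (loads (signs (comp₁ t)) lam q) G)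
    ≡⟨ cong (⟦ vanishes t p ⟧ ℕ.*_) (∑-loads (signs (comp₁ t)) a lam (restrict t p) G) ⟨
  ⟦ vanishes t p ⟧ ℕ.* ∑ (loads (signs (comp₁ t)) (a ∷ lam) (restrict t p)) G ∎
  where open ≡-Reasoning

private
  abss-split⁻ : ∀ t p → p ≡ abss t → T (vanishes t p) × restrict t p ≡ abss (comp₁ t)
  abss-split⁻ [] .[] refl = _ , refl
  abss-split⁻ (+ zero ∷ t) .(abss (+ zero ∷ t)) refl = abss-split⁻ t _ refl
  abss-split⁻ (+ suc n ∷ t) .(abss (+ suc n ∷ t)) refl = let v , r = abss-split⁻ t _ refl in v , cong (suc n ∷_) r
  abss-split⁻ (-[1+ n ] ∷ t) .(abss (-[1+ n ] ∷ t)) refl = let v , r = abss-split⁻ t _ refl in v , cong (suc n ∷_) r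

  abss-split⁺ : ∀ t p → length p ≡ length t → T (vanishes t p) → restrict t p ≡ abss (comp₁ t) → p ≡ abss t
  abss-split⁺ [] [] len v r = refl
  abss-split⁺ (+ zero ∷ t) (zero ∷ p) len v r = cong (0 ∷_) (abss-split⁺ t p (ℕP.suc-injective len) v r)
  abss-split⁺ (+ suc n ∷ t) (x ∷ p) len v r =
    cong₂ _∷_ (ListP.∷-injectiveˡ r) (abss-split⁺ t p (ℕP.suc-injective len) v (ListP.∷-injectiveʳ r))
  abss-split⁺ (-[1+ n ] ∷ t) (x ∷ p) len v r =
    cong₂ _∷_ (ListP.∷-injectiveˡ r) (abss-split⁺ t p (ℕP.suc-injective len) v (ListP.∷-injectiveʳ r))

  ==-split : ∀ t p → length p ≡ length t → ⟦ p == abss t ⟧ ≡ ⟦ vanishes t p ⟧ ℕ.* ⟦ restrict t p == abss (comp₁ t) ⟧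
  ==-split t p len = trans (cong ⟦_⟧ (T-ext
      (λ h → let v , r = abss-split⁻ t p (toWitness h) in T-∧⁺ {vanishes t p} v (fromWitness r))
      (λ h → let v , r = T-∧⁻ {vanishes t p} h in fromWitness (abss-split⁺ t p len v (toWitness r)))))
    (⟦∧⟧ (vanishes t p) _)

  restrict-zeros : ∀ t → restrict t (zeros (length t)) ≡ zeros (length (comp₁ t))
  restrict-zeros [] = refl
  restrict-zeros (+ zero ∷ t) = restrict-zeros t
  restrict-zeros (+ suc n ∷ t) = cong (0 ∷_) (restrict-zeros t)
  restrict-zeros (-[1+ n ] ∷ t) = cong (0 ∷_) (restrict-zeros t)

  vanishes-zeros : ∀ t → vanishes t (zeros (length t)) ≡ true
  vanishes-zeros [] = refl
  vanishes-zeros (+ zero ∷ t) = vanishes-zeros t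
  vanishes-zeros (+ suc n ∷ t) = vanishes-zeros t
  vanishes-zeros (-[1+ n ] ∷ t) = vanishes-zeros t

-- On the right the slots `ss` no longer depend on which cells of the matrix are zero. This
-- uniformity lets `N-product` exchange the sum over matrices with the sum over placements.
N-comp₁ : ∀ {t ss} lam → NonzeroParts lam → Consistent t ss →
  N lam (comp₁ t) ≡ ∑ (loads ss lam (zeros (length t))) (λ p → ⟦ p == abss t ⟧)
N-comp₁ {t} {ss} lam nz cs = begin
  ∑ (loads (signs (comp₁ t)) lam (zeros (length (comp₁ t)))) G
    ≡⟨ cong (λ p → ∑ (loads (signs (comp₁ t)) lam p) G) (restrict-zeros t) ⟨
  ∑ (loads (signs (comp₁ t)) lam (restrict t z)) G
    ≡⟨ ℕP.*-identityˡ _ ⟨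
  1 ℕ.* ∑ (loads (signs (comp₁ t)) lam (restrict t z)) G
    ≡⟨ cong (λ v → ⟦ v ⟧ ℕ.* ∑ (loads (signs (comp₁ t)) lam (restrict t z)) G) (vanishes-zeros t) ⟨
  ⟦ vanishes t z ⟧ ℕ.* ∑ (loads (signs (comp₁ t)) lam (restrict t z)) G
    ≡⟨ loads-restrict lam z G nz cs len ⟨
  ∑ (loads ss lam z) (λ p → ⟦ vanishes t p ⟧ ℕ.* G (restrict t p))
    ≡⟨ ∑-cong-All (loads-length ss lam z) (λ p eq → ==-split t p (trans eq len)) ⟨
  ∑ (loads ss lam z) (λ p → ⟦ p == abss t ⟧) ∎
  where
  open ≡-Reasoning
  z = zeros (length t)
  G : List ℕ → ℕ
  G p = ⟦ p == abss (comp₁ t) ⟧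
  len : length z ≡ length t
  len = ListP.length-replicate (length t)

-- Row and column sums of placements into cells

stepM : ℤ → List (List Bool) → List (List ℕ) → List (List (List ℕ))
stepM a (ss ∷ SS) (r ∷ P) = map (_∷ P) (step a ss r) ++ map (r ∷_) (stepM a SS P)
stepM a _ _ = []

loadsM : List (List Bool) → List ℤ → List (List ℕ) → List (List (List ℕ))
loadsM SS = runs (λ a → stepM a SS)

Shape : List (List Bool) → List (List ℕ) → Set
Shape = Pointwise (λ ss r → length ss ≡ length r)

private
  map-if : ∀ {A B : Set} (f : A → B) b x → map f (if b then x ∷ [] else []) ≡ (if b then f x ∷ [] else [])
  map-if f true x  = refl
  map-if f false x = refl

step-++ : ∀ a ss ss′ p p′ → length ss ≡ length p →
  step a (ss ++ ss′) (p ++ p′) ≡ map (_++ p′) (step a ss p) ++ map (p ++_) (step a ss′ p′)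
step-++ a [] ss′ [] p′ len = sym (ListP.map-id _)
step-++ a (s ∷ ss) ss′ (x ∷ p) p′ len = begin
  (if accepts s a then (x ℕ.+ ∣ a ∣ ∷ p ++ p′) ∷ [] else []) ++ map (x ∷_) (step a (ss ++ ss′) (p ++ p′))
    ≡⟨ cong₂ _++_ (sym (map-if (_++ p′) (accepts s a) _))
         (trans (cong (map (x ∷_)) (step-++ a ss ss′ p p′ (ℕP.suc-injective len))) (ListP.map-++ (x ∷_) (map (_++ p′) (step a ss p)) _)) ⟩
  map (_++ p′) here′ ++ map (x ∷_) (map (_++ p′) (step a ss p)) ++ map (x ∷_) (map (p ++_) (step a ss′ p′))
    ≡⟨ cong (map (_++ p′) here′ ++_) (cong₂ _++_ (trans (sym (ListP.map-∘ (step a ss p))) (ListP.map-∘ (step a ss p))) (sym (ListP.map-∘ (step a ss′ p′)))) ⟩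
  map (_++ p′) here′ ++ map (_++ p′) (map (x ∷_) (step a ss p)) ++ map ((x ∷ p) ++_) (step a ss′ p′)
    ≡⟨ ListP.++-assoc (map (_++ p′) here′) _ _ ⟨
  (map (_++ p′) here′ ++ map (_++ p′) (map (x ∷_) (step a ss p))) ++ map ((x ∷ p) ++_) (step a ss′ p′)
    ≡⟨ cong (_++ map ((x ∷ p) ++_) (step a ss′ p′)) (ListP.map-++ (_++ p′) here′ _) ⟨
  map (_++ p′) (here′ ++ map (x ∷_) (step a ss p)) ++ map ((x ∷ p) ++_) (step a ss′ p′) ∎
  where
  open ≡-Reasoning
  here′ = if accepts s a then (x ℕ.+ ∣ a ∣ ∷ p) ∷ [] else []

step-concat : ∀ a {SS P} → Shape SS P → step a (concat SS) (concat P) ≡ map concat (stepM a SS P)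
step-concat a [] = refl
step-concat a {ss ∷ SS} {r ∷ P} (l ∷ ls) = begin
  step a (ss ++ concat SS) (r ++ concat P)
    ≡⟨ step-++ a ss (concat SS) r (concat P) l ⟩
  map (_++ concat P) (step a ss r) ++ map (r ++_) (step a (concat SS) (concat P))
    ≡⟨ cong₂ _++_ (ListP.map-∘ (step a ss r)) (trans (cong (map (r ++_)) (step-concat a ls)) (trans (sym (ListP.map-∘ (stepM a SS P))) (ListP.map-∘ (stepM a SS P)))) ⟩
  map concat (map (_∷ P) (step a ss r)) ++ map concat (map (r ∷_) (stepM a SS P))
    ≡⟨ ListP.map-++ concat (map (_∷ P) (step a ss r)) _ ⟨
  map concat (stepM a (ss ∷ SS) (r ∷ P)) ∎
  where open ≡-Reasoning

stepM-shape : ∀ a {SS P} → Shape SS P → All (Shape SS) (stepM a SS P)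
stepM-shape a [] = []
stepM-shape a {ss ∷ SS} (l ∷ ls) = AllP.++⁺
  (AllP.map⁺ (All.map (λ eq → trans l (sym eq) ∷ ls) (step-length a ss)))
  (AllP.map⁺ (All.map (l ∷_) (stepM-shape a ls)))

runs-map : {P Q : Set} {I : P → Set} (st : ℤ → P → List P) (st′ : ℤ → Q → List Q) (φ : P → Q) →
  (∀ a {p} → I p → All I (st a p)) → (∀ a {p} → I p → st′ a (φ p) ≡ map φ (st a p)) →
  ∀ lam {p} → I p → runs st′ lam (φ p) ≡ map φ (runs st lam p)
runs-map st st′ φ inv comm [] i = refl
runs-map {I = I} st st′ φ inv comm (a ∷ lam) {p} i = trans (cong (concatMap (runs st′ lam)) (comm a i)) (go (inv a i))
  where
  go : ∀ {xs} → All I xs → concatMap (runs st′ lam) (map φ xs) ≡ map φ (concatMap (runs st lam) xs)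
  go [] = refl
  go {x ∷ xs} (ix ∷ ixs) = trans (cong₂ _++_ (runs-map st st′ φ inv comm lam ix) (go ixs))
    (sym (ListP.map-++ φ (runs st lam x) _))

-- Links the two views of a cell: a slot of the flattened matrix, as in `N-comp₁`, and a position in
-- a row and a column, as the margins require.
loads-concat : ∀ {SS P} lam → Shape SS P → loads (concat SS) lam (concat P) ≡ map concat (loadsM SS lam P)
loads-concat {SS} lam sh =
  runs-map (λ a → stepM a SS) (λ a → step a (concat SS)) concat (λ a → stepM-shape a) (λ a → step-concat a) lam sh

loadsM-shape : ∀ {SS P} lam → Shape SS P → All (Shape SS) (loadsM SS lam P)
loadsM-shape {SS} lam sh = runs-inv (λ a → stepM a SS) (λ a → stepM-shape a) lam sh

cellSigns : List Bool → List Bool → List (List Bool)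
cellSigns sμ sν = map (λ s → map (s ∨_) sν) sμ

rowSums : List (List ℕ) → List ℕ
rowSums = map (foldr ℕ._+_ 0)

-- A cell accepts a part exactly when its row and its column both do. This is the local form of the
-- multiplicativity of `N`.
accepts-∨ : ∀ s s′ a → ⟦ accepts (s ∨ s′) a ⟧ ≡ ⟦ accepts s a ⟧ ℕ.* ⟦ accepts s′ a ⟧
accepts-∨ false s′ a = sym (ℕP.+-identityʳ _)
accepts-∨ true false a = sym (ℕP.*-identityʳ _)
accepts-∨ true true a with isNeg a
... | true  = refl
... | false = refl

-- Wherever in the row `a` lands, the row sum grows by the same `∣ a ∣`; acceptance by the row
-- factors out and only the choice of a column remains.
∑-row-step : ∀ a s sν r (K : ℕ → List ℕ → ℕ) →
  ∑ (step a (map (s ∨_) sν) r) (λ r′ → K (foldr ℕ._+_ 0 r′) r′) ≡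
  ⟦ accepts s a ⟧ ℕ.* ∑ (step a sν r) (K (foldr ℕ._+_ 0 r ℕ.+ ∣ a ∣))
∑-row-step a s [] r K = sym (ℕP.*-zeroʳ ⟦ accepts s a ⟧)
∑-row-step a s (s′ ∷ sν) [] K = sym (ℕP.*-zeroʳ ⟦ accepts s a ⟧)
∑-row-step a s (s′ ∷ sν) (x ∷ r) K = begin
  ∑ (step a ((s ∨ s′) ∷ map (s ∨_) sν) (x ∷ r)) (λ r′ → K (foldr ℕ._+_ 0 r′) r′)
    ≡⟨ ∑-step a (s ∨ s′) (map (s ∨_) sν) x r _ ⟩
  ⟦ accepts (s ∨ s′) a ⟧ ℕ.* K (x ℕ.+ ∣ a ∣ ℕ.+ S) (x ℕ.+ ∣ a ∣ ∷ r) ℕ.+ ∑ (step a (map (s ∨_) sν) r) (λ r′ → K (x ℕ.+ foldr ℕ._+_ 0 r′) (x ∷ r′))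
    ≡⟨ cong₂ ℕ._+_ (cong₂ ℕ._*_ (accepts-∨ s s′ a) (cong (λ k → K k (x ℕ.+ ∣ a ∣ ∷ r)) (xy∙z≈xz∙y x ∣ a ∣ S)))
         (∑-row-step a s sν r (λ k r′ → K (x ℕ.+ k) (x ∷ r′))) ⟩
  ⟦ accepts s a ⟧ ℕ.* ⟦ accepts s′ a ⟧ ℕ.* K (x ℕ.+ S ℕ.+ ∣ a ∣) (x ℕ.+ ∣ a ∣ ∷ r) ℕ.+ ⟦ accepts s a ⟧ ℕ.* ∑ (step a sν r) (λ r′ → K (x ℕ.+ (S ℕ.+ ∣ a ∣)) (x ∷ r′))
    ≡⟨ cong₂ ℕ._+_ (ℕP.*-assoc ⟦ accepts s a ⟧ _ _) (cong (λ k → ⟦ accepts s a ⟧ ℕ.* ∑ (step a sν r) (λ r′ → K k (x ∷ r′))) (sym (ℕP.+-assoc x S ∣ a ∣))) ⟩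
  ⟦ accepts s a ⟧ ℕ.* (⟦ accepts s′ a ⟧ ℕ.* K (x ℕ.+ S ℕ.+ ∣ a ∣) (x ℕ.+ ∣ a ∣ ∷ r)) ℕ.+ ⟦ accepts s a ⟧ ℕ.* ∑ (step a sν r) (λ r′ → K (x ℕ.+ S ℕ.+ ∣ a ∣) (x ∷ r′))
    ≡⟨ ℕP.*-distribˡ-+ ⟦ accepts s a ⟧ _ _ ⟨
  ⟦ accepts s a ⟧ ℕ.* (⟦ accepts s′ a ⟧ ℕ.* K (x ℕ.+ S ℕ.+ ∣ a ∣) (x ℕ.+ ∣ a ∣ ∷ r) ℕ.+ ∑ (step a sν r) (λ r′ → K (x ℕ.+ S ℕ.+ ∣ a ∣) (x ∷ r′)))
    ≡⟨ cong (⟦ accepts s a ⟧ ℕ.*_) (∑-step a s′ sν x r _) ⟨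
  ⟦ accepts s a ⟧ ℕ.* ∑ (step a (s′ ∷ sν) (x ∷ r)) (K (x ℕ.+ S ℕ.+ ∣ a ∣)) ∎
  where
  open ≡-Reasoning
  open import Algebra.Properties.CommutativeSemigroup ℕP.+-commutativeSemigroup using (xy∙z≈xz∙y)
  S = foldr ℕ._+_ 0 r

-- Acceptance does not look at the loads, so a placement commutes with adding a fixed load vector.
step-zipʳ : ∀ a ss p q → length p ≡ length q → step a ss (zipWith ℕ._+_ p q) ≡ map (zipWith ℕ._+_ p) (step a ss q)
step-zipʳ a [] p q len = refl
step-zipʳ a (s ∷ ss) [] [] len = refl
step-zipʳ a (s ∷ ss) (x ∷ p) (y ∷ q) len = trans
  (cong₂ _++_ (trans (cong (λ k → if accepts s a then (k ∷ zipWith ℕ._+_ p q) ∷ [] else []) (ℕP.+-assoc x y ∣ a ∣))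
                (sym (map-if (zipWith ℕ._+_ (x ∷ p)) (accepts s a) _)))
    (trans (cong (map _) (step-zipʳ a ss p q (ℕP.suc-injective len))) (trans (sym (ListP.map-∘ (step a ss q))) (ListP.map-∘ (step a ss q)))))
  (sym (ListP.map-++ (zipWith ℕ._+_ (x ∷ p)) (if accepts s a then _ else []) _))

∑-zipʳ : ∀ a ss p q (F : List ℕ → ℕ) → length p ≡ length q →
  ∑ (step a ss q) (λ q′ → F (zipWith ℕ._+_ p q′)) ≡ ∑ (step a ss (zipWith ℕ._+_ p q)) F
∑-zipʳ a ss p q F len = sym (trans (cong (λ L → ∑ L F) (step-zipʳ a ss p q len)) (∑-map F (zipWith ℕ._+_ p) (step a ss q)))

∑-zipˡ : ∀ a ss p q (F : List ℕ → ℕ) → length p ≡ length q →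
  ∑ (step a ss p) (λ p′ → F (zipWith ℕ._+_ p′ q)) ≡ ∑ (step a ss (zipWith ℕ._+_ p q)) F
∑-zipˡ a ss p q F len = begin
  ∑ (step a ss p) (λ p′ → F (zipWith ℕ._+_ p′ q)) ≡⟨ ∑-cong (step a ss p) (λ p′ → cong F (ListP.zipWith-comm ℕ._+_ ℕP.+-comm p′ q)) ⟩
  ∑ (step a ss p) (λ p′ → F (zipWith ℕ._+_ q p′)) ≡⟨ ∑-zipʳ a ss q p F (sym len) ⟩
  ∑ (step a ss (zipWith ℕ._+_ q p)) F             ≡⟨ cong (λ r → ∑ (step a ss r) F) (ListP.zipWith-comm ℕ._+_ ℕP.+-comm q p) ⟩
  ∑ (step a ss (zipWith ℕ._+_ p q)) F             ∎
  where open ≡-Reasoning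

Rect : ℕ → List Bool → List (List ℕ) → Set
Rect l sμ P = Pointwise (λ _ r → length r ≡ l) sμ P

rect-All : ∀ {l sμ P} → Rect l sμ P → All (λ r → length r ≡ l) P
rect-All [] = []
rect-All (p ∷ ps) = p ∷ rect-All ps

-- A cell is a row and a column chosen independently. Whether `a` goes into the first row or below
-- it, the column choice becomes a step on the same vector `zipWith ℕ._+_ r C`.
∑-stepM : ∀ a {sμ P} sν (H : List ℕ → List ℕ → ℕ) → Rect (length sν) sμ P →
  ∑ (stepM a (cellSigns sμ sν) P) (λ P′ → H (rowSums P′) (colSums (length sν) P′)) ≡
  ∑ (step a sμ (rowSums P)) (λ ρ → ∑ (step a sν (colSums (length sν) P)) (H ρ))
∑-stepM a sν H [] = refl
∑-stepM a {s ∷ sμ} {r ∷ P} sν H (lr ∷ ls) = begin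
  ∑ (map (_∷ P) R ++ map (r ∷_) (stepM a (cellSigns sμ sν) P)) G
    ≡⟨ ∑-++ G (map (_∷ P) R) _ ⟩
  ∑ (map (_∷ P) R) G ℕ.+ ∑ (map (r ∷_) (stepM a (cellSigns sμ sν) P)) G
    ≡⟨ cong₂ ℕ._+_ (∑-map G (_∷ P) R) (∑-map G (r ∷_) (stepM a (cellSigns sμ sν) P)) ⟩
  ∑ R (λ r′ → H (foldr ℕ._+_ 0 r′ ∷ ρ) (zipWith ℕ._+_ r′ C)) ℕ.+
  ∑ (stepM a (cellSigns sμ sν) P) (λ P′ → H (S ∷ rowSums P′) (zipWith ℕ._+_ r (colSums (length sν) P′)))
    ≡⟨ cong₂ ℕ._+_ (∑-row-step a s sν r (λ k r′ → H (k ∷ ρ) (zipWith ℕ._+_ r′ C)))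
         (∑-stepM a sν (λ ρ c → H (S ∷ ρ) (zipWith ℕ._+_ r c)) ls) ⟩
  ⟦ accepts s a ⟧ ℕ.* ∑ (step a sν r) (λ r′ → H (S ℕ.+ ∣ a ∣ ∷ ρ) (zipWith ℕ._+_ r′ C)) ℕ.+
  ∑ (step a sμ ρ) (λ ρ′ → ∑ (step a sν C) (λ c → H (S ∷ ρ′) (zipWith ℕ._+_ r c)))
    ≡⟨ cong₂ ℕ._+_ (cong (⟦ accepts s a ⟧ ℕ.*_) (∑-zipˡ a sν r C _ len))
         (∑-cong (step a sμ ρ) (λ ρ′ → ∑-zipʳ a sν r C _ len)) ⟩
  ⟦ accepts s a ⟧ ℕ.* ∑ (step a sν (zipWith ℕ._+_ r C)) (H (S ℕ.+ ∣ a ∣ ∷ ρ)) ℕ.+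
  ∑ (step a sμ ρ) (λ ρ′ → ∑ (step a sν (zipWith ℕ._+_ r C)) (H (S ∷ ρ′)))
    ≡⟨ ∑-step a s sμ S ρ _ ⟨
  ∑ (step a (s ∷ sμ) (S ∷ ρ)) (λ ρ → ∑ (step a sν (zipWith ℕ._+_ r C)) (H ρ)) ∎
  where
  open ≡-Reasoning
  R = step a (map (s ∨_) sν) r
  C = colSums (length sν) P
  ρ = rowSums P
  S = foldr ℕ._+_ 0 r
  G : List (List ℕ) → ℕ
  G P′ = H (rowSums P′) (colSums (length sν) P′)
  len : length r ≡ length C
  len = trans lr (sym (colSums-length (length sν) P (rect-All ls)))

rect-shape : ∀ {sμ P} sν → Rect (length sν) sμ P → Shape (cellSigns sμ sν) P
rect-shape sν [] = []
rect-shape sν (l ∷ ls) = trans (ListP.length-map _ sν) (sym l) ∷ rect-shape sν ls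

shape-rect : ∀ {sμ P} sν → Shape (cellSigns sμ sν) P → Rect (length sν) sμ P
shape-rect {[]} sν [] = []
shape-rect {s ∷ sμ} sν (l ∷ ls) = trans (sym l) (ListP.length-map _ sν) ∷ shape-rect sν ls

∑-loadsM : ∀ lam {sμ P} sν (H : List ℕ → List ℕ → ℕ) → Rect (length sν) sμ P →
  ∑ (loadsM (cellSigns sμ sν) lam P) (λ P′ → H (rowSums P′) (colSums (length sν) P′)) ≡
  ∑ (loads sμ lam (rowSums P)) (λ ρ → ∑ (loads sν lam (colSums (length sν) P)) (H ρ))
∑-loadsM [] {sμ} {P} sν H sh = cong (ℕ._+ 0) (sym (ℕP.+-identityʳ _))
∑-loadsM (a ∷ lam) {sμ} {P} sν H sh = begin
  ∑ (loadsM SS (a ∷ lam) P) G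
    ≡⟨ ∑-runs (λ a → stepM a SS) a lam P G ⟩
  ∑ (stepM a SS P) (λ P₁ → ∑ (loadsM SS lam P₁) G)
    ≡⟨ ∑-cong-All (stepM-shape a (rect-shape sν sh)) (λ P₁ sh₁ → ∑-loadsM lam sν H (shape-rect sν sh₁)) ⟩
  ∑ (stepM a SS P) (λ P₁ → ∑ (loads sμ lam (rowSums P₁)) (λ ρ → ∑ (loads sν lam (colSums (length sν) P₁)) (H ρ)))
    ≡⟨ ∑-stepM a sν (λ ρ₁ c₁ → ∑ (loads sμ lam ρ₁) (λ ρ → ∑ (loads sν lam c₁) (H ρ))) sh ⟩
  ∑ (step a sμ (rowSums P)) (λ ρ₁ → ∑ (step a sν C) (λ c₁ → ∑ (loads sμ lam ρ₁) (λ ρ → ∑ (loads sν lam c₁) (H ρ))))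
    -- The column choice for `a` moves past the row choices for the remaining parts, so that rows
    -- and columns separate into two full runs.
    ≡⟨ ∑-cong (step a sμ (rowSums P)) (λ ρ₁ → ∑-swap _ (step a sν C) (loads sμ lam ρ₁)) ⟩
  ∑ (step a sμ (rowSums P)) (λ ρ₁ → ∑ (loads sμ lam ρ₁) (λ ρ → ∑ (step a sν C) (λ c₁ → ∑ (loads sν lam c₁) (H ρ))))
    ≡⟨ ∑-loads sμ a lam (rowSums P) _ ⟨
  ∑ (loads sμ (a ∷ lam) (rowSums P)) (λ ρ → ∑ (step a sν C) (λ c₁ → ∑ (loads sν lam c₁) (H ρ)))
    ≡⟨ ∑-cong (loads sμ (a ∷ lam) (rowSums P)) (λ ρ → ∑-loads sν a lam C (H ρ)) ⟨
  ∑ (loads sμ (a ∷ lam) (rowSums P)) (λ ρ → ∑ (loads sν (a ∷ lam) C) (H ρ)) ∎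
  where
  open ≡-Reasoning
  SS = cellSigns sμ sν
  C = colSums (length sν) P
  G : List (List ℕ) → ℕ
  G P′ = H (rowSums P′) (colSums (length sν) P′)

-- Multiplicativity of N

withSign : ℤ → ℤ → ℕ → ℤ
withSign a b x = if isNeg a ∨ isNeg b then ℤ.- (+ x) else + x

signedRow : ℤ → List ℤ → List ℕ → List ℤ
signedRow a = zipWith (withSign a)

signedMat : List ℤ → List ℤ → List (List ℕ) → List (List ℤ)
signedMat μ ν = zipWith (λ a r → signedRow a ν r) μ

∣withSign∣ : ∀ a b x → ∣ withSign a b x ∣ ≡ x
∣withSign∣ a b x with isNeg a ∨ isNeg b
... | true  = ℤP.∣-i∣≡∣i∣ (+ x)
... | false = refl

withSign-OK : ∀ a b x → T (signOK a b (withSign a b x))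
withSign-OK a b x with isNeg a ∨ isNeg b
... | true  = fromWitness {a? = ℤ.- (+ x) ℤ.≤? + 0} (ℤP.neg-mono-≤ {+ 0} {+ x} (ℤ.+≤+ z≤n))
... | false = fromWitness {a? = + 0 ℤ.≤? + x} (ℤ.+≤+ z≤n)

withSign-unique : ∀ a b m → T (signOK a b m) → m ≡ withSign a b ∣ m ∣
withSign-unique a b m h with isNeg a ∨ isNeg b
withSign-unique a b (+ zero) h | true = refl
withSign-unique a b -[1+ n ] h | true = refl
withSign-unique a b (+ n) h | false = refl

abss-signedRow : ∀ a ν r → length r ≡ length ν → abss (signedRow a ν r) ≡ r
abss-signedRow a [] [] len = refl
abss-signedRow a (b ∷ ν) (x ∷ r) len = cong₂ _∷_ (∣withSign∣ a b x) (abss-signedRow a ν r (ℕP.suc-injective len))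

signedRow-OK : ∀ a ν r → length r ≡ length ν → Pointwise (λ b m → T (signOK a b m)) ν (signedRow a ν r)
signedRow-OK a [] [] len = []
signedRow-OK a (b ∷ ν) (x ∷ r) len = withSign-OK a b x ∷ signedRow-OK a ν r (ℕP.suc-injective len)

signedRow-unique : ∀ {a ν r} → Pointwise (λ b m → T (signOK a b m)) ν r → r ≡ signedRow a ν (abss r)
signedRow-unique [] = refl
signedRow-unique {a} {b ∷ ν} {m ∷ r} (p ∷ ps) = cong₂ _∷_ (withSign-unique a b m p) (signedRow-unique ps)

signedMat-unique : ∀ {μ ν M} → Pointwise (Row ν) μ M → M ≡ signedMat μ ν (map abss M)
signedMat-unique [] = refl
signedMat-unique {a ∷ μ} {ν} ((_ , _ , s) ∷ rs) = cong₂ _∷_ (signedRow-unique s) (signedMat-unique rs)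

absMat-signedMat : ∀ {μ ν P} → Pointwise (λ _ r → length r ≡ length ν) μ P → map abss (signedMat μ ν P) ≡ P
absMat-signedMat [] = refl
absMat-signedMat {a ∷ μ} {ν} {r ∷ P} (l ∷ ls) = cong₂ _∷_ (abss-signedRow a ν r l) (absMat-signedMat ls)

signedMat-rows : ∀ {μ ν P} → Pointwise (λ _ r → length r ≡ length ν) μ P → rowSums P ≡ abss μ →
  Pointwise (Row ν) μ (signedMat μ ν P)
signedMat-rows [] eq = []
signedMat-rows {a ∷ μ} {ν} {r ∷ P} (l ∷ ls) eq =
  ( trans (ListP.length-zipWith (withSign a) ν r) (trans (cong (length ν ℕ.⊓_) l) (ℕP.⊓-idem _))
  , trans (cong (foldr ℕ._+_ 0) (abss-signedRow a ν r l)) (ListP.∷-injectiveˡ eq)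
  , signedRow-OK a ν r l ) ∷ signedMat-rows ls (ListP.∷-injectiveʳ eq)

rows-absSums : ∀ {μ ν M} → Pointwise (Row ν) μ M → rowSums (map abss M) ≡ abss μ
rows-absSums [] = refl
rows-absSums ((_ , s , _) ∷ rs) = cong₂ _∷_ s (rows-absSums rs)

rows-∈-words : ∀ {μ ν M} B → All (λ a → ∣ a ∣ ≤ B) μ → Pointwise (Row ν) μ M → M ∈ words (words (box B) (length ν)) (length μ)
rows-∈-words {μ} {ν} {M} B bd rs =
  subst (λ k → M ∈ words (words (box B) (length ν)) k) (sym (PW.Pointwise-length rs)) (∈-words⁺ (go bd rs))
  where
  row : ∀ r {k} → absSum r ≡ k → k ≤ B → All (_∈ box B) r
  row r refl k≤B = All.map (λ {m} h → ∈-box {B} m (ℕP.≤-trans h k≤B)) (parts≤absSum r)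
  go : ∀ {μ M} → All (λ a → ∣ a ∣ ≤ B) μ → Pointwise (Row ν) μ M → All (_∈ words (box B) (length ν)) M
  go [] [] = []
  go {M = r ∷ _} (b ∷ bs) ((l , s , _) ∷ rs) = subst (λ k → r ∈ words (box B) k) l (∈-words⁺ (row r s b)) ∷ go bs rs

concat-injective : ∀ {A : Set} {k : ℕ} {I : Set} {is : List I} {P Q : List (List A)} → Pointwise (λ _ r → length r ≡ k) is P →
  Pointwise (λ _ r → length r ≡ k) is Q → concat P ≡ concat Q → P ≡ Q
concat-injective [] [] eq = refl
concat-injective {P = p ∷ P} {q ∷ Q} (l ∷ ls) (l′ ∷ ls′) eq =
  let e , e′ = split p q (trans l (sym l′)) eq in cong₂ _∷_ e (concat-injective ls ls′ e′)
  where
  split : ∀ {A : Set} (p q : List A) {u v} → length p ≡ length q → p ++ u ≡ q ++ v → p ≡ q × u ≡ v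
  split [] [] len eq = refl , eq
  split (x ∷ p) (y ∷ q) len eq =
    let e , e′ = split p q (ℕP.suc-injective len) (ListP.∷-injectiveʳ eq) in cong₂ _∷_ (ListP.∷-injectiveˡ eq) e , e′

abss-concat : ∀ M → concat (map abss M) ≡ abss (concat M)
abss-concat [] = refl
abss-concat (r ∷ M) = trans (cong (abss r ++_) (abss-concat M)) (sym (ListP.map-++ ∣_∣ r (concat M)))

-- A matrix in 𝒩 is determined by its absolute values, and it exists iff these have the right margins.
∑-absMat : ∀ μ ν P → Pointwise (λ _ r → length r ≡ length ν) μ P →
  ∑ (𝒩 μ ν) (λ M → ⟦ concat P == abss (concat M) ⟧) ≡ ⟦ rowSums P == abss μ ⟧ ℕ.* ⟦ colSums (length ν) P == abss ν ⟧
∑-absMat μ ν P sh = begin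
  ∑ (𝒩 μ ν) (λ M → ⟦ concat P == abss (concat M) ⟧)
    ≡⟨ ∑-filterᵇ (inN μ ν) _ W ⟩
  ∑ W (λ M → ⟦ inN μ ν M ⟧ ℕ.* ⟦ concat P == abss (concat M) ⟧)
    ≡⟨ ∑-cong W (λ M → trans (sym (⟦∧⟧ (inN μ ν M) _)) (sym (ℕP.*-identityʳ _))) ⟩
  ∑ W (λ M → ⟦ inN μ ν M ∧ (concat P == abss (concat M)) ⟧ ℕ.* 1)
    ≡⟨ count (rowSums P == abss μ) (colSums (length ν) P == abss ν) refl refl ⟩
  ⟦ (rowSums P == abss μ) ∧ (colSums (length ν) P == abss ν) ⟧
    ≡⟨ ⟦∧⟧ (rowSums P == abss μ) _ ⟩
  ⟦ rowSums P == abss μ ⟧ ℕ.* ⟦ colSums (length ν) P == abss ν ⟧ ∎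
  where
  open ≡-Reasoning
  W = words (words (box (absSum μ)) (length ν)) (length μ)
  E : List (List ℤ) → Bool
  E M = inN μ ν M ∧ (concat P == abss (concat M))
  absRows : ∀ {μ M} → Pointwise (Row ν) μ M → Pointwise (λ _ r → length r ≡ length ν) μ (map abss M)
  absRows [] = []
  absRows {M = r ∷ _} ((l , _) ∷ rs) = trans (ListP.length-map ∣_∣ r) l ∷ absRows rs
  E⁻ : ∀ M → T (E M) → IsMat μ ν M × P ≡ map abss M
  E⁻ M h = let h₁ , h₂ = T-∧⁻ {inN μ ν M} h
               m = inN⁻ μ ν M h₁
           in m , concat-injective sh (absRows (rows m)) (trans (toWitness h₂) (sym (abss-concat M)))
  none : (∀ M → ¬ (T (E M))) → ∑ W (λ M → ⟦ E M ⟧ ℕ.* 1) ≡ 0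
  none h = ∑-zero W (λ M _ → cong (ℕ._* 1) (⟦⟧-zero (h M)))
  count : ∀ x y → (rowSums P == abss μ) ≡ x → (colSums (length ν) P == abss ν) ≡ y →
    ∑ W (λ M → ⟦ E M ⟧ ℕ.* 1) ≡ ⟦ x ∧ y ⟧
  count false y ex ey = none (λ M h → let m , e = E⁻ M h in
    subst T ex (fromWitness (trans (cong rowSums e) (rows-absSums (rows m)))))
  count true false ex ey = none (λ M h → let m , e = E⁻ M h in
    subst T ey (fromWitness (trans (cong (colSums (length ν)) e) (cols m))))
  count true true ex ey = ∑-indicator E (λ _ → 1)
    (words-Unique (words-Unique (box-Unique (absSum μ)) (length ν)) (length μ))
    (rows-∈-words (absSum μ) (parts≤absSum μ) rs)
    (T-∧⁺ {inN μ ν M₀} (inN⁺ (mat rs (trans (cong (colSums (length ν)) abs₀) colsP)))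
      (fromWitness (trans (cong concat (sym abs₀)) (abss-concat M₀))))
    (λ M h → let m , e = E⁻ M h in trans (signedMat-unique (rows m)) (cong (signedMat μ ν) (sym e)))
    where
    rowsP : rowSums P ≡ abss μ
    rowsP = toWitness (subst T (sym ex) _)
    colsP : colSums (length ν) P ≡ abss ν
    colsP = toWitness (subst T (sym ey) _)
    M₀ = signedMat μ ν P
    rs : Pointwise (Row ν) μ M₀
    rs = signedMat-rows sh rowsP
    abs₀ : map abss M₀ ≡ P
    abs₀ = absMat-signedMat sh

signOK-consistent : ∀ {a b m} → T (signOK a b m) → T (isNonzero m) → isNeg m ≡ isNeg a ∨ isNeg b
signOK-consistent {a} {b} {m} h m≠0 with isNeg a ∨ isNeg b
signOK-consistent {m = + suc n} () m≠0 | true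
signOK-consistent {m = -[1+ n ]} h m≠0 | true = refl
signOK-consistent {m = + suc n} h m≠0 | false = refl

mat-consistent : ∀ {μ ν M} → Pointwise (Row ν) μ M → Consistent (concat M) (concat (cellSigns (signs μ) (signs ν)))
mat-consistent [] = []
mat-consistent {a ∷ μ} {ν} ((_ , _ , s) ∷ rs) = PW.++⁺ (row s) (mat-consistent rs)
  where
  row : ∀ {ν r} → Pointwise (λ b m → T (signOK a b m)) ν r → Consistent r (map (isNeg a ∨_) (signs ν))
  row [] = []
  row {b ∷ _} {m ∷ _} (p ∷ ps) = signOK-consistent {a} {b} {m} p ∷ row ps

zeroMat : ℕ → ℕ → List (List ℕ)
zeroMat k l = replicate k (zeros l)

zeroMat-rect : ∀ {A : Set} l (xs : List A) → Pointwise (λ _ r → length r ≡ l) xs (zeroMat (length xs) l)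
zeroMat-rect l [] = []
zeroMat-rect l (x ∷ xs) = ListP.length-replicate l ∷ zeroMat-rect l xs

concat-zeroMat : ∀ {k l} {M : List (List ℤ)} → length M ≡ k → All (λ r → length r ≡ l) M →
  concat (zeroMat k l) ≡ zeros (length (concat M))
concat-zeroMat refl [] = refl
concat-zeroMat {l = l} {r ∷ M} refl (lr ∷ ls) = trans (cong₂ _++_ (cong zeros (sym lr)) (concat-zeroMat {M = M} refl ls))
  (trans (sym (replicate-++ (length r) (length (concat M)))) (cong zeros (sym (ListP.length-++ r))))
  where
  replicate-++ : ∀ i j → zeros (i ℕ.+ j) ≡ zeros i ++ zeros j
  replicate-++ zero j = refl
  replicate-++ (suc i) j = cong (0 ∷_) (replicate-++ i j)

rowSums-zeroMat : ∀ k l → rowSums (zeroMat k l) ≡ zeros k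
rowSums-zeroMat zero l = refl
rowSums-zeroMat (suc k) l = cong₂ _∷_ (sum-zeros l) (rowSums-zeroMat k l)
  where
  sum-zeros : ∀ l → foldr ℕ._+_ 0 (zeros l) ≡ 0
  sum-zeros zero = refl
  sum-zeros (suc l) = sum-zeros l

colSums-zeroMat : ∀ k l → colSums l (zeroMat k l) ≡ zeros l
colSums-zeroMat zero l = refl
colSums-zeroMat (suc k) l = trans (cong (zipWith ℕ._+_ (zeros l)) (colSums-zeroMat k l)) (zipWith-+-zeros (zeros l) l (ListP.length-replicate l))

N-product : ∀ lam μ ν → NonzeroParts lam → ∑ (𝒩 μ ν) (λ M → N lam (comp M)) ≡ N lam μ ℕ.* N lam ν
N-product lam μ ν nz = begin
  ∑ (𝒩 μ ν) (λ M → N lam (comp M))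
    ≡⟨ ∑-cong-∈ (𝒩 μ ν) perMatrix ⟩
  ∑ (𝒩 μ ν) (λ M → ∑ L (λ P → ⟦ concat P == abss (concat M) ⟧))
    -- `L` is the same for every `M`, because zero cells were kept as slots.
    ≡⟨ ∑-swap _ (𝒩 μ ν) L ⟩
  ∑ L (λ P → ∑ (𝒩 μ ν) (λ M → ⟦ concat P == abss (concat M) ⟧))
    ≡⟨ ∑-cong-All (loadsM-shape lam shape₀) (λ P sh → ∑-absMat μ ν P (unsign (shape-rect (signs ν) sh))) ⟩
  ∑ L (λ P → ⟦ rowSums P == abss μ ⟧ ℕ.* ⟦ colSums l P == abss ν ⟧)
    ≡⟨ cong (λ l → ∑ L (λ P → ⟦ rowSums P == abss μ ⟧ ℕ.* ⟦ colSums l P == abss ν ⟧)) len ⟩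
  ∑ L (λ P → ⟦ rowSums P == abss μ ⟧ ℕ.* ⟦ colSums (length (signs ν)) P == abss ν ⟧)
    ≡⟨ ∑-loadsM lam (signs ν) (λ ρ c → ⟦ ρ == abss μ ⟧ ℕ.* ⟦ c == abss ν ⟧) rect₀ ⟩
  ∑ (loads (signs μ) lam (rowSums P₀)) (λ ρ → ∑ (loads (signs ν) lam (colSums (length (signs ν)) P₀)) (λ c → ⟦ ρ == abss μ ⟧ ℕ.* ⟦ c == abss ν ⟧))
    ≡⟨ cong₂ (λ p q → ∑ (loads (signs μ) lam p) (λ ρ → ∑ (loads (signs ν) lam q) (λ c → ⟦ ρ == abss μ ⟧ ℕ.* ⟦ c == abss ν ⟧)))
         (rowSums-zeroMat (length μ) l) (trans (cong (λ l′ → colSums l′ P₀) (sym len)) (colSums-zeroMat (length μ) l)) ⟩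
  ∑ (loads (signs μ) lam (zeros (length μ))) (λ ρ → ∑ (loads (signs ν) lam (zeros l)) (λ c → ⟦ ρ == abss μ ⟧ ℕ.* ⟦ c == abss ν ⟧))
    ≡⟨ ∑-cong (loads (signs μ) lam (zeros (length μ))) (λ ρ → *-∑ ⟦ ρ == abss μ ⟧ _ (loads (signs ν) lam (zeros l))) ⟩
  ∑ (loads (signs μ) lam (zeros (length μ))) (λ ρ → ⟦ ρ == abss μ ⟧ ℕ.* N lam ν)
    ≡⟨ ∑-* (N lam ν) _ (loads (signs μ) lam (zeros (length μ))) ⟩
  N lam μ ℕ.* N lam ν ∎
  where
  open ≡-Reasoning
  l = length ν
  SS = cellSigns (signs μ) (signs ν)
  P₀ = zeroMat (length μ) l
  L = loadsM SS lam P₀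
  len : l ≡ length (signs ν)
  len = sym (ListP.length-map isNeg ν)
  rect₀ : Rect (length (signs ν)) (signs μ) P₀
  rect₀ = subst (λ k → Rect k (signs μ) P₀) len
    (subst (λ k → Rect l (signs μ) (zeroMat k l)) (ListP.length-map isNeg μ) (zeroMat-rect l (signs μ)))
  shape₀ : Shape SS P₀
  shape₀ = rect-shape (signs ν) rect₀
  unsign : ∀ {μ P} → Rect (length (signs ν)) (signs μ) P → Pointwise (λ _ r → length r ≡ l) μ P
  unsign {[]} [] = []
  unsign {a ∷ μ} (p ∷ ps) = trans p (sym len) ∷ unsign ps
  perMatrix : ∀ M → M ∈ 𝒩 μ ν → N lam (comp M) ≡ ∑ L (λ P → ⟦ concat P == abss (concat M) ⟧)
  perMatrix M M∈ = begin
    N lam (comp₁ (concat M))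
      ≡⟨ N-comp₁ lam nz (mat-consistent (rows m)) ⟩
    ∑ (loads (concat SS) lam (zeros (length (concat M)))) (λ p → ⟦ p == abss (concat M) ⟧)
      ≡⟨ cong (λ p → ∑ (loads (concat SS) lam p) (λ p → ⟦ p == abss (concat M) ⟧))
           (concat-zeroMat (sym (PW.Pointwise-length (rows m))) (rows-length (rows m))) ⟨
    ∑ (loads (concat SS) lam (concat P₀)) (λ p → ⟦ p == abss (concat M) ⟧)
      ≡⟨ cong (λ L → ∑ L (λ p → ⟦ p == abss (concat M) ⟧)) (loads-concat lam shape₀) ⟩
    ∑ (map concat L) (λ p → ⟦ p == abss (concat M) ⟧)
      ≡⟨ ∑-map _ concat L ⟩
    ∑ L (λ P → ⟦ concat P == abss (concat M) ⟧) ∎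
    where
    m : IsMat μ ν M
    m = ∈-𝒩⁻ {μ} {ν} M∈

-- Symmetry, positivity and transposition

-- Two placements commute since acceptance ignores the loads and loads add commutatively. The four
-- cases, by whether each part enters the first slot, are matched by a semiring identity.
step-swap : ∀ a b ss p (G : List ℕ → ℕ) →
  ∑ (step a ss p) (λ p′ → ∑ (step b ss p′) G) ≡ ∑ (step b ss p) (λ p′ → ∑ (step a ss p′) G)
step-swap a b [] p G = refl
step-swap a b (s ∷ ss) [] G = refl
step-swap a b (s ∷ ss) (x ∷ p) G = begin
  ∑ (step a (s ∷ ss) (x ∷ p)) (λ p′ → ∑ (step b (s ∷ ss) p′) G)
    ≡⟨ expand a b ⟩
  A ℕ.* (B ℕ.* G (x ℕ.+ ∣ a ∣ ℕ.+ ∣ b ∣ ∷ p) ℕ.+ Gb) ℕ.+ (B ℕ.* Ga ℕ.+ ∑ (step a ss p) (λ p′ → ∑ (step b ss p′) (G ∘ (x ∷_))))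
    ≡⟨ cong₂ (λ y z → A ℕ.* (B ℕ.* G (y ∷ p) ℕ.+ Gb) ℕ.+ (B ℕ.* Ga ℕ.+ z)) (xy∙z≈xz∙y x ∣ a ∣ ∣ b ∣) (step-swap a b ss p (G ∘ (x ∷_))) ⟩
  A ℕ.* (B ℕ.* g ℕ.+ Gb) ℕ.+ (B ℕ.* Ga ℕ.+ S)
    ≡⟨ solve 6 (λ A B g Gb Ga S → A :* (B :* g :+ Gb) :+ (B :* Ga :+ S) := B :* (A :* g :+ Ga) :+ (A :* Gb :+ S)) refl A B g Gb Ga S ⟩
  B ℕ.* (A ℕ.* g ℕ.+ Ga) ℕ.+ (A ℕ.* Gb ℕ.+ S)
    ≡⟨ expand b a ⟨
  ∑ (step b (s ∷ ss) (x ∷ p)) (λ p′ → ∑ (step a (s ∷ ss) p′) G) ∎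
  where
  open ≡-Reasoning
  open +-*-Solver using (solve; _:=_; _:+_; _:*_)
  open import Algebra.Properties.CommutativeSemigroup ℕP.+-commutativeSemigroup using (xy∙z≈xz∙y)
  A = ⟦ accepts s a ⟧
  B = ⟦ accepts s b ⟧
  Ga = ∑ (step a ss p) (λ p′ → G (x ℕ.+ ∣ b ∣ ∷ p′))
  Gb = ∑ (step b ss p) (λ p′ → G (x ℕ.+ ∣ a ∣ ∷ p′))
  g = G (x ℕ.+ ∣ b ∣ ℕ.+ ∣ a ∣ ∷ p)
  S = ∑ (step b ss p) (λ p′ → ∑ (step a ss p′) (G ∘ (x ∷_)))
  expand : ∀ a b → ∑ (step a (s ∷ ss) (x ∷ p)) (λ p′ → ∑ (step b (s ∷ ss) p′) G) ≡
    ⟦ accepts s a ⟧ ℕ.* (⟦ accepts s b ⟧ ℕ.* G (x ℕ.+ ∣ a ∣ ℕ.+ ∣ b ∣ ∷ p) ℕ.+ ∑ (step b ss p) (λ p′ → G (x ℕ.+ ∣ a ∣ ∷ p′))) ℕ.+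
    (⟦ accepts s b ⟧ ℕ.* ∑ (step a ss p) (λ p′ → G (x ℕ.+ ∣ b ∣ ∷ p′)) ℕ.+ ∑ (step a ss p) (λ p′ → ∑ (step b ss p′) (G ∘ (x ∷_))))
  expand a b = trans (∑-step a s ss x p _) (cong₂ ℕ._+_ (cong (⟦ accepts s a ⟧ ℕ.*_) (∑-step b s ss (x ℕ.+ ∣ a ∣) p G))
    (trans (∑-cong (step a ss p) (λ p′ → ∑-step b s ss x p′ G))
      (trans (ℕΣ.∑-∙ _ _ (step a ss p)) (cong (ℕ._+ _) (*-∑ ⟦ accepts s b ⟧ _ (step a ss p))))))

loads-↭ : ∀ ss {lam lam′} → lam ↭ lam′ → ∀ p (G : List ℕ → ℕ) → ∑ (loads ss lam p) G ≡ ∑ (loads ss lam′ p) G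
loads-↭ ss ↭.refl p G = refl
loads-↭ ss {a ∷ lam} {a ∷ lam′} (↭.prep a π) p G = trans (∑-loads ss a lam p G)
  (trans (∑-cong (step a ss p) (λ p′ → loads-↭ ss π p′ G)) (sym (∑-loads ss a lam′ p G)))
loads-↭ ss {a ∷ b ∷ lam} {b ∷ a ∷ lam′} (↭.swap a b π) p G = begin
  ∑ (loads ss (a ∷ b ∷ lam) p) G
    ≡⟨ two a b lam ⟩
  ∑ (step a ss p) (λ p₁ → ∑ (step b ss p₁) (λ p₂ → ∑ (loads ss lam p₂) G))
    ≡⟨ step-swap a b ss p _ ⟩
  ∑ (step b ss p) (λ p₁ → ∑ (step a ss p₁) (λ p₂ → ∑ (loads ss lam p₂) G))
    ≡⟨ ∑-cong (step b ss p) (λ p₁ → ∑-cong (step a ss p₁) (λ p₂ → loads-↭ ss π p₂ G)) ⟩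
  ∑ (step b ss p) (λ p₁ → ∑ (step a ss p₁) (λ p₂ → ∑ (loads ss lam′ p₂) G))
    ≡⟨ two b a lam′ ⟨
  ∑ (loads ss (b ∷ a ∷ lam′) p) G ∎
  where
  open ≡-Reasoning
  two : ∀ a b lam → ∑ (loads ss (a ∷ b ∷ lam) p) G ≡ ∑ (step a ss p) (λ p₁ → ∑ (step b ss p₁) (λ p₂ → ∑ (loads ss lam p₂) G))
  two a b lam = trans (∑-loads ss a (b ∷ lam) p G) (∑-cong (step a ss p) (λ p₁ → ∑-loads ss b lam p₁ G))
loads-↭ ss (↭.trans π π′) p G = trans (loads-↭ ss π p G) (loads-↭ ss π′ p G)

N-↭ : ∀ {lam lam′} σ → lam ↭ lam′ → N lam σ ≡ N lam′ σ
N-↭ σ π = loads-↭ (signs σ) π (zeros (length σ)) _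

∑-mono : {A : Set} {f g : A → ℕ} (xs : List A) → (∀ x → f x ≤ g x) → ∑ xs f ≤ ∑ xs g
∑-mono [] h = z≤n
∑-mono (x ∷ xs) h = ℕP.+-mono-≤ (h x) (∑-mono xs h)

-- Leaving the first slot untouched from now on is one of the possible ways to continue.
loads-skip : ∀ s ss x lam p (G : List ℕ → ℕ) → ∑ (loads ss lam p) (G ∘ (x ∷_)) ≤ ∑ (loads (s ∷ ss) lam (x ∷ p)) G
loads-skip s ss x [] p G = ℕP.≤-refl
loads-skip s ss x (a ∷ lam) p G = begin
  ∑ (loads ss (a ∷ lam) p) (G ∘ (x ∷_))
    ≡⟨ ∑-loads ss a lam p _ ⟩
  ∑ (step a ss p) (λ p′ → ∑ (loads ss lam p′) (G ∘ (x ∷_)))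
    ≤⟨ ∑-mono (step a ss p) (λ p′ → loads-skip s ss x lam p′ G) ⟩
  ∑ (step a ss p) (λ p′ → ∑ (loads (s ∷ ss) lam (x ∷ p′)) G)
    ≤⟨ ℕP.m≤n+m _ _ ⟩
  ⟦ accepts s a ⟧ ℕ.* ∑ (loads (s ∷ ss) lam (x ℕ.+ ∣ a ∣ ∷ p)) G ℕ.+ ∑ (step a ss p) (λ p′ → ∑ (loads (s ∷ ss) lam (x ∷ p′)) G)
    ≡⟨ ∑-step a s ss x p _ ⟨
  ∑ (step a (s ∷ ss) (x ∷ p)) (λ p′ → ∑ (loads (s ∷ ss) lam p′) G)
    ≡⟨ ∑-loads (s ∷ ss) a lam (x ∷ p) G ⟨
  ∑ (loads (s ∷ ss) (a ∷ lam) (x ∷ p)) G ∎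
  where open ℕP.≤-Reasoning

accepts-self : ∀ a → accepts (isNeg a) a ≡ true
accepts-self (+ _) = refl
accepts-self -[1+ _ ] = refl

-- One assignment is exhibited, each part in its own slot: `a` fills the first slot, which
-- `loads-skip` then leaves alone.
N-self : ∀ lam → 1 ≤ N lam lam
N-self [] = ℕP.≤-refl
N-self (a ∷ lam) = begin
  1
    ≤⟨ N-self lam ⟩
  ∑ (loads (signs lam) lam z) (λ p → ⟦ p == abss lam ⟧)
    ≡⟨ ∑-cong (loads (signs lam) lam z) (λ p → cong ⟦_⟧ (T-ext {p == abss lam} (λ h → fromWitness (cong (∣ a ∣ ∷_) (toWitness h)))
          (λ h → fromWitness (ListP.∷-injectiveʳ (toWitness {a? = ListP.≡-dec ℕ._≟_ (∣ a ∣ ∷ p) _} h))))) ⟩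
  ∑ (loads (signs lam) lam z) (G ∘ (∣ a ∣ ∷_))
    ≤⟨ loads-skip (isNeg a) (signs lam) ∣ a ∣ lam z G ⟩
  ∑ (loads (signs (a ∷ lam)) lam (∣ a ∣ ∷ z)) G
    ≡⟨ ℕP.*-identityˡ _ ⟨
  1 ℕ.* ∑ (loads (signs (a ∷ lam)) lam (∣ a ∣ ∷ z)) G
    ≡⟨ cong (λ b → ⟦ b ⟧ ℕ.* ∑ (loads (signs (a ∷ lam)) lam (∣ a ∣ ∷ z)) G) (accepts-self a) ⟨
  ⟦ accepts (isNeg a) a ⟧ ℕ.* ∑ (loads (signs (a ∷ lam)) lam (∣ a ∣ ∷ z)) G
    ≤⟨ ℕP.m≤m+n _ _ ⟩
  ⟦ accepts (isNeg a) a ⟧ ℕ.* ∑ (loads (signs (a ∷ lam)) lam (∣ a ∣ ∷ z)) G ℕ.+ ∑ (step a (signs lam) z) (λ p → ∑ (loads (signs (a ∷ lam)) lam (0 ∷ p)) G)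
    ≡⟨ ∑-step a (isNeg a) (signs lam) 0 z _ ⟨
  ∑ (step a (signs (a ∷ lam)) (0 ∷ z)) (λ p → ∑ (loads (signs (a ∷ lam)) lam p) G)
    ≡⟨ ∑-loads (signs (a ∷ lam)) a lam (0 ∷ z) G ⟨
  N (a ∷ lam) (a ∷ lam) ∎
  where
  open ℕP.≤-Reasoning
  z = zeros (length lam)
  G : List ℕ → ℕ
  G p = ⟦ p == abss (a ∷ lam) ⟧

loads-single : ∀ lam x → loads (false ∷ []) lam (x ∷ []) ≡ (x ℕ.+ absSum lam ∷ []) ∷ []
loads-single [] x = cong (λ y → (y ∷ []) ∷ []) (sym (ℕP.+-identityʳ x))
loads-single (a ∷ lam) x = trans (ListP.++-identityʳ _) (trans (loads-single lam (x ℕ.+ ∣ a ∣))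
  (cong (λ y → (y ∷ []) ∷ []) (ℕP.+-assoc x ∣ a ∣ (absSum lam))))

-- A single positive slot accepts every part and leaves no choice. This makes the unit act as the
-- identity on `I`.
N-whole : ∀ lam → N lam (+ absSum lam ∷ []) ≡ 1
N-whole lam = trans (cong (λ L → ∑ L (λ p → ⟦ p == (absSum lam ∷ []) ⟧)) (loads-single lam 0))
  (cong (λ b → ⟦ b ⟧ ℕ.+ 0) (T⇒≡true {(absSum lam ∷ []) == (absSum lam ∷ [])} (fromWitness refl)))

-- Columns of a matrix and the rank

transposed : ℕ → List (List ℤ) → List (List ℤ)
transposed l []      = replicate l []
transposed l (r ∷ M) = zipWith _∷_ r (transposed l M)

transposed-length : ∀ l M → All (λ r → length r ≡ l) M → length (transposed l M) ≡ l
transposed-length l [] [] = ListP.length-replicate l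
transposed-length l (r ∷ M) (lr ∷ ls) = trans (ListP.length-zipWith _∷_ r _)
  (trans (cong₂ ℕ._⊓_ lr (transposed-length l M ls)) (ℕP.⊓-idem l))

absSum-transposed : ∀ l M → map absSum (transposed l M) ≡ colSums l (map abss M)
absSum-transposed l [] = ListP.map-replicate absSum l []
absSum-transposed l (r ∷ M) = trans (go r (transposed l M)) (cong (zipWith ℕ._+_ (abss r)) (absSum-transposed l M))
  where
  go : ∀ r C → map absSum (zipWith _∷_ r C) ≡ zipWith ℕ._+_ (abss r) (map absSum C)
  go [] C = refl
  go (x ∷ r) [] = refl
  go (x ∷ r) (c ∷ C) = cong (_ ∷_) (go r C)

concat-transposed : ∀ l M → All (λ r → length r ≡ l) M → concat (transposed l M) ↭ concat M
concat-transposed l [] [] = ↭.↭-reflexive (empty l)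
  where
  empty : ∀ l → concat (replicate l []) ≡ ([] {A = ℤ})
  empty zero = refl
  empty (suc l) = empty l
concat-transposed l (r ∷ M) (lr ∷ ls) = ↭-trans (go r (transposed l M) (trans lr (sym (transposed-length l M ls))))
  (↭P.++⁺ˡ r (concat-transposed l M ls))
  where
  go : ∀ r C → length r ≡ length C → concat (zipWith _∷_ r C) ↭ r ++ concat C
  go [] [] len = ↭-refl
  go (x ∷ r) (c ∷ C) len = ↭-prep x (↭-trans (↭P.++⁺ˡ c (go r C (ℕP.suc-injective len)))
    (↭P.shifts c r))

comp₁-↭ : ∀ {r s} → r ↭ s → comp₁ r ↭ comp₁ s
comp₁-↭ = ↭P.filter-↭ (T? ∘ isNonzero)

rank-↭ : ∀ {σ τ} → σ ↭ τ → rank σ ≡ rank τ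
rank-↭ π = sum-↭ (↭P.map⁺ _ π)

-- The sign rule of `𝒩` treats rows and columns alike, so the rank argument for rows carries over to
-- columns.
columns-lines : ∀ {μ ν M} → IsMat μ ν M → Pointwise Line ν (transposed (length ν) M)
columns-lines {μ} {ν} {M} (mat rs cs) = go (trans (absSum-transposed (length ν) M) cs) (nonpos rs)
  where
  NegCol : ℤ → List ℤ → Set
  NegCol b c = T (isNeg b) → All (ℤ._≤ ℤ.0ℤ) c
  go : ∀ {ν C} → map absSum C ≡ abss ν → Pointwise NegCol ν C → Pointwise Line ν C
  go eq [] = []
  go eq (p ∷ ps) = (ListP.∷-injectiveˡ eq , p) ∷ go (ListP.∷-injectiveʳ eq) ps
  signOK-col : ∀ a b {m} → T (signOK a b m) → T (isNeg b) → m ℤ.≤ ℤ.0ℤ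
  signOK-col (+ _) -[1+ _ ] h _ = toWitness h
  signOK-col -[1+ _ ] -[1+ _ ] h _ = toWitness h
  add : ∀ {a ν r C} → Pointwise (λ b m → T (signOK a b m)) ν r → Pointwise NegCol ν C → Pointwise NegCol ν (zipWith _∷_ r C)
  add [] [] = []
  add {a} {b ∷ _} (p ∷ ps) (c ∷ cs) = (λ b<0 → signOK-col a b p b<0 ∷ c b<0) ∷ add ps cs
  empty : ∀ ν → Pointwise NegCol ν (replicate (length ν) [])
  empty [] = []
  empty (b ∷ ν) = (λ _ → []) ∷ empty ν
  nonpos : ∀ {μ M} → Pointwise (Row ν) μ M → Pointwise NegCol ν (transposed (length ν) M)
  nonpos [] = empty ν
  nonpos ((_ , _ , s) ∷ rs) = add s (nonpos rs)

-- Transposing M shows that lam arises from σ by splitting parts.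
diagonal-rank : ∀ {lam σ M} → NonzeroParts σ → M ∈ diagonal lam σ → rank σ < rank lam ⊎ σ ↭ lam
diagonal-rank {lam} {σ} {M} nz M∈ with ∈-filter⁻ (λ M → T? (comp M ≡ℤ lam)) {xs = 𝒩 lam σ} M∈
... | M∈𝒩 , c = conclude (lines-rank nz (columns-lines m))
  where
  m : IsMat lam σ M
  m = ∈-𝒩⁻ {lam} {σ} M∈𝒩
  π : comp (transposed (length σ) M) ↭ lam
  π = ↭-trans (comp₁-↭ (concat-transposed (length σ) M (rows-length (rows m)))) (↭.↭-reflexive (toWitness c))
  conclude : rank σ < rank (comp (transposed (length σ) M)) ⊎ Pointwise OneEntry σ (transposed (length σ) M) →
    rank σ < rank lam ⊎ σ ↭ lam
  conclude (inj₁ lt) = inj₁ (subst (rank σ <_) (rank-↭ π) lt)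
  conclude (inj₂ os) = inj₂ (subst (_↭ lam) (oneEntry-comp os) π)

-- Enumerating and sorting signed compositions

≥-decTotalOrder : DecTotalOrder 0ℓ 0ℓ 0ℓ
≥-decTotalOrder = Flip.decTotalOrder ℤP.≤-decTotalOrder

module ≥ = DecTotalOrder ≥-decTotalOrder
open import Data.List.Sort ≥-decTotalOrder using (sortingAlgorithm)
open import Data.List.Sort.Base ≥.totalOrder using (SortingAlgorithm)
open SortingAlgorithm sortingAlgorithm using (sort; sort-↭; sort-↗)

sorted-↭⇒≡ : ∀ {xs ys : List ℤ} → Linked ℤ._≥_ xs → Linked ℤ._≥_ ys → xs ↭ ys → xs ≡ ys
sorted-↭⇒≡ xs↘ ys↘ π = PW.Pointwise-≡⇒≡
  (↗↭↗⇒≋ ≥.totalOrder xs↘ ys↘ (↭⇒↭ₛ′ ≥.Eq.isEquivalence π))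

comps : ℕ → List (List ℤ)
comps n = concatMap (words (box n)) (upTo (suc n))

withProof-map : ∀ {A : Set} (P : A → Bool) xs → map proj₁ (withProof P xs) ≡ filterᵇ P xs
withProof-map P [] = refl
withProof-map P (x ∷ xs) with T? (P x)
... | yes p = trans (cong (x ∷_) (withProof-map P xs)) (sym (ListP.filter-accept (T? ∘ P) p))
... | no ¬p = trans (withProof-map P xs) (sym (ListP.filter-reject (T? ∘ P) ¬p))

-- Forgetting the validity proofs turns a sum over all generators into one over a duplicate-free
-- list of integer lists, to which `∑-single` applies.
parts-allSignedComps : ∀ n → map parts (allSignedComps n) ≡ filterᵇ (isSignedComp n) (comps n)
parts-allSignedComps n = trans (sym (ListP.map-∘ (withProof (isSignedComp n) (comps n)))) (withProof-map (isSignedComp n) (comps n))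

comps-Unique : ∀ n → Unique (comps n)
comps-Unique n = Uniq.concat⁺
  (AllP.map⁺ {xs = upTo (suc n)} (All.tabulate (λ {l} _ → words-Unique (box-Unique n) l)))
  (AllPairsP.map⁺ {xs = upTo (suc n)} (AllPairs.map disjoint (Uniq.upTo⁺ (suc n))))
  where
  disjoint : ∀ {i j} → i ≢ j → ∀ {v} → ¬ (v ∈ words (box n) i × v ∈ words (box n) j)
  disjoint {i} {j} i≢j (v∈ᵢ , v∈ⱼ) = i≢j (trans (sym (proj₁ (∈-words⁻ i v∈ᵢ))) (proj₁ (∈-words⁻ j v∈ⱼ)))

signedComp⁻ : ∀ {n} l → T (isSignedComp n l) → NonzeroParts l × absSum l ≡ n
signedComp⁻ l h = let h₁ , h₂ = T-∧⁻ h in map-and⁻ isNonzero l h₁ , toWitness h₂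

signedComp⁺ : ∀ {n l} → NonzeroParts l → absSum l ≡ n → T (isSignedComp n l)
signedComp⁺ {n} {l} nz eq = T-∧⁺ (map-and⁺ isNonzero nz) (fromWitness {a? = absSum l ℕ.≟ n} eq)

∣nonzero∣ : ∀ a → T (isNonzero a) → 1 ≤ ∣ a ∣
∣nonzero∣ (+ suc n) _ = s≤s z≤n
∣nonzero∣ -[1+ n ] _ = s≤s z≤n

length≤absSum : ∀ {l} → NonzeroParts l → length l ≤ absSum l
length≤absSum [] = z≤n
length≤absSum {a ∷ _} (a≠0 ∷ nz) = ℕP.+-mono-≤ (∣nonzero∣ a a≠0) (length≤absSum nz)

-- A part counts at most 2 in the rank and at least 1 in size. The bound is what makes the search in
-- `maximal` stop.
rank≤ : ∀ {l} → NonzeroParts l → rank l ≤ absSum l ℕ.+ absSum l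
rank≤ [] = z≤n
rank≤ {a ∷ l} (a≠0 ∷ nz) = subst (rank (a ∷ l) ≤_) (interchange ∣ a ∣ ∣ a ∣ (absSum l) (absSum l))
  (ℕP.+-mono-≤ (part a a≠0) (rank≤ nz))
  where
  open import Algebra.Properties.CommutativeSemigroup ℕP.+-commutativeSemigroup using (interchange)
  part : ∀ a → T (isNonzero a) → suc ⟦ isNeg a ⟧ ≤ ∣ a ∣ ℕ.+ ∣ a ∣
  part (+ suc n) _ = s≤s z≤n
  part -[1+ n ] _ = s≤s (ℕP.≤-trans (s≤s z≤n) (ℕP.m≤n+m (suc n) n))

∈-signedComps : ∀ {n l} → T (isSignedComp n l) → l ∈ filterᵇ (isSignedComp n) (comps n)
∈-signedComps {n} {l} h with signedComp⁻ l h
... | nz , refl = ∈-filter⁺ (T? ∘ isSignedComp n)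
  (∈-concat⁺′ (∈-words⁺ (All.map (λ {x} → ∈-box {absSum l} x) (parts≤absSum l))) (∈-map⁺ (words (box n)) (∈-upTo⁺ (s≤s (length≤absSum nz))))) h

signedComps-Unique : ∀ n → Unique (filterᵇ (isSignedComp n) (comps n))
signedComps-Unique n = Uniq.filter⁺ (T? ∘ isSignedComp n) (comps-Unique n)

-- Every matrix thus belongs to a generator, and no term is lost when matrices are grouped by
-- `comp`.
comp-signed : ∀ {n} (μ ν : SignedComp n) {M} → M ∈ 𝒩 (parts μ) (parts ν) → T (isSignedComp n (comp M))
comp-signed (sc μ v) (sc ν _) {M} M∈ = signedComp⁺ (comp₁-nonzero (concat M))
  (trans (absSum-comp₁ (concat M)) (trans (total (rows (∈-𝒩⁻ {μ} {ν} M∈))) (proj₂ (signedComp⁻ μ v))))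
  where
  total : ∀ {μ M} → Pointwise (Row ν) μ M → absSum (concat M) ≡ absSum μ
  total [] = refl
  total {M = r ∷ M} ((_ , s , _) ∷ rs) = trans (absSum-++ r (concat M)) (cong₂ ℕ._+_ s (total rs))

signedComp-↭ : ∀ {n l l′} → l ↭ l′ → T (isSignedComp n l) → T (isSignedComp n l′)
signedComp-↭ {l = l} π h = let nz , eq = signedComp⁻ l h in
  signedComp⁺ (↭P.All-resp-↭ π nz) (trans (sym (sum-↭ (↭P.map⁺ ∣_∣ π))) eq)

sorted : ∀ {n} → SignedComp n → SignedComp n
sorted (sc l v) = sc (sort l) (signedComp-↭ (↭-sym (sort-↭ l)) v)

sorted-partition : ∀ {n} (μ : SignedComp n) → IsSignedPartition (sorted μ)
sorted-partition (sc l v) = sort-↗ l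

sorted-↭ : ∀ {n} (μ : SignedComp n) → parts (sorted μ) ↭ parts μ
sorted-↭ (sc l v) = sort-↭ l

-- The characters σ ↦ d_{λσλ}

module FieldProperties {c ℓ} (R : Field c ℓ) where
  open Field R renaming (refl to ≈-refl; sym to ≈-sym; trans to ≈-trans; reflexive to ≈-reflexive)
  open SetoidReasoning setoid
  module RΣ = Sum +-commutativeMonoid

  infixr 8 _^ᴿ_
  _^ᴿ_ : Carrier → ℕ → Carrier
  _^ᴿ_ = Defs._^_ R

  ι : ℕ → Carrier
  ι = ℕ→R R

  ι-+ : ∀ i j → ι (i ℕ.+ j) ≈ ι i + ι j
  ι-+ zero j = ≈-sym (+-identityˡ (ι j))
  ι-+ (suc i) j = ≈-trans (+-congˡ (ι-+ i j)) (≈-sym (+-assoc 1# (ι i) (ι j)))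

  ι-* : ∀ i j → ι (i ℕ.* j) ≈ ι i * ι j
  ι-* zero j = ≈-sym (zeroˡ (ι j))
  ι-* (suc i) j = begin
    ι (j ℕ.+ i ℕ.* j)      ≈⟨ ι-+ j (i ℕ.* j) ⟩
    ι j + ι (i ℕ.* j)      ≈⟨ +-cong (≈-sym (*-identityˡ (ι j))) (ι-* i j) ⟩
    1# * ι j + ι i * ι j   ≈⟨ distribʳ (ι j) 1# (ι i) ⟨
    (1# + ι i) * ι j       ∎

  ι-∑ : ∀ {A : Set} (f : A → ℕ) xs → ι (∑ xs f) ≈ RΣ.∑ xs (ι ∘ f)
  ι-∑ f [] = ≈-refl
  ι-∑ f (x ∷ xs) = ≈-trans (ι-+ (f x) (∑ xs f)) (+-congˡ (ι-∑ f xs))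

  ^-+ : ∀ q i j → q ^ᴿ (i ℕ.+ j) ≈ q ^ᴿ i * q ^ᴿ j
  ^-+ q zero j = ≈-sym (*-identityˡ _)
  ^-+ q (suc i) j = ≈-trans (*-congˡ (^-+ q i j)) (≈-sym (*-assoc q _ _))

  ∑-*ˡ : ∀ {A : Set} x (f : A → Carrier) xs → RΣ.∑ xs (λ a → x * f a) ≈ x * RΣ.∑ xs f
  ∑-*ˡ x f [] = ≈-sym (zeroʳ x)
  ∑-*ˡ x f (a ∷ xs) = ≈-trans (+-congˡ (∑-*ˡ x f xs)) (≈-sym (distribˡ x (f a) _))

  ∑-const : ∀ {A : Set} x (xs : List A) → RΣ.∑ xs (λ _ → x) ≈ x * ι (length xs)
  ∑-const x [] = ≈-sym (zeroʳ x)
  ∑-const x (_ ∷ xs) = ≈-trans (+-cong (≈-sym (*-identityʳ x)) (∑-const x xs)) (≈-sym (distribˡ x 1# _))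

  *-cancelʳ : ∀ {x y z} → ¬ (z ≈ 0#) → x * z ≈ y * z → x ≈ y
  *-cancelʳ {x} {y} {z} z≉0 eq with inverse z z≉0
  ... | w , zw≈1 = ≈-trans (undo x) (≈-trans (*-congʳ eq) (≈-sym (undo y)))
    where
    undo : ∀ x → x ≈ x * z * w
    undo x = ≈-sym (≈-trans (*-assoc x z w) (≈-trans (*-congˡ zw≈1) (*-identityʳ x)))

  *-nonzero : ∀ {x y} → ¬ (x ≈ 0#) → ¬ (y ≈ 0#) → ¬ (x * y ≈ 0#)
  *-nonzero x≉0 y≉0 eq = x≉0 (*-cancelʳ y≉0 (≈-trans eq (≈-sym (zeroˡ _))))

  ^-nonzero : ∀ {q} k → ¬ (q ≈ 0#) → ¬ (q ^ᴿ k ≈ 0#)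
  ^-nonzero zero q≉0 eq = 0≉1 (≈-sym eq)
  ^-nonzero (suc k) q≉0 = *-nonzero q≉0 (^-nonzero k q≉0)

  character : Carrier → List ℤ → List ℤ → Carrier
  character q lam σ = d R q lam σ lam

  character-formula : ∀ q lam σ → NonzeroParts lam → character q lam σ ≈ q ^ᴿ negSum σ * ι (N lam σ)
  character-formula q lam σ nz = begin
    RΣ.∑ (diagonal lam σ) (λ M → q ^ᴿ ∣ wt lam σ M ∣)
      ≈⟨ RΣ.∑-cong-∈ (diagonal lam σ) (λ M M∈ → ≈-reflexive (cong (q ^ᴿ_) (wt-diagonal {lam} {σ} M∈))) ⟩
    RΣ.∑ (diagonal lam σ) (λ M → q ^ᴿ negSum σ)
      ≈⟨ ∑-const (q ^ᴿ negSum σ) (diagonal lam σ) ⟩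
    q ^ᴿ negSum σ * ι (length (diagonal lam σ))
      ≈⟨ *-congˡ (≈-reflexive (cong ι (length-diagonal lam σ nz))) ⟩
    q ^ᴿ negSum σ * ι (N lam σ) ∎

  character-product : ∀ q lam μ ν → NonzeroParts lam →
    RΣ.∑ (𝒩 μ ν) (λ M → q ^ᴿ ∣ wt μ ν M ∣ * character q lam (comp M)) ≈ character q lam μ * character q lam ν
  character-product q lam μ ν nz = begin
    RΣ.∑ (𝒩 μ ν) (λ M → q ^ᴿ ∣ wt μ ν M ∣ * character q lam (comp M))
      -- By the weight identity the power of `q` is now the same for all `M`, which reduces the
      -- claim to `N-product`.
      ≈⟨ RΣ.∑-cong-∈ (𝒩 μ ν) term ⟩
    RΣ.∑ (𝒩 μ ν) (λ M → q ^ᴿ (negSum μ ℕ.+ negSum ν) * ι (N lam (comp M)))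
      ≈⟨ ∑-*ˡ _ _ (𝒩 μ ν) ⟩
    q ^ᴿ (negSum μ ℕ.+ negSum ν) * RΣ.∑ (𝒩 μ ν) (λ M → ι (N lam (comp M)))
      ≈⟨ *-congˡ (ι-∑ _ (𝒩 μ ν)) ⟨
    q ^ᴿ (negSum μ ℕ.+ negSum ν) * ι (∑ (𝒩 μ ν) (λ M → N lam (comp M)))
      ≈⟨ *-cong (^-+ q (negSum μ) (negSum ν)) (≈-trans (≈-reflexive (cong ι (N-product lam μ ν nz))) (ι-* (N lam μ) (N lam ν))) ⟩
    (q ^ᴿ negSum μ * q ^ᴿ negSum ν) * (ι (N lam μ) * ι (N lam ν))
      ≈⟨ interchange _ _ _ _ ⟩
    (q ^ᴿ negSum μ * ι (N lam μ)) * (q ^ᴿ negSum ν * ι (N lam ν))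
      ≈⟨ *-cong (character-formula q lam μ nz) (character-formula q lam ν nz) ⟨
    character q lam μ * character q lam ν ∎
    where
    open import Algebra.Properties.CommutativeSemigroup *-commutativeSemigroup using (interchange)
    term : ∀ M → M ∈ 𝒩 μ ν → q ^ᴿ ∣ wt μ ν M ∣ * character q lam (comp M) ≈ q ^ᴿ (negSum μ ℕ.+ negSum ν) * ι (N lam (comp M))
    term M M∈ = begin
      q ^ᴿ ∣ wt μ ν M ∣ * character q lam (comp M)
        ≈⟨ *-congˡ (character-formula q lam (comp M) nz) ⟩
      q ^ᴿ ∣ wt μ ν M ∣ * (q ^ᴿ negSum (comp M) * ι (N lam (comp M)))
        ≈⟨ *-assoc _ _ _ ⟨
      q ^ᴿ ∣ wt μ ν M ∣ * q ^ᴿ negSum (comp M) * ι (N lam (comp M))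
        ≈⟨ *-congʳ (^-+ q ∣ wt μ ν M ∣ (negSum (comp M))) ⟨
      q ^ᴿ (∣ wt μ ν M ∣ ℕ.+ negSum (comp M)) * ι (N lam (comp M))
        ≈⟨ *-congʳ (≈-reflexive (cong (q ^ᴿ_) (wt-negSum (∈-𝒩⁻ {μ} {ν} M∈)))) ⟩
      q ^ᴿ (negSum μ ℕ.+ negSum ν) * ι (N lam (comp M)) ∎

  character-↭ : ∀ q {lam lam′} σ → NonzeroParts lam → NonzeroParts lam′ → lam ↭ lam′ → character q lam σ ≈ character q lam′ σ
  character-↭ q {lam} {lam′} σ nz nz′ π = ≈-trans (character-formula q lam σ nz)
    (≈-trans (*-congˡ (≈-reflexive (cong ι (N-↭ σ π)))) (≈-sym (character-formula q lam′ σ nz′)))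

  -- The positive integer `N lam lam` stays nonzero in characteristic zero, and so does the power of
  -- `q` in front of it.
  character-self : CharacteristicZero R → ∀ {q} → ¬ (q ≈ 0#) → ∀ lam → NonzeroParts lam → ¬ (character q lam lam ≈ 0#)
  character-self char0 {q} q≉0 lam nz eq with N lam lam | N-self lam | character-formula q lam lam nz
  ... | suc k | _ | formula = *-nonzero (^-nonzero (negSum lam) q≉0) (char0 k) (≈-trans (≈-sym formula) eq)

  character-nonzero : ∀ q lam σ → ¬ (character q lam σ ≈ 0#) → ∃ λ M → M ∈ diagonal lam σ
  character-nonzero q lam σ ≉0 with diagonal lam σ
  ... | []    = contradiction ≈-refl ≉0
  ... | M ∷ _ = M , here refl

  module _ {m ℓm} (V : LeftModule ring m ℓm) where
    open LeftModule V
    private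
      module VΣ = Sum +ᴹ-commutativeMonoid
      module ≈ᴹ = SetoidReasoning (CommutativeMonoid.setoid +ᴹ-commutativeMonoid)

    filter-*ₗ : ∀ {A : Set} (P : A → Bool) (w : A → Carrier) g xs →
      sumR R (map w (filterᵇ P xs)) *ₗ g ≈ᴹ VΣ.∑ xs (λ a → if P a then w a *ₗ g else 0ᴹ)
    filter-*ₗ P w g [] = *ₗ-zeroˡ g
    filter-*ₗ P w g (a ∷ xs) with P a
    ... | true  = ≈ᴹ-trans (*ₗ-distribʳ g (w a) _) (+ᴹ-congˡ (filter-*ₗ P w g xs))
    ... | false = ≈ᴹ-trans (filter-*ₗ P w g xs) (≈ᴹ-sym (+ᴹ-identityˡ _))

    -- Each matrix contributes to the coefficient of one generator only, so expanding all
    -- coefficients gives a plain sum over matrices. `G` is defined on bare lists because `comp M`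
    -- comes without a validity proof.
    structure-sum : ∀ {n} q (μ ν : SignedComp n) (G : List ℤ → Carrierᴹ) →
      VΣ.∑ (allSignedComps n) (λ σ → d R q (parts μ) (parts ν) (parts σ) *ₗ G (parts σ)) ≈ᴹ
      VΣ.∑ (𝒩 (parts μ) (parts ν)) (λ M → q ^ᴿ ∣ wt (parts μ) (parts ν) M ∣ *ₗ G (comp M))
    structure-sum {n} q μ ν G = ≈ᴹ.begin
      VΣ.∑ (allSignedComps n) (F ∘ parts)
        ≈ᴹ.≡⟨ VΣ.∑-map F parts (allSignedComps n) ⟨
      VΣ.∑ (map parts (allSignedComps n)) F
        ≈ᴹ.≡⟨ cong (λ L → VΣ.∑ L F) (parts-allSignedComps n) ⟩
      VΣ.∑ L F
        ≈ᴹ.≈⟨ VΣ.∑-cong L (λ σ → filter-*ₗ (λ M → comp M ≡ℤ σ) w (G σ) Ms) ⟩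
      VΣ.∑ L (λ σ → VΣ.∑ Ms (λ M → if comp M ≡ℤ σ then w M *ₗ G σ else 0ᴹ))
        ≈ᴹ.≈⟨ VΣ.∑-swap _ L Ms ⟩
      VΣ.∑ Ms (λ M → VΣ.∑ L (λ σ → if comp M ≡ℤ σ then w M *ₗ G σ else 0ᴹ))
        ≈ᴹ.≈⟨ VΣ.∑-cong-∈ Ms (λ M M∈ → ≈ᴹ-trans
             (VΣ.∑-single (signedComps-Unique n) (∈-signedComps (comp-signed μ ν M∈)) (λ σ σ≢ → if-false (w M *ₗ G σ) (λ h → σ≢ (sym (toWitness h)))))
             (≈ᴹ-reflexive (cong (λ b → if b then w M *ₗ G (comp M) else 0ᴹ) (T⇒≡true {comp M ≡ℤ comp M} (fromWitness refl))))) ⟩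
      VΣ.∑ Ms (λ M → w M *ₗ G (comp M)) ≈ᴹ.∎
      where
      Ms = 𝒩 (parts μ) (parts ν)
      L = filterᵇ (isSignedComp n) (comps n)
      w : List (List ℤ) → Carrier
      w M = q ^ᴿ ∣ wt (parts μ) (parts ν) M ∣
      F : List ℤ → Carrierᴹ
      F σ = d R q (parts μ) (parts ν) σ *ₗ G σ
      if-false : ∀ {b} x → ¬ (T b) → (if b then x else 0ᴹ) ≈ᴹ 0ᴹ
      if-false x h = ≈ᴹ-reflexive (cong (λ b → if b then x else 0ᴹ) (¬T⇒≡false h))

-- The modules I(λ) and the classification

partsNonzero : ∀ {n} (μ : SignedComp n) → NonzeroParts (parts μ)
partsNonzero (sc l v) = proj₁ (signedComp⁻ l v)

module OneDimensional {c ℓ} (R : Field c ℓ) (q : Field.Carrier R) {n : ℕ} (lam : SignedComp n) where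
  open Field R renaming (refl to ≈-refl; sym to ≈-sym; trans to ≈-trans; reflexive to ≈-reflexive)
  open FieldProperties R
  open SetoidReasoning setoid

  private
    χ : List ℤ → Carrier
    χ = character q (parts lam)
    V = I R q lam
    module V = SigmaRep V

  character-whole : χ (+ n ∷ []) ≈ 1#
  character-whole = begin
    χ (+ n ∷ [])                                       ≈⟨ character-formula q (parts lam) (+ n ∷ []) (partsNonzero lam) ⟩
    q ^ᴿ negSum (+ n ∷ []) * ι (N (parts lam) (+ n ∷ [])) ≈⟨ *-identityˡ _ ⟩
    ι (N (parts lam) (+ n ∷ []))                       ≈⟨ ≈-reflexive (cong ι (subst (λ k → N (parts lam) (+ k ∷ []) ≡ 1) (proj₂ (signedComp⁻ (parts lam) (valid lam))) (N-whole (parts lam)))) ⟩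
    1# + 0#                                            ≈⟨ +-identityʳ 1# ⟩
    1#                                                 ∎

  isSigmaModule : IsSigmaModule R V q
  isSigmaModule = record
    { act-cong = λ μ → *-congˡ
    ; act-+ = λ μ → distribˡ (χ (parts μ))
    ; act-*ₗ = λ μ r x → x∙yz≈y∙xz (χ (parts μ)) r x
    ; act-rel = relation
    ; act-unit = λ { μ refl x → ≈-trans (*-congʳ character-whole) (*-identityˡ x) }
    }
    where
    open import Algebra.Properties.CommutativeSemigroup *-commutativeSemigroup using (x∙yz≈y∙xz)
    relation : ∀ μ ν x → χ (parts μ) * (χ (parts ν) * x) ≈
      sumᴹ R V (map (λ σ → d R q (parts μ) (parts ν) (parts σ) * (χ (parts σ) * x)) (allSignedComps n))
    relation μ ν x = begin
      χ (parts μ) * (χ (parts ν) * x)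
        ≈⟨ *-assoc _ _ x ⟨
      χ (parts μ) * χ (parts ν) * x
        ≈⟨ *-congʳ (character-product q (parts lam) (parts μ) (parts ν) (partsNonzero lam)) ⟨
      RΣ.∑ Ms (λ M → w M * χ (comp M)) * x
        ≈⟨ *-comm _ x ⟩
      x * RΣ.∑ Ms (λ M → w M * χ (comp M))
        ≈⟨ ∑-*ˡ x _ Ms ⟨
      RΣ.∑ Ms (λ M → x * (w M * χ (comp M)))
        ≈⟨ RΣ.∑-cong Ms (λ M → ≈-trans (*-comm x _) (*-assoc (w M) _ x)) ⟩
      RΣ.∑ Ms (λ M → w M * (χ (comp M) * x))
        ≈⟨ structure-sum V.carrierModule q μ ν (λ σ → χ σ * x) ⟨
      RΣ.∑ (allSignedComps n) (λ σ → d R q (parts μ) (parts ν) (parts σ) * (χ (parts σ) * x)) ∎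
      where
      Ms = 𝒩 (parts μ) (parts ν)
      w : List (List ℤ) → Carrier
      w M = q ^ᴿ ∣ wt (parts μ) (parts ν) M ∣

  irreducible : Irreducible R V
  irreducible = record
    { nonzero = 1# , λ eq → 0≉1 (≈-sym eq)
    ; simple = λ S isSub (x , Sx , x≉0) y → let x⁻¹ , xx⁻¹≈1 = inverse x x≉0 in
        IsSubmodule.resp isSub
          (≈-trans (*-assoc y x⁻¹ x) (≈-trans (*-congˡ (≈-trans (*-comm x⁻¹ x) xx⁻¹≈1)) (*-identityʳ y)))
          (IsSubmodule.*ₗ-closed isSub (y * x⁻¹) Sx)
    }

module _ {c ℓ} (R : Field c ℓ) where
  open Field R renaming (refl to ≈-refl; sym to ≈-sym; trans to ≈-trans; reflexive to ≈-reflexive)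
  open FieldProperties R

  -- The image `f 1#` is a nonzero scalar. Linearity and equivariance evaluate `f` at the action of
  -- `α` on `1#` in two ways, and `f 1#` cancels.
  iso⇒character : ∀ {n} q (lam lam′ : SignedComp n) → Iso R (I R q lam) (I R q lam′) →
    ∀ (α : SignedComp n) → character q (parts lam) (parts α) ≈ character q (parts lam′) (parts α)
  iso⇒character q lam lam′ iso α = *-cancelʳ f1≉0 (≈-trans (≈-sym (f-*ₗ _ 1#)) (f-act α 1#))
    where
    open Iso iso
    f0≈0 : f 0# ≈ 0#
    f0≈0 = ≈-trans (f-cong (≈-sym (zeroˡ 0#))) (≈-trans (f-*ₗ 0# 0#) (zeroˡ _))
    f1≉0 : ¬ (f 1# ≈ 0#)
    f1≉0 eq = 0≉1 (≈-sym (injective (≈-trans eq (≈-sym f0≈0))))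

  -- Equality of the characters at `lam` and at `lam′` carries `character-self` over to the mixed
  -- values, so each partition splits into the other; the rank cannot rise strictly in both
  -- directions.
  iso⇒≡ : CharacteristicZero R → ∀ {n} q → ¬ (q ≈ 0#) → (lam lam′ : SignedComp n) →
    IsSignedPartition lam → IsSignedPartition lam′ → Iso R (I R q lam) (I R q lam′) → parts lam ≡ parts lam′
  iso⇒≡ char0 q q≉0 lam lam′ lam↘ lam′↘ iso =
    sorted-↭⇒≡ lam↘ lam′↘ (conclude
      (diagonal-rank {parts lam′} {parts lam} (partsNonzero lam) (proj₂ splits))
      (diagonal-rank {parts lam} {parts lam′} (partsNonzero lam′) (proj₂ splits′)))
    where
    χ≈ = iso⇒character q lam lam′ iso
    splits : ∃ λ M → M ∈ diagonal (parts lam′) (parts lam)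
    splits = character-nonzero q (parts lam′) (parts lam) (λ eq → character-self char0 q≉0 (parts lam) (partsNonzero lam) (≈-trans (χ≈ lam) eq))
    splits′ : ∃ λ M → M ∈ diagonal (parts lam) (parts lam′)
    splits′ = character-nonzero q (parts lam) (parts lam′) (λ eq → character-self char0 q≉0 (parts lam′) (partsNonzero lam′) (≈-trans (≈-sym (χ≈ lam′)) eq))
    conclude : ∀ {l l′} → rank l < rank l′ ⊎ l ↭ l′ → rank l′ < rank l ⊎ l′ ↭ l → l ↭ l′
    conclude (inj₂ π) _ = π
    conclude (inj₁ lt) (inj₂ π) = ↭-sym π
    conclude (inj₁ lt) (inj₁ gt) = contradiction lt (ℕP.<-asym gt)

-- Irreducible modules are one-dimensional

module Classification {c ℓ m ℓm} (R : Field c ℓ) (em : ExcludedMiddle (c ⊔ ℓ ⊔ m ⊔ ℓm))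
  {n : ℕ} (1≤n : 1 ≤ n) (q : Field.Carrier R)
  (V : SigmaRep R n m ℓm) (isModule : IsSigmaModule R V q) (irr : Irreducible R V) where
  open Field R renaming (refl to ≈-refl; sym to ≈-sym; trans to ≈-trans; reflexive to ≈-reflexive)
  open FieldProperties R
  open SigmaRep V
  open IsSigmaModule isModule
  open Irreducible irr
  private
    module VΣ = Sum +ᴹ-commutativeMonoid
    module ≈ᴹ = SetoidReasoning (CommutativeMonoid.setoid +ᴹ-commutativeMonoid)

  -- Irreducibility speaks of elements that are not zero, and equality in `V` comes with no decision
  -- procedure; excluded middle removes the double negation.
  stableᴹ : ∀ {x y} → ¬ ¬ (x ≈ᴹ y) → x ≈ᴹ y
  stableᴹ {x} {y} h with em {Lift (c ⊔ ℓ ⊔ m ⊔ ℓm) (x ≈ᴹ y)}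
  ... | yes (lift eq) = eq
  ... | no ¬eq = contradiction (λ eq → ¬eq (lift eq)) h

  stable : ∀ {x y} → ¬ ¬ (x ≈ y) → x ≈ y
  stable {x} {y} h with em {Lift (c ⊔ ℓ ⊔ m ⊔ ℓm) (x ≈ y)}
  ... | yes (lift eq) = eq
  ... | no ¬eq = contradiction (λ eq → ¬eq (lift eq)) h

  act-0 : ∀ μ → act μ 0ᴹ ≈ᴹ 0ᴹ
  act-0 μ = ≈ᴹ-trans (act-cong μ (≈ᴹ-sym (*ₗ-zeroˡ 0ᴹ))) (≈ᴹ-trans (act-*ₗ μ 0# 0ᴹ) (*ₗ-zeroˡ _))

  ActsNontrivially : SignedComp n → Set (m ⊔ ℓm)
  ActsNontrivially μ = ∃ λ x → ¬ (act μ x ≈ᴹ 0ᴹ)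

  Maximal : SignedComp n → Set (m ⊔ ℓm)
  Maximal lam = ActsNontrivially lam × (∀ σ → rank (parts lam) < rank (parts σ) → ∀ x → act σ x ≈ᴹ 0ᴹ)

  maximal : ∃ Maximal
  -- The search starts at the unit, which acts as the identity on a nonzero module. Each round
  -- raises the rank, and no rank exceeds `n ℕ.+ n`.
  maximal = search (n ℕ.+ n) whole
      (proj₁ nonzero , λ eq → proj₂ nonzero (≈ᴹ-trans (≈ᴹ-sym (act-unit whole refl _)) eq))
      (ℕP.m≤n+m (n ℕ.+ n) (rank (parts whole)))
    where
    whole : SignedComp n
    whole = sc (+ n ∷ []) (signedComp⁺ (nz 1≤n ∷ []) (ℕP.+-identityʳ n))
      where
      nz : ∀ {n} → 1 ≤ n → T (isNonzero (+ n))
      nz (s≤s _) = _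
    bound : ∀ (σ : SignedComp n) → rank (parts σ) ≤ n ℕ.+ n
    bound (sc l v) = let nz , eq = signedComp⁻ l v in subst (λ k → rank l ≤ k ℕ.+ k) eq (rank≤ nz)
    search : ∀ fuel lam → ActsNontrivially lam → n ℕ.+ n ≤ rank (parts lam) ℕ.+ fuel → ∃ Maximal
    search fuel lam alive h with em {Lift (c ⊔ ℓ ⊔ m ⊔ ℓm) (∃ λ σ → rank (parts lam) < rank (parts σ) × ActsNontrivially σ)}
    ... | no none = lam , alive , λ σ lt x → stableᴹ (λ ≉0 → none (lift (σ , lt , x , ≉0)))
    search zero lam alive h | yes (lift (σ , lt , alive′)) =
      contradiction (ℕP.≤-trans lt (bound σ)) (ℕP.≤⇒≯ (subst (n ℕ.+ n ≤_) (ℕP.+-identityʳ _) h))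
    search (suc fuel) lam alive h | yes (lift (σ , lt , alive′)) =
      search fuel σ alive′ (ℕP.≤-trans (subst (n ℕ.+ n ≤_) (ℕP.+-suc (rank (parts lam)) fuel) h) (ℕP.+-monoˡ-≤ fuel lt))

  lam : SignedComp n
  lam = proj₁ maximal

  χ : SignedComp n → Carrier
  χ α = character q (parts lam) (parts α)

  -- The action of E_σ, extended by zero to arbitrary lists σ.
  actOn : Carrierᴹ → List ℤ → Carrierᴹ
  actOn x l with T? (isSignedComp n l)
  ... | yes v = act (sc l v) x
  ... | no _  = 0ᴹ

  actOn-parts : ∀ x μ → actOn x (parts μ) ≈ᴹ act μ x
  actOn-parts x (sc l v) with T? (isSignedComp n l)
  ... | yes v′ = ≈ᴹ-reflexive (cong (λ v → act (sc l v) x) (T-irrelevant v′ v))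
  ... | no ¬v  = contradiction v ¬v

  actOn-higher : ∀ x l → rank (parts lam) < rank l → actOn x l ≈ᴹ 0ᴹ
  actOn-higher x l lt with T? (isSignedComp n l)
  ... | yes v = proj₂ (proj₂ maximal) (sc l v) lt x
  ... | no _  = ≈ᴹ-refl

  act-lam : ∀ α x → act lam (act α x) ≈ᴹ χ α *ₗ act lam x
  act-lam α x = ≈ᴹ.begin
    act lam (act α x)
      ≈ᴹ.≈⟨ act-rel lam α x ⟩
    VΣ.∑ (allSignedComps n) (λ σ → d R q (parts lam) (parts α) (parts σ) *ₗ act σ x)
      ≈ᴹ.≈⟨ VΣ.∑-cong (allSignedComps n) (λ σ → *ₗ-congˡ (actOn-parts x σ)) ⟨
    VΣ.∑ (allSignedComps n) (λ σ → d R q (parts lam) (parts α) (parts σ) *ₗ actOn x (parts σ))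
      ≈ᴹ.≈⟨ structure-sum carrierModule q lam α (actOn x) ⟩
    VΣ.∑ Ms (λ M → w M *ₗ actOn x (comp M))
      ≈ᴹ.≈⟨ VΣ.∑-cong-∈ Ms term ⟩
    VΣ.∑ Ms (λ M → if comp M ≡ℤ parts lam then w M *ₗ actOn x (parts lam) else 0ᴹ)
      ≈ᴹ.≈⟨ filter-*ₗ carrierModule (λ M → comp M ≡ℤ parts lam) w _ Ms ⟨
    χ α *ₗ actOn x (parts lam)
      ≈ᴹ.≈⟨ *ₗ-congˡ (actOn-parts x lam) ⟩
    χ α *ₗ act lam x ≈ᴹ.∎
    where
    Ms = 𝒩 (parts lam) (parts α)
    w : List (List ℤ) → Carrier
    w M = q ^ᴿ ∣ wt (parts lam) (parts α) M ∣
    term : ∀ M → M ∈ Ms → w M *ₗ actOn x (comp M) ≈ᴹ (if comp M ≡ℤ parts lam then w M *ₗ actOn x (parts lam) else 0ᴹ)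
    -- If a row gains rank, the generator of `comp M` acts as zero by maximality; the remaining
    -- matrices are those that `d` counts at `parts lam`.
    term M M∈ with lines-rank (partsNonzero lam) (rows-lines (rows (∈-𝒩⁻ {parts lam} {parts α} M∈)))
    ... | inj₁ lt = ≈ᴹ-trans (*ₗ-congˡ (actOn-higher x (comp M) lt)) (≈ᴹ-trans (*ₗ-zeroʳ (w M))
            (≈ᴹ-reflexive (cong (λ b → if b then w M *ₗ actOn x (parts lam) else 0ᴹ)
              (sym (¬T⇒≡false {comp M ≡ℤ parts lam} (λ h → ℕP.<⇒≢ lt (cong rank (sym (toWitness h)))))))))
    ... | inj₂ os = ≈ᴹ-reflexive (trans (cong (λ l → w M *ₗ actOn x l) eq)
            (cong (λ b → if b then w M *ₗ actOn x (parts lam) else 0ᴹ) (sym (T⇒≡true {comp M ≡ℤ parts lam} (fromWitness eq)))))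
      where eq = oneEntry-comp os

  -- By act-lam the kernel of E_λ is a submodule, so it vanishes.
  act-lam-injective : ∀ {x} → act lam x ≈ᴹ 0ᴹ → x ≈ᴹ 0ᴹ
  act-lam-injective {x} eq = stableᴹ (λ x≉0 →
    proj₂ (proj₁ (proj₂ maximal)) (lower (simple Kernel isSubmodule (x , lift eq , x≉0) (proj₁ (proj₁ (proj₂ maximal))))))
    where
    Kernel : Carrierᴹ → Set (c ⊔ ℓ ⊔ m ⊔ ℓm)
    Kernel y = Lift (c ⊔ ℓ ⊔ m ⊔ ℓm) (act lam y ≈ᴹ 0ᴹ)
    isSubmodule : IsSubmodule R V Kernel
    isSubmodule = record
      { resp = λ x≈y (lift p) → lift (≈ᴹ-trans (act-cong lam (≈ᴹ-sym x≈y)) p)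
      ; 0-closed = lift (act-0 lam)
      ; +-closed = λ (lift p) (lift p′) → lift (≈ᴹ-trans (act-+ lam _ _) (≈ᴹ-trans (+ᴹ-cong p p′) (+ᴹ-identityˡ 0ᴹ)))
      ; *ₗ-closed = λ r (lift p) → lift (≈ᴹ-trans (act-*ₗ lam r _) (≈ᴹ-trans (*ₗ-congˡ p) (*ₗ-zeroʳ r)))
      ; act-closed = λ α (lift p) → lift (≈ᴹ-trans (act-lam α _) (≈ᴹ-trans (*ₗ-congˡ p) (*ₗ-zeroʳ (χ α))))
      }

  private
    *ₗ-cancels : ∀ r x → r *ₗ x +ᴹ (- r) *ₗ x ≈ᴹ 0ᴹ
    *ₗ-cancels r x = ≈ᴹ-trans (≈ᴹ-sym (*ₗ-distribʳ x r (- r))) (≈ᴹ-trans (*ₗ-congʳ (-‿inverseʳ r)) (*ₗ-zeroˡ x))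

  -- `act lam` cannot tell `act α x` from `χ α *ₗ x`, and it is injective.
  act-scalar : ∀ α x → act α x ≈ᴹ χ α *ₗ x
  act-scalar α x = GroupProperties.∙-cancelʳ +ᴹ-group ((- χ α) *ₗ x) _ _
    (≈ᴹ-trans (act-lam-injective vanish) (≈ᴹ-sym (*ₗ-cancels (χ α) x)))
    where
    vanish : act lam (act α x +ᴹ (- χ α) *ₗ x) ≈ᴹ 0ᴹ
    vanish = ≈ᴹ-trans (act-+ lam _ _) (≈ᴹ-trans (+ᴹ-cong (act-lam α x) (act-*ₗ lam (- χ α) x)) (*ₗ-cancels (χ α) (act lam x)))

  x₀ : Carrierᴹ
  x₀ = proj₁ nonzero

  -- As every generator acts by scalars, the line through `x₀` is a nonzero submodule, hence
  -- everything.
  coordinates : ∀ y → Σ Carrier λ r → y ≈ᴹ r *ₗ x₀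
  coordinates y = lower (simple Span isSubmodule (x₀ , lift (1# , ≈ᴹ-sym (*ₗ-identityˡ x₀)) , proj₂ nonzero) y)
    where
    Span : Carrierᴹ → Set (c ⊔ ℓ ⊔ m ⊔ ℓm)
    Span y = Lift (c ⊔ ℓ ⊔ m ⊔ ℓm) (Σ Carrier λ r → y ≈ᴹ r *ₗ x₀)
    scaled : ∀ s {y} → Span y → Span (s *ₗ y)
    scaled s (lift (r , p)) = lift (s * r , ≈ᴹ-trans (*ₗ-congˡ p) (≈ᴹ-sym (*ₗ-assoc s r x₀)))
    respects : ∀ {x y} → x ≈ᴹ y → Span x → Span y
    respects x≈y (lift (r , p)) = lift (r , ≈ᴹ-trans (≈ᴹ-sym x≈y) p)
    isSubmodule : IsSubmodule R V Span
    isSubmodule = record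
      { resp = respects
      ; 0-closed = lift (0# , ≈ᴹ-sym (*ₗ-zeroˡ x₀))
      ; +-closed = λ (lift (r , p)) (lift (s , p′)) → lift (r + s , ≈ᴹ-trans (+ᴹ-cong p p′) (≈ᴹ-sym (*ₗ-distribʳ x₀ r s)))
      ; *ₗ-closed = scaled
      ; act-closed = λ α {x} Sx → respects (≈ᴹ-sym (act-scalar α x)) (scaled (χ α) Sx)
      }

  scalar-nonzero : ∀ {r} → r *ₗ x₀ ≈ᴹ 0ᴹ → r ≈ 0#
  scalar-nonzero {r} eq = stable (λ r≉0 → let r⁻¹ , rr⁻¹≈1 = inverse r r≉0 in
    proj₂ nonzero (≈ᴹ-trans (≈ᴹ-sym (*ₗ-identityˡ x₀)) (≈ᴹ-trans (*ₗ-congʳ (≈-trans (≈-sym rr⁻¹≈1) (*-comm r r⁻¹)))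
      (≈ᴹ-trans (*ₗ-assoc r⁻¹ r x₀) (≈ᴹ-trans (*ₗ-congˡ eq) (*ₗ-zeroʳ r⁻¹))))))

  coordinate-unique : ∀ {r s} → r *ₗ x₀ ≈ᴹ s *ₗ x₀ → r ≈ s
  coordinate-unique {r} {s} eq = GroupProperties.∙-cancelʳ +-group (- s) r s (≈-trans
    (scalar-nonzero (≈ᴹ-trans (*ₗ-distribʳ x₀ r (- s)) (≈ᴹ-trans (+ᴹ-congʳ eq) (*ₗ-cancels s x₀))))
    (≈-sym (-‿inverseʳ s)))

  χ-sorted : ∀ α → χ α ≈ character q (parts (sorted lam)) (parts α)
  χ-sorted α = character-↭ q (parts α) (partsNonzero lam) (partsNonzero (sorted lam)) (↭-sym (sorted-↭ lam))

  -- The map takes the coordinate with respect to `x₀`; compatibility with sums, scalars and the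
  -- action follows from uniqueness of that coordinate.
  iso : Iso R V (I R q (sorted lam))
  iso = record
    { f = coord
    ; f-cong = λ {x} {y} x≈y → unique (≈ᴹ-trans x≈y (spec y))
    ; f-+ = λ x y → unique (≈ᴹ-trans (+ᴹ-cong (spec x) (spec y)) (≈ᴹ-sym (*ₗ-distribʳ x₀ _ _)))
    ; f-*ₗ = λ r x → unique (≈ᴹ-trans (*ₗ-congˡ (spec x)) (≈ᴹ-sym (*ₗ-assoc r _ x₀)))
    ; f-act = λ μ x → ≈-trans (unique (≈ᴹ-trans (act-scalar μ x) (≈ᴹ-trans (*ₗ-congˡ (spec x)) (≈ᴹ-sym (*ₗ-assoc (χ μ) _ x₀)))))
        (*-congʳ (χ-sorted μ))
    ; injective = λ {x} {y} fx≈fy → ≈ᴹ-trans (spec x) (≈ᴹ-trans (*ₗ-congʳ fx≈fy) (≈ᴹ-sym (spec y)))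
    ; surjective = λ r → r *ₗ x₀ , unique ≈ᴹ-refl
    }
    where
    coord : Carrierᴹ → Carrier
    coord y = proj₁ (coordinates y)
    spec : ∀ y → y ≈ᴹ coord y *ₗ x₀
    spec y = proj₂ (coordinates y)
    unique : ∀ {y r} → y ≈ᴹ r *ₗ x₀ → coord y ≈ r
    unique {y} p = coordinate-unique (≈ᴹ-trans (≈ᴹ-sym (spec y)) p)

theorem8p7 : ∀ {c ℓ m ℓm} (R : Field c ℓ) → CharacteristicZero R →
    ExcludedMiddle (c ⊔ ℓ ⊔ m ⊔ ℓm) →
    (n : ℕ) → 1 ≤ n → (q : Field.Carrier R) → ¬ (Field._≈_ R q (Field.0# R)) →
    ((lam : SignedComp n) → IsSignedPartition lam →
    IsSigmaModule R (I R q lam) q × Irreducible R (I R q lam))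
    × ((lam lam′ : SignedComp n) → IsSignedPartition lam → IsSignedPartition lam′ →
    Iso R (I R q lam) (I R q lam′) → parts lam ≡ parts lam′)
    × ((V : SigmaRep R n m ℓm) → IsSigmaModule R V q → Irreducible R V →
    ∃ λ lam → IsSignedPartition lam × Iso R V (I R q lam))
theorem8p7 R char0 em n 1≤n q q≉0 =
  (λ lam _ → OneDimensional.isSigmaModule R q lam , OneDimensional.irreducible R q lam) ,
  iso⇒≡ R char0 q q≉0 ,
  λ V isModule irr → let open Classification R em 1≤n q V isModule irr in
    sorted lam , sorted-partition lam , iso
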